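{- Suppose that $(\Gamma,G)\in\mathcal{OG}(4)$ is basic of quasiprimitive type. Then $G$ has a unique minimal normal subgroup $N=T^k$ for some finite nonabelian simple group $T$, $k\leq 2$, and one of the following holds: (a) $k=1$, and there are many known examples; or (b) $k=2$, $G=N\cdot 2$, and $\Gamma$ is a Cayley graph for $N$ as in the Twisted Wreath Construction described in the context; or (c) $k=2$, $N$ is not regular (on the vertex set of $\Gamma$), and there are many known examples.
   Context: All graphs are finite, simple and undirected. $\mathcal{OG}(4)$ is the set of pairs $(\Gamma,G)$ where $\Gamma$ is a connected graph of valency $4$ with vertex set $X$, $G\leq\mathrm{Aut}(\Gamma)$ is transitive on $X$ and on edges, and $\Gamma$ is $G$-oriented: there is a $G$-orbit $\Delta\subset X\times X$, disjoint from $\Delta^*=\{(y,x)\mid (x,y)\in\Delta\}$, such that the edges of $\Gamma$ are exactly the pairs $\{x,y\}$ with $(x,y)\in\Delta$ or $(y,x)\in\Delta$. A pair $(\Gamma,G)\in\mathcal{OG}(4)$ is basic of quasiprimitive type if $G$ is quasiprimitive on $X$, that is, every nontrivial normal subgroup of $G$ is transitive on $X$. A permutation group is regular if it is transitive and only the identity fixes a point. $G=N\cdot 2$ means that $N$ is normal of index $2$ in $G$. "Examples" in (a) and (c) means pairs $(\Gamma,G)\in\mathcal{OG}(4)$ that are basic of quasiprimitive type and satisfy the conditions of that case. For a group $N$ and an inverse-closed subset $S\subseteq N\setminus\{1_N\}$, the Cayley graph $\mathrm{Cay}(N,S)$ has vertex set $N$ and edges the pairs $\{x,y\}$ with $xy^{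 -1}\in S$; $N$ acts on it by right multiplication as a group of automorphisms regular on vertices. Twisted Wreath Construction: let $T$ be a nonabelian simple group, and let $\{a,b\}$ be a generating set for $T$ such that no automorphism of $T$ interchanges $a$ and $b$. Let $N=T\times T$, $S_0=\{(a,b),(b,a)\}$, $S=S_0\cup S_0^{ -1}$, and $\Gamma=\mathrm{Cay}(N,S)$. Let $\tau\in\mathrm{Aut}(N)$ be the map $\tau:(x,y)\mapsto(y,x)$, and let $G=N\rtimes\langle\tau\rangle$. (Here $N$ acts by right multiplication and $\tau$ acts naturally on the vertex set $N$.) -}

module Defs where

open import Algebra.Bundles using (Group)
import Algebra.Construct.DirectProduct as DirectProduct
import Algebra.Construct.Pointwise as Pointwise
open import Algebra.Definitions using (Commutative)
open import Algebra.Morphism.Structures using (module GroupMorphisms)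
open import Data.Fin.Base using (Fin)
open import Data.Fin.Permutation
  using (Permutation′; _⟨$⟩ʳ_; _⟨$⟩ˡ_; _∘ₚ_; id; flip; inverseˡ; inverseʳ)
  renaming (_≈_ to _≈ₚ_)
open import Data.List.Base using (length; filter; allFin)
open import Data.Nat.Base using (ℕ; _≤_)
open import Data.Product.Base using (Σ-syntax; ∃; ∃-syntax; _×_; _,_; proj₁; proj₂; swap)
open import Data.Sum.Base using (_⊎_)
open import Data.Unit.Base using (⊤; tt)
open import Function.Bundles using (Inverse; _⇔_)
open import Level using (0ℓ)
open import Relation.Binary.Construct.Closure.ReflexiveTransitive using (Star)
open import Relation.Binary.Core using (Rel)
open import Relation.Binary.Definitions using (Irreflexive; Symmetric) renaming (Decidable to Decidable₂)
open import Relation.Binary.PropositionalEquality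
  using (_≡_; refl; sym; trans; cong; setoid)
open import Relation.Nullary using (¬_; yes)
open import Relation.Unary using (Pred; Decidable; _⊆_; _≐_)

------------------------------------------------------------------------
-- Subgroups

-- Subgroups have decidable membership: every group below is finite, and
-- a subset of a finite set is classically just a Boolean-valued function.
record Subgroup (G : Group 0ℓ 0ℓ) : Set₁ where
  open Group G
  field
    Mem   : Pred Carrier 0ℓ
    mem?  : Decidable Mem
    resp  : ∀ {x y} → x ≈ y → Mem x → Mem y
    ε∈    : Mem ε
    ∙∈    : ∀ {x y} → Mem x → Mem y → Mem (x ∙ y)
    ⁻¹∈   : ∀ {x} → Mem x → Mem (x ⁻¹)

open Subgroup public

module _ {G : Group 0ℓ 0ℓ} where
  open Group G

  subgroup→group : Subgroup G → Group 0ℓ 0ℓ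
  subgroup→group H = record
    { Carrier = ∃ (Mem H)
    ; _≈_     = λ x y → proj₁ x ≈ proj₁ y
    ; _∙_     = λ x y → proj₁ x ∙ proj₁ y , ∙∈ H (proj₂ x) (proj₂ y)
    ; ε       = ε , ε∈ H
    ; _⁻¹     = λ x → proj₁ x ⁻¹ , ⁻¹∈ H (proj₂ x)
    ; isGroup = record
      { isMonoid = record
        { isSemigroup = record
          { isMagma = record
            { isEquivalence = record
              { refl  = Group.refl G
              ; sym   = Group.sym G
              ; trans = Group.trans G
              }
            ; ∙-cong = ∙-cong
            }
          ; assoc = λ x y z → assoc (proj₁ x) (proj₁ y) (proj₁ z)
          }
        ; identity = (λ x → identityˡ (proj₁ x)) , (λ x → identityʳ (proj₁ x))
        }
      ; inverse = (λ x → G-inverseˡ (proj₁ x)) , (λ x → G-inverseʳ (proj₁ x))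
      ; ⁻¹-cong = ⁻¹-cong
      }
    }
    where
    open Group G using () renaming (inverseˡ to G-inverseˡ; inverseʳ to G-inverseʳ)

  Nontrivial : Subgroup G → Set
  Nontrivial H = ∃[ x ] Mem H x × ¬ (x ≈ ε)

  infix 4 _⊴_

  _⊴_ : Subgroup G → Subgroup G → Set
  N ⊴ H = (Mem N ⊆ Mem H)
        × (∀ {h x} → Mem H h → Mem N x → Mem N ((h ⁻¹ ∙ x) ∙ h))

  IndexTwo : Subgroup G → Subgroup G → Set
  IndexTwo N H = ∃[ g ] Mem H g × ¬ Mem N g
               × (∀ {h} → Mem H h → Mem N h ⊎ Mem N (h ∙ g ⁻¹))

  MinimalNormal : Subgroup G → Subgroup G → Set₁
  MinimalNormal N H = N ⊴ H × Nontrivial N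
    × (∀ (M : Subgroup G) → M ⊴ H → Nontrivial M → Mem M ⊆ Mem N → Mem N ⊆ Mem M)

  UniqueMinimalNormal : Subgroup G → Subgroup G → Set₁
  UniqueMinimalNormal N H = MinimalNormal N H
    × (∀ (M : Subgroup G) → MinimalNormal M H → Mem M ≐ Mem N)

whole : (G : Group 0ℓ 0ℓ) → Subgroup G
whole G = record
  { Mem = λ _ → ⊤ ; mem? = λ _ → yes tt ; resp = λ _ _ → tt
  ; ε∈ = tt ; ∙∈ = λ _ _ → tt ; ⁻¹∈ = λ _ → tt }

------------------------------------------------------------------------
-- Abstract finite groups

IsIsomorphism : (G H : Group 0ℓ 0ℓ) → (Group.Carrier G → Group.Carrier H) → Set
IsIsomorphism G H = IsGroupIsomorphism
  where open GroupMorphisms (Group.rawGroup G) (Group.rawGroup H)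

infix 4 _≅_

_≅_ : Group 0ℓ 0ℓ → Group 0ℓ 0ℓ → Set
G ≅ H = ∃ (IsIsomorphism G H)

FiniteGroup : Group 0ℓ 0ℓ → Set
FiniteGroup G = ∃[ m ] Inverse (Group.setoid G) (setoid (Fin m))

Simple : Group 0ℓ 0ℓ → Set₁
Simple G = Nontrivial (whole G)
  × (∀ (M : Subgroup G) → M ⊴ whole G → (∀ {x} → Mem M x → x ≈ ε) ⊎ (∀ x → Mem M x))
  where open Group G

Nonabelian : Group 0ℓ 0ℓ → Set
Nonabelian G = ¬ Commutative _≈_ _∙_
  where open Group G

FiniteNonabelianSimple : Group 0ℓ 0ℓ → Set₁
FiniteNonabelianSimple T = FiniteGroup T × Nonabelian T × Simple T

power : Group 0ℓ 0ℓ → ℕ → Group 0ℓ 0ℓ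
power T k = Pointwise.group (Fin k) T

------------------------------------------------------------------------
-- Permutation groups

-- Permutations act on the right: _∘ₚ_ is diagrammatic, so
-- (g ∙ h) ⟨$⟩ʳ x is h ⟨$⟩ʳ (g ⟨$⟩ʳ x).
Sym : ℕ → Group 0ℓ 0ℓ
Sym n = record
  { Carrier = Permutation′ n
  ; _≈_     = _≈ₚ_
  ; _∙_     = _∘ₚ_
  ; ε       = id
  ; _⁻¹     = flip
  ; isGroup = record
    { isMonoid = record
      { isSemigroup = record
        { isMagma = record
          { isEquivalence = record
            { refl  = λ _ → refl
            ; sym   = λ p i → sym (p i)
            ; trans = λ p q i → trans (p i) (q i)
            }
          ; ∙-cong = λ {x} {y} {u} {v} p q i →
              trans (cong (u ⟨$⟩ʳ_) (p i)) (q (y ⟨$⟩ʳ i))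
          }
        ; assoc = λ _ _ _ _ → refl
        }
      ; identity = (λ _ _ → refl) , (λ _ _ → refl)
      }
    ; inverse = (λ π _ → inverseʳ π) , (λ π _ → inverseˡ π)
    ; ⁻¹-cong = λ {x} {y} p i →
        trans (sym (inverseˡ y))
          (trans (cong (y ⟨$⟩ˡ_) (sym (p (x ⟨$⟩ˡ i))))
                 (cong (y ⟨$⟩ˡ_) (inverseʳ x)))
    }
  }

PermGroup : ℕ → Set₁
PermGroup n = Subgroup (Sym n)

module _ {n : ℕ} where

  Transitive : PermGroup n → Set
  Transitive G = ∀ x y → ∃[ g ] Mem G g × g ⟨$⟩ʳ x ≡ y

  Regular : PermGroup n → Set
  Regular G = Transitive G
            × (∀ {g} → Mem G g → ∀ x → g ⟨$⟩ʳ x ≡ x → g ≈ₚ id)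

  Quasiprimitive : PermGroup n → Set₁
  Quasiprimitive G = ∀ (M : PermGroup n) → M ⊴ G → Nontrivial M → Transitive M

  Orbital : PermGroup n → Fin n → Fin n → Rel (Fin n) 0ℓ
  Orbital G u v x y = ∃[ g ] Mem G g × g ⟨$⟩ʳ u ≡ x × g ⟨$⟩ʳ v ≡ y

------------------------------------------------------------------------
-- Oriented graphs

record Graph (n : ℕ) : Set₁ where
  field
    Adj    : Rel (Fin n) 0ℓ
    adj?   : Decidable₂ Adj
    symm   : Symmetric Adj
    irrefl : Irreflexive _≡_ Adj

open Graph public

module _ {n : ℕ} (Γ : Graph n) where

  -- The empty graph is not connected.
  Connected : Set
  Connected = Fin n × (∀ x y → Star (Adj Γ) x y)

  valency : Fin n → ℕ
  valency x = length (filter (adj? Γ x) (allFin n))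

  IsAutomorphism : Permutation′ n → Set
  IsAutomorphism σ = ∀ x y → Adj Γ x y ⇔ Adj Γ (σ ⟨$⟩ʳ x) (σ ⟨$⟩ʳ y)

  EdgeTransitive : PermGroup n → Set
  EdgeTransitive G = ∀ {x y x′ y′} → Adj Γ x y → Adj Γ x′ y′ →
    ∃[ g ] Mem G g × ( (g ⟨$⟩ʳ x ≡ x′ × g ⟨$⟩ʳ y ≡ y′)
                     ⊎ (g ⟨$⟩ʳ x ≡ y′ × g ⟨$⟩ʳ y ≡ x′))

  Oriented : PermGroup n → Set
  Oriented G = ∃[ u ] ∃[ v ] let Δ = Orbital G u v in
      (∀ {x y} → Δ x y → ¬ Δ y x)
    × (∀ x y → Adj Γ x y ⇔ (Δ x y ⊎ Δ y x))

  record OG4 (G : PermGroup n) : Set where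
    field
      connected      : Connected
      valency4       : ∀ x → valency x ≡ 4
      automorphisms  : ∀ {g} → Mem G g → IsAutomorphism g
      transitive     : Transitive G
      edgeTransitive : EdgeTransitive G
      oriented       : Oriented G

  BasicQuasiprimitive : PermGroup n → Set₁
  BasicQuasiprimitive G = OG4 G × Quasiprimitive G

------------------------------------------------------------------------
-- The Twisted Wreath Construction

CayleyAdj : (N : Group 0ℓ 0ℓ) → Pred (Group.Carrier N) 0ℓ → Rel (Group.Carrier N) 0ℓ
CayleyAdj N S x y = S (x ∙ y ⁻¹)
  where open Group N

module _ (T : Group 0ℓ 0ℓ) where
  open Group T using (Carrier; _≈_)

  Generates : Carrier → Carrier → Set₁
  Generates a b = ∀ (H : Subgroup T) → Mem H a → Mem H b → ∀ x → Mem H x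

  Interchangeable : Carrier → Carrier → Set
  Interchangeable a b = ∃[ α ] IsIsomorphism T T α × α a ≈ b × α b ≈ a

  private
    T² = DirectProduct.group T T
    module T² = Group T²

  twistedConnectionSet : Carrier → Carrier → Pred T².Carrier 0ℓ
  twistedConnectionSet a b s = S₀ s ⊎ S₀ (s T².⁻¹)
    where
    S₀ : Pred T².Carrier 0ℓ
    S₀ s = s T².≈ (a , b) ⊎ s T².≈ (b , a)

  RightMultiplication : Pred (T².Carrier → T².Carrier) 0ℓ
  RightMultiplication f = ∃[ t ] (∀ x → f x T².≈ x T².∙ t)

  -- The permutations of T² induced by the elements of T² ⋊ ⟨τ⟩, where
  -- τ = swap: as τ has order 2, each is τⁱ followed by a right
  -- multiplication, with i ∈ {0, 1}.
  TwistedWreathElement : Pred (T².Carrier → T².Carrier) 0ℓ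
  TwistedWreathElement f =
    ∃[ t ] ((∀ x → f x T².≈ x T².∙ t) ⊎ (∀ x → f x T².≈ swap x T².∙ t))

  -- φ identifies the vertices with T² in such a way that Γ becomes
  -- Cay(T², S), G becomes T² ⋊ ⟨τ⟩ and N becomes T² acting by right
  -- multiplication.
  record IsTwistedWreath {n : ℕ} (Γ : Graph n) (G N : PermGroup n) : Set₁ where
    field
      a b          : Carrier
      generates    : Generates a b
      noAut        : ¬ Interchangeable a b
      φ            : Inverse (setoid (Fin n)) T².setoid
    open Inverse φ using (to; from)
    field
      graph        : ∀ x y → Adj Γ x y ⇔ CayleyAdj T² (twistedConnectionSet a b) (to x) (to y)
      group        : ∀ σ → Mem G σ ⇔ TwistedWreathElement (λ t → to (σ ⟨$⟩ʳ from t))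
      normal       : ∀ σ → Mem N σ ⇔ RightMultiplication (λ t → to (σ ⟨$⟩ʳ from t))

------------------------------------------------------------------------
-- Examples

record SocleIsPower {n : ℕ} (G N : PermGroup n) (T : Group 0ℓ 0ℓ) (k : ℕ) : Set₁ where
  field
    uniqueMinimalNormal : UniqueMinimalNormal N G
    nonabelianSimple    : FiniteNonabelianSimple T
    isPower             : subgroup→group N ≅ power T k

AlmostSimpleExample : {n : ℕ} → Graph n → PermGroup n → Set₁
AlmostSimpleExample {n} Γ G = BasicQuasiprimitive Γ G
  × Σ[ N ∈ PermGroup n ] Σ[ T ∈ Group 0ℓ 0ℓ ] SocleIsPower G N T 1

NonregularSquareExample : {n : ℕ} → Graph n → PermGroup n → Set₁
NonregularSquareExample {n} Γ G = BasicQuasiprimitive Γ G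
  × Σ[ N ∈ PermGroup n ] Σ[ T ∈ Group 0ℓ 0ℓ ] (SocleIsPower G N T 2 × ¬ Regular N)

-- "There are many examples" is read as: there are infinitely many, up to
-- isomorphism.  As there are only finitely many pairs (Γ, G) on n vertices,
-- this says that the number of vertices of an example is unbounded.
Many : (∀ {n} → Graph n → PermGroup n → Set₁) → Set₁
Many Example = ∀ m → Σ[ n ∈ ℕ ] m ≤ n × (Σ[ Γ ∈ Graph n ] Σ[ G ∈ PermGroup n ] Example Γ G)

{-# OPTIONS --safe #-}

-- Let N be a transitive normal subgroup of G and let t be maximal such that N
-- is transitive on the directed t-arcs.  Then the stabilizer in N of a t-arc
-- fixes the outneighbours of its end, hence also the arc shifted by one step,
-- and so on: it is trivial, since Γ is strongly connected.  If q in G fixes a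
-- t-arc and the outneighbours of its end, then q commutes with the element of
-- N that shifts the arc, and in the same way q = 1.  As an arc stabilizer in G
-- acts on two outneighbours, |G : N| ≤ 2.  Therefore two minimal normal
-- subgroups cannot intersect trivially, and a minimal normal subgroup N is
-- either simple or T × Tʰ for any h in G outside N.  In the second case, if N
-- is regular, take h in a vertex stabilizer; it has order two and interchanges
-- both the factors of N and the outneighbours of its vertex.
--
-- For the examples let T be the alternating group of odd degree at least 11,
-- a a cycle of full length and u = (0 1)(2 3).  Then u and its conjugate by
-- a⁻⁴ commute, but u and its conjugate by (u a)⁻⁴ do not, so that no
-- automorphism of T fixes u and maps a to u a.  By Goursat's lemma T × T is
-- generated by (u , u) and (a , u a), and the coset graphs of T and of
-- T wr 2 over ⟨u⟩ and ⟨(u , u), swap⟩ are the examples sought.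

module Submission where

open import Defs
open import Algebra.Bundles using (Group)
import Algebra.Construct.DirectProduct as DirectProduct
open import Algebra.Morphism.Construct.Composition using (isGroupIsomorphism)
open import Algebra.Morphism.Structures using (module GroupMorphisms)
import Algebra.Properties.Group as GroupProperties
open import Data.Bool.Base using (Bool; true; false; not)
import Data.Bool.Properties as Bool
open import Data.Fin.Base using (Fin; zero; suc; toℕ; inject₁; inject≤; finToFun; funToFin; remQuot; combine)
open import Data.Fin.Induction using (<-weakInduction)
open import Data.Fin.Patterns using (0F; 1F; 2F; 3F; 4F; 5F; 6F; 7F)
open import Data.Fin.Permutation
  using (Permutation′; _⟨$⟩ʳ_; _⟨$⟩ˡ_; _∘ₚ_; permutation; flip; transpose; lift₀; lift₀-transpose; lift₀-comp; lift₀-cong)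
import Data.Fin.Permutation as Perm
open import Data.Fin.Properties
  using (_≟_; any?; all?; finToFun-funToFin; remQuot-combine; pigeonhole; inject≤-injective; injective⇒≤; suc-injective)
open import Data.List.Base using (List; []; _∷_; length; filter; allFin; map; tabulate)
import Data.List.Membership.DecPropositional as DecMembership
open import Data.List.Membership.Propositional using (_∈_)
open import Data.List.Membership.Propositional.Properties using (∈-allFin; ∈-map⁺)
open import Data.List.Membership.Setoid.Properties using (index-injective)
open import Data.List.Relation.Unary.All using (All; []; _∷_)
open import Data.List.Relation.Unary.All.Properties using (¬Any⇒All¬)
open import Data.List.Relation.Unary.Any using (here; there) renaming (index to ∈-index)
open import Data.Nat.Base using (ℕ; _≤_; _<_; zero; suc; _+_; _*_; _^_; z≤n; s≤s; z<s)
import Data.Nat.Properties as ℕₚ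
open import Algebra.Properties.CommutativeMonoid.Sum ℕₚ.+-0-commutativeMonoid
  using (sum; sum-cong-≗; sum-permute; ∑-comm; ∑-distrib-+)
open import Data.Product.Base using (Σ-syntax; ∃; ∃-syntax; _×_; _,_; proj₁; proj₂; swap)
open import Data.Sum.Base using (_⊎_; inj₁; inj₂; [_,_]′)
open import Data.Unit.Base using (tt)
open import Function.Base using (_∘_; case_of_)
open import Function.Bundles using (Inverse; _⇔_; mk⇔; Equivalence)
open import Level using (0ℓ)
open import Relation.Binary.Bundles using (Setoid)
open import Relation.Binary.Construct.Closure.ReflexiveTransitive as Star
  using (Star; _◅_; _◅◅_) renaming (ε to []*)
open import Relation.Binary.Core using (Rel)
open import Relation.Binary.Definitions using () renaming (Decidable to Decidable₂)
open import Relation.Binary.PropositionalEquality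
  using (_≡_; _≢_; refl; sym; trans; cong; cong₂; subst; subst₂; setoid; module ≡-Reasoning)
open import Relation.Binary.Structures using (IsEquivalence)
open import Relation.Nullary using (¬_; Dec; yes; no; contradiction)
open import Relation.Nullary.Decidable using (map′; _×-dec_; _⊎-dec_; ¬?; _→-dec_; decidable-stable)
open import Relation.Unary using (Pred; Decidable; _⊆_)

-- Word problem in free groups

-- A subgroup is a decidable predicate here, so every subgroup, orbital and maximum in the argument
-- has to come with a terminating search. For this reason symmetric groups are enumerated, generated
-- subgroups appear as components of Cayley graphs, and the critical `t` is sought along a single
-- walk that visits all vertices: once its initial `t`-arc covers the graph, the stabilizer of that
-- arc is trivial and the search ends. Permutations are compared pointwise, so formal group
-- identities are needed up to an equivalence; the free group solver reduces each of them to a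
-- computation. The overview is silent on two points. That `N` is nonabelian needs an argument of
-- its own: an abelian `N` would contain an element reversing an arc. And the alternating group is
-- not introduced by a sign. It is the group generated by `u` and `a`, shown to contain every
-- product of two transpositions and to lie in every group that contains all 3-cycles; the degree is
-- odd because only then is a cycle of full length even.

data Term (k : ℕ) : Set where
  var  : Fin k → Term k
  :ε   : Term k
  _:∙_ : Term k → Term k → Term k
  _:⁻¹ : Term k → Term k

infixl 7 _:∙_
infix 8 _:⁻¹

Letter : ℕ → Set
Letter k = Bool × Fin k

cancelCons : ∀ {k} → Letter k → List (Letter k) → List (Letter k)
cancelCons l [] = l ∷ []
cancelCons (true  , i) ((false , j) ∷ w) with i ≟ j
... | yes _ = w
... | no  _ = (true , i) ∷ (false , j) ∷ w
cancelCons (false , i) ((true , j) ∷ w) with i ≟ j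
... | yes _ = w
... | no  _ = (false , i) ∷ (true , j) ∷ w
cancelCons l w = l ∷ w

-- The Boolean is the sign of the exponent: inverses are pushed down to the letters while the word
-- is built from the right.
reduceOnto : ∀ {k} → Bool → Term k → List (Letter k) → List (Letter k)
reduceOnto b     (var i)   w = cancelCons (b , i) w
reduceOnto b     :ε        w = w
reduceOnto true  (s :∙ t)  w = reduceOnto true s (reduceOnto true t w)
reduceOnto false (s :∙ t)  w = reduceOnto false t (reduceOnto false s w)
reduceOnto b     (t :⁻¹)   w = reduceOnto (not b) t w

normalForm : ∀ {k} → Term k → List (Letter k)
normalForm t = reduceOnto true t []

module FreeGroup (G : Group 0ℓ 0ℓ) where
  open Group G renaming (refl to ≈-refl; sym to ≈-sym; trans to ≈-trans)
  open GroupProperties G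

  module _ {k : ℕ} (ρ : Fin k → Carrier) where

    ⟦_⟧ : Term k → Carrier
    ⟦ var i ⟧  = ρ i
    ⟦ :ε ⟧     = ε
    ⟦ s :∙ t ⟧ = ⟦ s ⟧ ∙ ⟦ t ⟧
    ⟦ t :⁻¹ ⟧  = ⟦ t ⟧ ⁻¹

    signed : Bool → Carrier → Carrier
    signed true  x = x
    signed false x = x ⁻¹

    ⟦_⟧ʷ : List (Letter k) → Carrier
    ⟦ [] ⟧ʷ          = ε
    ⟦ (b , i) ∷ w ⟧ʷ = signed b (ρ i) ∙ ⟦ w ⟧ʷ

    cancelCons-correct : ∀ l w → ⟦ cancelCons l w ⟧ʷ ≈ ⟦ l ∷ w ⟧ʷ
    cancelCons-correct l [] = ≈-refl
    cancelCons-correct (true  , i) ((true  , j) ∷ w) = ≈-refl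
    cancelCons-correct (false , i) ((false , j) ∷ w) = ≈-refl
    cancelCons-correct (true  , i) ((false , j) ∷ w) with i ≟ j
    ... | yes refl = ≈-sym (\\-leftDividesˡ (ρ i) ⟦ w ⟧ʷ)
    ... | no  _    = ≈-refl
    cancelCons-correct (false , i) ((true , j) ∷ w) with i ≟ j
    ... | yes refl = ≈-sym (\\-leftDividesʳ (ρ i) ⟦ w ⟧ʷ)
    ... | no  _    = ≈-refl

    reduceOnto-correct : ∀ b t w → ⟦ reduceOnto b t w ⟧ʷ ≈ signed b ⟦ t ⟧ ∙ ⟦ w ⟧ʷ
    reduceOnto-correct b     (var i)  w = cancelCons-correct (b , i) w
    reduceOnto-correct true  :ε       w = ≈-sym (identityˡ _)
    reduceOnto-correct false :ε       w = ≈-sym (≈-trans (∙-congʳ ε⁻¹≈ε) (identityˡ _))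
    reduceOnto-correct true  (s :∙ t) w =
      ≈-trans (reduceOnto-correct true s _)
        (≈-trans (∙-congˡ (reduceOnto-correct true t w)) (≈-sym (assoc _ _ _)))
    reduceOnto-correct false (s :∙ t) w =
      ≈-trans (reduceOnto-correct false t _)
        (≈-trans (∙-congˡ (reduceOnto-correct false s w))
          (≈-trans (≈-sym (assoc _ _ _)) (∙-congʳ (≈-sym (⁻¹-anti-homo-∙ _ _)))))
    reduceOnto-correct true  (t :⁻¹)  w = reduceOnto-correct false t w
    reduceOnto-correct false (t :⁻¹)  w =
      ≈-trans (reduceOnto-correct true t w) (∙-congʳ (≈-sym (⁻¹-involutive _)))

    -- Reduction preserves values. For concrete terms the hypothesis is `refl`, so every purely
    -- formal group identity below is settled by computing two reduced words.
    freely : ∀ s t → normalForm s ≡ normalForm t → ⟦ s ⟧ ≈ ⟦ t ⟧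
    freely s t eq = ≈-trans (≈-sym (reduced s)) (≈-trans (reflexive (cong ⟦_⟧ʷ eq)) (reduced t))
      where
      reduced : ∀ r → ⟦ normalForm r ⟧ʷ ≈ ⟦ r ⟧
      reduced r = ≈-trans (reduceOnto-correct true r []) (identityʳ _)

  v₀ : ∀ {k} → Term (suc k)
  v₀ = var zero
  v₁ : ∀ {k} → Term (suc (suc k))
  v₁ = var (suc zero)
  v₂ : ∀ {k} → Term (suc (suc (suc k)))
  v₂ = var (suc (suc zero))
  v₃ : ∀ {k} → Term (suc (suc (suc (suc k))))
  v₃ = var (suc (suc (suc zero)))

  private
    env₂ : Carrier → Carrier → Fin 2 → Carrier
    env₂ x y zero = x
    env₂ x y (suc _) = y
    env₃ : Carrier → Carrier → Carrier → Fin 3 → Carrier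
    env₃ x y z zero = x
    env₃ x y z (suc i) = env₂ y z i
    env₄ : Carrier → Carrier → Carrier → Carrier → Fin 4 → Carrier
    env₄ x y z w zero = x
    env₄ x y z w (suc i) = env₃ y z w i

  freely₂ : ∀ x y (s t : Term 2) → normalForm s ≡ normalForm t → ⟦ env₂ x y ⟧ s ≈ ⟦ env₂ x y ⟧ t
  freely₂ x y = freely (env₂ x y)
  freely₃ : ∀ x y z (s t : Term 3) → normalForm s ≡ normalForm t → ⟦ env₃ x y z ⟧ s ≈ ⟦ env₃ x y z ⟧ t
  freely₃ x y z = freely (env₃ x y z)
  freely₄ : ∀ x y z w (s t : Term 4) → normalForm s ≡ normalForm t → ⟦ env₄ x y z w ⟧ s ≈ ⟦ env₄ x y z w ⟧ t
  freely₄ x y z w = freely (env₄ x y z w)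

-- Finite setoids

module FiniteSearch {S : Setoid 0ℓ 0ℓ} {m : ℕ} (F : Inverse S (setoid (Fin m))) where
  open Setoid S renaming (refl to ≈-refl; sym to ≈-sym; trans to ≈-trans)
  open Inverse F

  from∘to : ∀ x → from (to x) ≈ x
  from∘to = strictlyInverseʳ

  to-injective : ∀ {x y} → to x ≡ to y → x ≈ y
  to-injective {x} {y} eq =
    ≈-trans (≈-sym (from∘to x)) (≈-trans (reflexive (cong from eq)) (from∘to y))

  infix 4 _≈?_
  _≈?_ : Decidable₂ _≈_
  x ≈? y = map′ to-injective to-cong (to x ≟ to y)

  ∃? : {P : Pred Carrier 0ℓ} → (∀ {x y} → x ≈ y → P x → P y) → Decidable P → Dec (∃ P)
  ∃? P-resp P? = map′ (λ (i , p) → from i , p)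
                      (λ (x , p) → to x , P-resp (≈-sym (from∘to x)) p)
                      (any? (P? ∘ from))

module _ {C : Set} {_~_ : Rel C 0ℓ} (~-eq : IsEquivalence _~_) (_~?_ : Decidable₂ _~_) where
  open IsEquivalence ~-eq renaming (refl to ~-refl; sym to ~-sym; trans to ~-trans)

  -- Greedy choice: an element becomes a representative unless it is equivalent to one already
  -- chosen.
  transversal : ∀ m (e : Fin m → C) →
    ∃[ k ] Σ[ r ∈ (Fin k → C) ] (∀ i j → r i ~ r j → i ≡ j) × (∀ i → ∃[ j ] e i ~ r j)
  transversal zero    e = 0 , (λ ()) , (λ ()) , λ ()
  transversal (suc m) e with transversal m (e ∘ suc)
  ... | k , r , r-inj , r-cov with any? (λ j → e zero ~? r j)
  ...   | yes (j , e~r) = k , r , r-inj , λ { zero → j , e~r ; (suc i) → r-cov i }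
  ...   | no  new = suc k , r′ , r′-inj , r′-cov
    where
    r′ : Fin (suc k) → C
    r′ zero    = e zero
    r′ (suc j) = r j
    r′-inj : ∀ i j → r′ i ~ r′ j → i ≡ j
    r′-inj zero    zero    _  = refl
    r′-inj zero    (suc j) eq = contradiction (j , eq) new
    r′-inj (suc i) zero    eq = contradiction (i , ~-sym eq) new
    r′-inj (suc i) (suc j) eq = cong suc (r-inj i j eq)
    r′-cov : ∀ i → ∃[ j ] e i ~ r′ j
    r′-cov zero    = zero , ~-refl
    r′-cov (suc i) = let j , p = r-cov i in suc j , p

  quotientSetoid : Setoid 0ℓ 0ℓ
  quotientSetoid = record { isEquivalence = ~-eq }

  -- The common source of finiteness for symmetric groups, subgroups, coset spaces and wreath
  -- products: each is enumerated with repetitions, up to its equivalence.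
  finiteQuotient : ∀ {m} (e : Fin m → C) → (∀ c → ∃[ i ] e i ~ c) →
                   ∃[ k ] Inverse quotientSetoid (setoid (Fin k))
  finiteQuotient {m} e e-cov with transversal m e
  ... | k , r , r-inj , r-cov = k , record
    { to        = index
    ; from      = r
    ; to-cong   = λ {c} {d} c~d →
        r-inj _ _ (~-trans (~-sym (index-~ c)) (~-trans c~d (index-~ d)))
    ; from-cong = λ { refl → ~-refl }
    ; inverse   = (λ {i} {c} c~r → r-inj _ _ (~-trans (~-sym (index-~ c)) c~r))
                , (λ { {c} refl → ~-sym (index-~ c) })
    }
    where
    located : ∀ c → ∃[ j ] c ~ r j
    located c = let i , e~c = e-cov c ; j , e~r = r-cov i in j , ~-trans (~-sym e~c) e~r
    index : C → Fin k
    index c = proj₁ (located c)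
    index-~ : ∀ c → c ~ r (index c)
    index-~ c = proj₂ (located c)

abstract
  -- A permutation carries its inverse, so the enumeration runs over all pairs of functions and
  -- keeps those that are mutually inverse.
  symFinite : ∀ n → FiniteGroup (Sym n)
  symFinite n = finiteQuotient (Group.isEquivalence (Sym n)) (λ σ τ → all? (λ i → (σ ⟨$⟩ʳ i) ≟ (τ ⟨$⟩ʳ i))) enum covers
    where
    MutuallyInverse : (f g : Fin n → Fin n) → Set
    MutuallyInverse f g = (∀ i → f (g i) ≡ i) × (∀ i → g (f i) ≡ i)

    inverse? : ∀ f g → Dec (MutuallyInverse f g)
    inverse? f g = all? (λ i → f (g i) ≟ i) ×-dec all? (λ i → g (f i) ≟ i)

    fromPair : (f g : Fin n → Fin n) → Dec (MutuallyInverse f g) → Permutation′ n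
    fromPair f g (yes (fg , gf)) = permutation f g fg gf
    -- A default for the remaining pairs; repetitions are harmless for `finiteQuotient`.
    fromPair f g (no _)          = Perm.id

    decode : Fin ((n ^ n) * (n ^ n)) → (Fin n → Fin n) × (Fin n → Fin n)
    decode i = let q , r = remQuot (n ^ n) i in finToFun q , finToFun r

    enum : Fin ((n ^ n) * (n ^ n)) → Permutation′ n
    enum i = let f , g = decode i in fromPair f g (inverse? f g)

    fromPair-to : ∀ f g (σ : Permutation′ n) → (∀ i → f i ≡ σ ⟨$⟩ʳ i) → (∀ i → g i ≡ σ ⟨$⟩ˡ i) →
                  ∀ d i → fromPair f g d ⟨$⟩ʳ i ≡ σ ⟨$⟩ʳ i
    fromPair-to f g σ f≡ g≡ (yes _) i = f≡ i
    fromPair-to f g σ f≡ g≡ (no ¬p) i = contradiction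
      ( (λ j → trans (f≡ (g j)) (trans (cong (σ ⟨$⟩ʳ_) (g≡ j)) (Perm.inverseʳ σ)))
      , (λ j → trans (g≡ (f j)) (trans (cong (σ ⟨$⟩ˡ_) (f≡ j)) (Perm.inverseˡ σ)))) ¬p

    covers : ∀ σ → ∃[ i ] ∀ j → enum i ⟨$⟩ʳ j ≡ σ ⟨$⟩ʳ j
    covers σ = i , fromPair-to (proj₁ (decode i)) (proj₂ (decode i)) σ
        (λ j → trans (cong (λ qr → finToFun (proj₁ qr) j) eq) (finToFun-funToFin (σ ⟨$⟩ʳ_) j))
        (λ j → trans (cong (λ qr → finToFun (proj₂ qr) j) eq) (finToFun-funToFin (σ ⟨$⟩ˡ_) j))
        (inverse? (proj₁ (decode i)) (proj₂ (decode i)))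
      where
      i : Fin ((n ^ n) * (n ^ n))
      i = combine (funToFin (σ ⟨$⟩ʳ_)) (funToFin (σ ⟨$⟩ˡ_))
      eq : remQuot (n ^ n) i ≡ (funToFin (σ ⟨$⟩ʳ_) , funToFin (σ ⟨$⟩ˡ_))
      eq = remQuot-combine {n = n ^ n} {k = n ^ n} (funToFin (σ ⟨$⟩ʳ_)) (funToFin (σ ⟨$⟩ˡ_))

abstract
  subgroupFinite : ∀ {G} → FiniteGroup G → (H : Subgroup G) → FiniteGroup (subgroup→group H)
  subgroupFinite {G} (m , F) H = finiteQuotient (Group.isEquivalence (subgroup→group H))
      (λ x y → proj₁ x ≈? proj₁ y) (λ i → select (from i) (mem? H (from i)))
      λ (x , x∈H) → to x , ≈-trans (select-≈ (from (to x)) (mem? H (from (to x))) (resp H (≈-sym (from∘to x)) x∈H)) (from∘to x)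
    where
    open Group G renaming (refl to ≈-refl; sym to ≈-sym; trans to ≈-trans)
    open Inverse F
    open FiniteSearch F
    select : ∀ x → Dec (Mem H x) → ∃ (Mem H)
    select x (yes x∈H) = x , x∈H
    select x (no _)    = ε , ε∈ H
    select-≈ : ∀ x d → Mem H x → proj₁ (select x d) ≈ x
    select-≈ x (yes _)  _   = ≈-refl
    select-≈ x (no x∉H) x∈H = contradiction x∈H x∉H

-- The Floyd–Warshall algorithm: Through k relates the endpoints of the
-- paths with all inner vertices among vs.
module Reachability {m : ℕ} {R : Rel (Fin m) 0ℓ} (R? : Decidable₂ R) where

  Through : List (Fin m) → Rel (Fin m) 0ℓ
  Through []       x y = x ≡ y ⊎ R x y
  Through (v ∷ vs) x y = Through vs x y ⊎ Through vs x v × Through vs v y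

  through? : ∀ vs → Decidable₂ (Through vs)
  through? []       x y = (x ≟ y) ⊎-dec R? x y
  through? (v ∷ vs) x y = through? vs x y ⊎-dec (through? vs x v ×-dec through? vs v y)

  through⇒star : ∀ vs {x y} → Through vs x y → Star R x y
  through⇒star []       (inj₁ refl)    = []*
  through⇒star []       (inj₂ r)       = r ◅ []*
  through⇒star (v ∷ vs) (inj₁ p)       = through⇒star vs p
  through⇒star (v ∷ vs) (inj₂ (p , q)) = through⇒star vs p ◅◅ through⇒star vs q

  widen : ∀ vs {x y} → Through [] x y → Through vs x y
  widen []       p = p
  widen (v ∷ vs) p = inj₁ (widen vs p)

  concat : ∀ vs {v x y} → v ∈ vs → Through vs x v → Through vs v y → Through vs x y
  concat (v ∷ vs) (here refl) p q = inj₂ (last p , first q)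
    where
    last : ∀ {x} → Through (v ∷ vs) x v → Through vs x v
    last (inj₁ p)       = p
    last (inj₂ (p , _)) = p
    first : ∀ {y} → Through (v ∷ vs) v y → Through vs v y
    first (inj₁ p)       = p
    first (inj₂ (_ , p)) = p
  concat (w ∷ vs) (there v∈) (inj₁ p)       (inj₁ q)       = inj₁ (concat vs v∈ p q)
  concat (w ∷ vs) (there v∈) (inj₁ p)       (inj₂ (q , r)) = inj₂ (concat vs v∈ p q , r)
  concat (w ∷ vs) (there v∈) (inj₂ (p , q)) (inj₁ r)       = inj₂ (p , concat vs v∈ q r)
  -- The detour from `w` to `v` and back to `w` is dropped.
  concat (w ∷ vs) (there v∈) (inj₂ (p , q)) (inj₂ (r , s)) = inj₂ (p , s)

  star⇒through : ∀ {x y} → Star R x y → Through (allFin m) x y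
  star⇒through []*       = widen (allFin m) (inj₁ refl)
  star⇒through (r ◅ rs) =
    concat (allFin m) (∈-allFin _) (widen (allFin m) (inj₂ r)) (star⇒through rs)

  abstract
    star? : Decidable₂ (Star R)
    star? x y = map′ (through⇒star _) star⇒through (through? (allFin m) x y)

-- Generated subgroups

module Generated (G : Group 0ℓ 0ℓ) (finite : FiniteGroup G) {S : Pred (Group.Carrier G) 0ℓ}
                 (S? : Decidable S) (S-resp : ∀ {x y} → Group._≈_ G x y → S x → S y) where
  open Group G renaming (refl to ≈-refl; sym to ≈-sym; trans to ≈-trans)
  open Inverse (proj₂ finite)
  open FiniteSearch (proj₂ finite)
  open FreeGroup G

  private
    -- The Cayley graph of the generators, symmetrized and moved to indices. The generated subgroup
    -- is the component of `ε`, so that reachability decides membership.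
    Step : Rel (Fin (proj₁ finite)) 0ℓ
    Step i j = S (from i ⁻¹ ∙ from j) ⊎ S (from j ⁻¹ ∙ from i)

    step? : Decidable₂ Step
    step? i j = S? _ ⊎-dec S? _

    InSpan : Pred Carrier 0ℓ
    InSpan x = Star Step (to ε) (to x)

    extend : ∀ {x s} → S s → Step (to x) (to (x ∙ s))
    extend {x} {s} s∈S = inj₁ (S-resp
      (≈-sym (≈-trans (∙-cong (⁻¹-cong (from∘to x)) (from∘to (x ∙ s)))
                      (freely₂ x s (v₀ :⁻¹ :∙ (v₀ :∙ v₁)) v₁ refl))) s∈S)

    extend⁻¹ : ∀ {x s} → S s → Step (to x) (to (x ∙ s ⁻¹))
    extend⁻¹ {x} {s} s∈S = inj₂ (S-resp
      (≈-sym (≈-trans (∙-cong (⁻¹-cong (from∘to (x ∙ s ⁻¹))) (from∘to x))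
                      (freely₂ x s ((v₀ :∙ v₁ :⁻¹) :⁻¹ :∙ v₀) v₁ refl))) s∈S)

  module _ {Q : Pred Carrier 0ℓ} (Q-resp : ∀ {x y} → x ≈ y → Q x → Q y) (Q-ε : Q ε)
           (Q-∙ : ∀ {x s} → Q x → S s → Q (x ∙ s)) (Q-∙⁻¹ : ∀ {x s} → Q x → S s → Q (x ∙ s ⁻¹)) where

    private
      follow : ∀ {i j} → Star Step i j → Q (from i) → Q (from j)
      follow []* q = q
      follow {i} (_◅_ {j = j} (inj₁ s) p) q =
        follow p (Q-resp (freely₂ (from i) (from j) (v₀ :∙ (v₀ :⁻¹ :∙ v₁)) v₁ refl) (Q-∙ q s))
      follow {i} (_◅_ {j = j} (inj₂ s) p) q =
        follow p (Q-resp (freely₂ (from i) (from j) (v₀ :∙ (v₁ :⁻¹ :∙ v₀) :⁻¹) v₁ refl) (Q-∙⁻¹ q s))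

    span-induction : ∀ {x} → InSpan x → Q x
    span-induction {x} p =
      Q-resp (from∘to x) (follow p (Q-resp (≈-sym (from∘to ε)) Q-ε))

  private
    span-resp : ∀ {x y} → x ≈ y → InSpan x → InSpan y
    span-resp x≈y = subst (Star Step (to ε)) (to-cong x≈y)

    span-S : ∀ {x s} → InSpan x → S s → InSpan (x ∙ s)
    span-S p s = p ◅◅ extend s ◅ []*

    span-S⁻¹ : ∀ {x s} → InSpan x → S s → InSpan (x ∙ s ⁻¹)
    span-S⁻¹ p s = p ◅◅ extend⁻¹ s ◅ []*

    span-∙ : ∀ {x y} → InSpan x → InSpan y → InSpan (x ∙ y)
    span-∙ {x} p = span-induction {Q = λ y → InSpan (x ∙ y)}
      (λ eq → span-resp (∙-congˡ eq))
      (span-resp (≈-sym (identityʳ x)) p)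
      (λ q s → span-resp (assoc _ _ _) (span-S q s))
      (λ q s → span-resp (assoc _ _ _) (span-S⁻¹ q s))

    S⊆span : ∀ {s} → S s → InSpan s
    S⊆span s = span-resp (identityˡ _) (span-S []* s)

    S⁻¹⊆span : ∀ {s} → S s → InSpan (s ⁻¹)
    S⁻¹⊆span s = span-resp (identityˡ _) (span-S⁻¹ []* s)

    span-⁻¹ : ∀ {x} → InSpan x → InSpan (x ⁻¹)
    span-⁻¹ = span-induction {Q = λ y → InSpan (y ⁻¹)}
      (λ eq → span-resp (⁻¹-cong eq))
      (span-resp (≈-sym (GroupProperties.ε⁻¹≈ε G)) []*)
      (λ {x} {t} q s → span-resp (freely₂ x t (v₁ :⁻¹ :∙ v₀ :⁻¹) ((v₀ :∙ v₁) :⁻¹) refl) (span-∙ (S⁻¹⊆span s) q))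
      (λ {x} {t} q s → span-resp (freely₂ x t (v₁ :∙ v₀ :⁻¹) ((v₀ :∙ v₁ :⁻¹) :⁻¹) refl) (span-∙ (S⊆span s) q))

  span : Subgroup G
  span = record
    { Mem  = InSpan
    ; mem? = λ x → Reachability.star? step? (to ε) (to x)
    ; resp = span-resp
    ; ε∈   = []*
    ; ∙∈   = span-∙
    ; ⁻¹∈  = span-⁻¹
    }

  generator∈span : ∀ {s} → S s → Mem span s
  generator∈span = S⊆span

  span-least : ∀ (M : Subgroup G) → (∀ {s} → S s → Mem M s) → ∀ {x} → Mem span x → Mem M x
  span-least M S⊆M = span-induction (resp M) (ε∈ M)
    (λ x∈M s → ∙∈ M x∈M (S⊆M s)) (λ x∈M s → ∙∈ M x∈M (⁻¹∈ M (S⊆M s)))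

module _ {A : Set} {_≼_ : Rel A 0ℓ} (≼-refl : ∀ {x} → x ≼ x) (≼-trans : ∀ {x y z} → x ≼ y → y ≼ z → x ≼ z)
         (_≼?_ : Decidable₂ _≼_) {P : Pred A 0ℓ} (P? : Decidable P) where

  -- One pass suffices: an element with `P` that is rejected lies below no later candidate either,
  -- since the candidates only descend.
  minimalBelow : ∀ (xs : List A) x → P x →
    ∃[ b ] b ≼ x × P b × (∀ {y} → y ∈ xs → P y → y ≼ b → b ≼ y)
  minimalBelow []       x px = x , ≼-refl , px , λ ()
  minimalBelow (y ∷ ys) x px with P? y ×-dec (y ≼? x)
  ... | yes (py , y≼x) with minimalBelow ys y py
  ...   | b , b≼y , pb , least = b , ≼-trans b≼y y≼x , pb , λ
    { (here refl) _ _ → b≼y ; (there z∈) → least z∈ }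
  minimalBelow (y ∷ ys) x px | no ¬p with minimalBelow ys x px
  ...   | b , b≼x , pb , least = b , b≼x , pb , λ
    { (here refl) py y≼b → contradiction (py , ≼-trans y≼b b≼x) ¬p ; (there z∈) → least z∈ }

-- Normal subgroups

module _ {G : Group 0ℓ 0ℓ} (finite : FiniteGroup G) where
  open Group G renaming (refl to ≈-refl; sym to ≈-sym; trans to ≈-trans)
  open Inverse (proj₂ finite)
  open FiniteSearch (proj₂ finite)
  open FreeGroup G

  module NormalClosure (H : Subgroup G) (x : Carrier) where
    Conjugate : Pred Carrier 0ℓ
    Conjugate y = ∃[ h ] Mem H h × y ≈ (h ⁻¹ ∙ x) ∙ h

    conjugate? : Decidable Conjugate
    conjugate? y = ∃? (λ eq (h∈ , p) → resp H eq h∈ , ≈-trans p (∙-cong (∙-congʳ (⁻¹-cong eq)) eq))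
                      (λ h → mem? H h ×-dec (y ≈? (h ⁻¹ ∙ x) ∙ h))

    conjugate-resp : ∀ {y z} → y ≈ z → Conjugate y → Conjugate z
    conjugate-resp y≈z (h , h∈ , p) = h , h∈ , ≈-trans (≈-sym y≈z) p

    open Generated G finite conjugate? conjugate-resp public

    span-conjugate : ∀ {h y} → Mem H h → Mem span y → Mem span ((h ⁻¹ ∙ y) ∙ h)
    span-conjugate {h} h∈ = span-induction {Q = λ y → Mem span ((h ⁻¹ ∙ y) ∙ h)}
      (λ eq → resp span (∙-congʳ (∙-congˡ eq)))
      (resp span (≈-sym (freely₂ h h (v₀ :⁻¹ :∙ :ε :∙ v₀) :ε refl)) (ε∈ span))
      (λ {y} {s} q s∈ → resp span
        (freely₃ h y s ((v₀ :⁻¹ :∙ v₁ :∙ v₀) :∙ (v₀ :⁻¹ :∙ v₂ :∙ v₀)) (v₀ :⁻¹ :∙ (v₁ :∙ v₂) :∙ v₀) refl)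
        (∙∈ span q (conj s∈)))
      (λ {y} {s} q s∈ → resp span
        (freely₃ h y s ((v₀ :⁻¹ :∙ v₁ :∙ v₀) :∙ (v₀ :⁻¹ :∙ v₂ :∙ v₀) :⁻¹) (v₀ :⁻¹ :∙ (v₁ :∙ v₂ :⁻¹) :∙ v₀) refl)
        (∙∈ span q (⁻¹∈ span (conj s∈))))
      where
      conj : ∀ {s} → Conjugate s → Mem span ((h ⁻¹ ∙ s) ∙ h)
      conj {s} (k , k∈ , p) = generator∈span (k ∙ h , ∙∈ H k∈ h∈ , ≈-trans (∙-congʳ (∙-congˡ p))
        (freely₃ h k x (v₀ :⁻¹ :∙ (v₁ :⁻¹ :∙ v₂ :∙ v₁) :∙ v₀) ((v₁ :∙ v₀) :⁻¹ :∙ v₂ :∙ (v₁ :∙ v₀)) refl))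

    span-normal : Mem H x → span ⊴ H
    span-normal x∈H =
        span-least H (λ (h , h∈ , p) → resp H (≈-sym p) (∙∈ H (∙∈ H (⁻¹∈ H h∈) x∈H) h∈))
      , span-conjugate

    self∈span : Mem span x
    self∈span = generator∈span (ε , ε∈ H , freely₂ x x v₀ (:ε :⁻¹ :∙ v₀ :∙ :ε) refl)

    span-leastNormal : ∀ (M : Subgroup G) → (∀ {h y} → Mem H h → Mem M y → Mem M ((h ⁻¹ ∙ y) ∙ h)) →
                       Mem M x → ∀ {y} → Mem span y → Mem M y
    span-leastNormal M M-conj x∈M =
      span-least M (λ (h , h∈ , p) → resp M (≈-sym p) (M-conj h∈ x∈M))

  -- A nontrivial element whose normal closure is as small as possible
  -- generates a minimal normal subgroup.
  minimalNormal : (H : Subgroup G) → Nontrivial H → ∃[ N ] MinimalNormal N H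
  minimalNormal H (x₀ , x₀∈ , x₀≉ε) = fromMinimal
    (minimalBelow {_≼_ = _≼_} (NormalClosure.self∈span H _) ≼-trans (λ y x → mem? (NormalClosure.span H x) y)
      {P = P} (λ x → mem? H x ×-dec ¬? (x ≈? ε)) (map from (allFin _)) x₀ (x₀∈ , x₀≉ε))
    where
    P : Pred Carrier 0ℓ
    P x = Mem H x × ¬ x ≈ ε
    _≼_ : Rel Carrier 0ℓ
    y ≼ x = Mem (NormalClosure.span H x) y
    ≼-trans : ∀ {x y z} → x ≼ y → y ≼ z → x ≼ z
    ≼-trans {x} {y} {z} x≼y y≼z = NormalClosure.span-leastNormal H y
      (NormalClosure.span H z) (NormalClosure.span-conjugate H z) y≼z x≼y
    fromMinimal : ∃[ b ] b ≼ x₀ × P b × (∀ {y} → y ∈ map from (allFin _) → P y → y ≼ b → b ≼ y) →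
                  ∃[ N ] MinimalNormal N H
    fromMinimal (b , _ , (b∈ , b≉ε) , least) =
      NormalClosure.span H b , NormalClosure.span-normal H b b∈ , (b , NormalClosure.self∈span H b , b≉ε) ,
      λ M (M⊆H , M-conj) (y , y∈M , y≉ε) M⊆N →
        let y′ = from (to y)
            y′∈M = resp M (≈-sym (from∘to y)) y∈M
        in NormalClosure.span-leastNormal H b M M-conj
             (NormalClosure.span-leastNormal H y′ M M-conj y′∈M
               (least (∈-map⁺ from (∈-allFin (to y)))
                      (M⊆H y′∈M , λ eq → y≉ε (≈-trans (≈-sym (from∘to y)) eq)) (M⊆N y′∈M)))

-- Counting


indicator : ∀ {A : Set} → Dec A → ℕ
indicator (yes _) = 1
indicator (no  _) = 0

indicator-⇔ : ∀ {A B : Set} (a : Dec A) (b : Dec B) → (A → B) → (B → A) → indicator a ≡ indicator b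
indicator-⇔ (yes _) (yes _) _ _ = refl
indicator-⇔ (no  _) (no  _) _ _ = refl
indicator-⇔ (yes a) (no ¬b) f _ = contradiction (f a) ¬b
indicator-⇔ (no ¬a) (yes b) _ g = contradiction (g b) ¬a

count : ∀ {n} {P : Pred (Fin n) 0ℓ} → Decidable P → ℕ
count P? = sum (indicator ∘ P?)

length-filter : ∀ {n} {A : Set} {P : Pred A 0ℓ} (P? : Decidable P) (f : Fin n → A) →
                length (filter P? (tabulate f)) ≡ count (P? ∘ f)
length-filter {zero}  P? f = refl
length-filter {suc n} P? f with P? (f zero)
... | yes _ = cong suc (length-filter P? (f ∘ suc))
... | no  _ = length-filter P? (f ∘ suc)

sum-const : ∀ n c → sum {n} (λ _ → c) ≡ n * c
sum-const zero    c = refl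
sum-const (suc n) c = cong (c +_) (sum-const n c)

count≡0 : ∀ {n} {P : Pred (Fin n) 0ℓ} (P? : Decidable P) → count P? ≡ 0 → ∀ i → ¬ P i
count≡0 P? eq zero    p with P? zero
... | no ¬p = ¬p p
count≡0 P? eq (suc i) p with P? zero
... | no _ = count≡0 (P? ∘ suc) eq i p

count≡1 : ∀ {n} {P : Pred (Fin n) 0ℓ} (P? : Decidable P) → count P? ≡ 1 →
          ∃[ i ] P i × (∀ {j} → P j → j ≡ i)
count≡1 {suc n} P? eq with P? zero
... | yes p = zero , p , λ { {zero} _ → refl ; {suc j} q → contradiction q (count≡0 (P? ∘ suc) (ℕₚ.suc-injective eq) j) }
... | no ¬p with count≡1 (P? ∘ suc) eq
...   | i , p , unique = suc i , p , λ { {zero} q → contradiction q ¬p ; {suc j} q → cong suc (unique q) }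

count≡2 : ∀ {n} {P : Pred (Fin n) 0ℓ} (P? : Decidable P) → count P? ≡ 2 →
          ∃[ i ] ∃[ j ] i ≢ j × P i × P j × (∀ {k} → P k → k ≡ i ⊎ k ≡ j)
count≡2 {suc n} P? eq with P? zero
... | yes p with count≡1 (P? ∘ suc) (ℕₚ.suc-injective eq)
...   | j , q , unique = zero , suc j , (λ ()) , p , q , λ
  { {zero} _ → inj₁ refl ; {suc k} r → inj₂ (cong suc (unique r)) }
count≡2 {suc n} P? eq | no ¬p with count≡2 (P? ∘ suc) eq
...   | i , j , i≢j , p , q , only = suc i , suc j , (λ { refl → i≢j refl }) , p , q , λ
  { {zero}  r → contradiction r ¬p
  ; {suc k} r → [ inj₁ ∘ cong suc , inj₂ ∘ cong suc ]′ (only r) }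

double≡4 : ∀ d → d + d ≡ 4 → d ≡ 2
double≡4 d eq = ℕₚ.*-cancelˡ-≡ d 2 2 (trans (cong (d +_) (ℕₚ.+-identityʳ d)) eq)

-- Permutations

module _ {n : ℕ} where

  infixl 6 _·_
  _·_ : Fin n → Permutation′ n → Fin n
  x · g = g ⟨$⟩ʳ x

  ·-injective : ∀ (g : Permutation′ n) {x y} → x · g ≡ y · g → x ≡ y
  ·-injective g eq = trans (sym (Perm.inverseˡ g)) (trans (cong (g ⟨$⟩ˡ_) eq) (Perm.inverseˡ g))

  ·-flip : ∀ (g : Permutation′ n) {x y} → x · g ≡ y → y · flip g ≡ x
  ·-flip g {x} refl = Perm.inverseˡ g

  iterate : Permutation′ n → ℕ → Fin n → Fin n
  iterate g zero    x = x
  iterate g (suc i) x = iterate g i x · g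

  -- Two of the first `n + 1` iterates coincide, and injectivity cancels their common initial steps.
  recurrent : ∀ g x → ∃[ i ] iterate g (suc i) x ≡ x
  recurrent g x with pigeonhole (ℕₚ.n<1+n n) (λ i → iterate g (toℕ i) x)
  ... | i , j , i<j , eq = cancel (toℕ i) (toℕ j) i<j eq
    where
    cancel : ∀ i j → i < j → iterate g i x ≡ iterate g j x → ∃[ k ] iterate g (suc k) x ≡ x
    cancel zero    (suc j) _         eq = j , sym eq
    cancel (suc i) (suc j) (s≤s i<j) eq = cancel i j i<j (·-injective g eq)

  open FiniteSearch (proj₂ (symFinite n)) public
    using () renaming (∃? to ∃ₚ?; _≈?_ to _≈ₚ?_)

  orbital? : (G : PermGroup n) → ∀ u v → Decidable₂ (Orbital G u v)
  orbital? G u v x y = ∃ₚ? (λ {g} {h} g≈h (g∈G , p , q) → resp G {g} {h} g≈h g∈G , trans (sym (g≈h u)) p , trans (sym (g≈h v)) q)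
                           (λ g → mem? G g ×-dec ((u · g ≟ x) ×-dec (v · g ≟ y)))

  module _ (G : PermGroup n) {u v : Fin n} where
    orbital-invariant : ∀ {g x y} → Mem G g → Orbital G u v x y → Orbital G u v (x · g) (y · g)
    orbital-invariant {g} g∈G (k , k∈G , p , q) =
      k ∘ₚ g , ∙∈ G {k} {g} k∈G g∈G , cong (_· g) p , cong (_· g) q

    orbital-transitive : ∀ {x y x′ y′} → Orbital G u v x y → Orbital G u v x′ y′ →
                         ∃[ g ] Mem G g × x · g ≡ x′ × y · g ≡ y′
    orbital-transitive (k , k∈G , p , q) (l , l∈G , r , s) =
      flip k ∘ₚ l , ∙∈ G {flip k} {l} (⁻¹∈ G {k} k∈G) l∈G ,
      trans (cong (_· l) (·-flip k p)) r , trans (cong (_· l) (·-flip k q)) s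

  Fixes : Permutation′ n → Fin n → Set
  Fixes g x = x · g ≡ x

count-permute : ∀ {n} {P Q : Pred (Fin n) 0ℓ} (P? : Decidable P) (Q? : Decidable Q) (g : Permutation′ n) →
                (∀ i → P i → Q (i · g)) → (∀ i → Q (i · g) → P i) → count P? ≡ count Q?
count-permute P? Q? g P⇒Q Q⇒P = trans
  (sum-cong-≗ (λ i → indicator-⇔ (P? i) (Q? (i · g)) (P⇒Q i) (Q⇒P i))) (sym (sum-permute (indicator ∘ Q?) g))

-- Oriented graphs of valency four

module Oriented4 {n : ℕ} (Γ : Graph n) (G : PermGroup n) (og : OG4 Γ G) where
  open OG4 og

  u v : Fin n
  u = proj₁ oriented
  v = proj₁ (proj₂ oriented)

  Δ : Rel (Fin n) 0ℓ
  Δ = Orbital G u v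

  Δ? : Decidable₂ Δ
  Δ? = orbital? G u v

  Δ-antisym : ∀ {x y} → Δ x y → ¬ Δ y x
  Δ-antisym = proj₁ (proj₂ (proj₂ oriented))

  adj⇔Δ : ∀ x y → Adj Γ x y ⇔ (Δ x y ⊎ Δ y x)
  adj⇔Δ = proj₂ (proj₂ (proj₂ oriented))

  Δ-invariant : ∀ {g x y} → Mem G g → Δ x y → Δ (x · g) (y · g)
  Δ-invariant = orbital-invariant G

  Δ-irrefl : ∀ {x y} → Δ x y → x ≢ y
  Δ-irrefl d refl = Δ-antisym d d

  outdegree indegree : Fin n → ℕ
  outdegree x = count (λ y → Δ? x y)
  indegree  x = count (λ y → Δ? y x)

  private
    degrees : ∀ x → outdegree x + indegree x ≡ 4
    degrees x = trans (sym (∑-distrib-+ (λ y → indicator (Δ? x y)) (λ y → indicator (Δ? y x))))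
      (trans (sum-cong-≗ pointwise) (trans (sym (length-filter (adj? Γ x) (λ y → y))) (valency4 x)))
      where
      pointwise : ∀ y → indicator (Δ? x y) + indicator (Δ? y x) ≡ indicator (adj? Γ x y)
      pointwise y with Δ? x y | Δ? y x | adj? Γ x y | adj⇔Δ x y
      ... | yes d | yes e | _     | _ = contradiction e (Δ-antisym d)
      ... | yes d | no _  | yes _ | _ = refl
      ... | no _  | yes e | yes _ | _ = refl
      ... | no _  | no _  | no _  | _ = refl
      ... | yes d | no _  | no ¬a | eqv = contradiction (Equivalence.from eqv (inj₁ d)) ¬a
      ... | no _  | yes e | no ¬a | eqv = contradiction (Equivalence.from eqv (inj₂ e)) ¬a
      ... | no ¬d | no ¬e | yes a | eqv = contradiction (Equivalence.to eqv a) [ ¬d , ¬e ]′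

    Δ-invariant⁻ : ∀ {g x y} → Mem G g → Δ (x · g) (y · g) → Δ x y
    Δ-invariant⁻ {g} {x} {y} g∈G d =
      subst₂ Δ (Perm.inverseˡ g) (Perm.inverseˡ g) (Δ-invariant {flip g} (⁻¹∈ G {g} g∈G) d)

    outdegree-const : ∀ x y → outdegree x ≡ outdegree y
    outdegree-const x y with transitive x y
    ... | g , g∈G , refl = count-permute (Δ? x) (Δ? (x · g)) g (λ _ → Δ-invariant {g} g∈G) (λ _ → Δ-invariant⁻ {g} g∈G)

    indegree-const : ∀ x y → indegree x ≡ indegree y
    indegree-const x y with transitive x y
    ... | g , g∈G , refl = count-permute (λ z → Δ? z x) (λ z → Δ? z (x · g)) g
      (λ _ → Δ-invariant {g} g∈G) (λ _ → Δ-invariant⁻ {g} g∈G)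

    -- Both sides count the arcs, divided by the number of vertices.
    outdegree≡indegree : ∀ x → outdegree x ≡ indegree x
    outdegree≡indegree x = cancel n x (trans (sym (sum-const n (outdegree x)))
      (trans (sum-cong-≗ (outdegree-const x)) (trans (∑-comm (λ y z → indicator (Δ? y z)))
        (trans (sum-cong-≗ (λ y → indegree-const y x)) (sum-const n (indegree x))))))
      where
      cancel : ∀ m → Fin m → ∀ {a b} → m * a ≡ m * b → a ≡ b
      cancel (suc m) _ {a} {b} eq = ℕₚ.*-cancelˡ-≡ a b (suc m) eq

  abstract
    outneighbours : ∀ x → ∃[ y ] ∃[ z ] y ≢ z × Δ x y × Δ x z × (∀ {w} → Δ x w → w ≡ y ⊎ w ≡ z)
    outneighbours x = count≡2 (Δ? x) (double≡4 _ (trans (cong (outdegree x +_) (outdegree≡indegree x)) (degrees x)))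

  other-outneighbour : ∀ {x y z w} → Δ x y → Δ x z → y ≢ z → Δ x w → w ≡ y ⊎ w ≡ z
  other-outneighbour {x} xy xz y≢z xw with outneighbours x
  ... | _ , _ , _ , _ , _ , only with only xy | only xz | only xw
  ...   | inj₁ refl | inj₁ refl | _ = contradiction refl y≢z
  ...   | inj₂ refl | inj₂ refl | _ = contradiction refl y≢z
  ...   | inj₁ refl | inj₂ refl | r = r
  ...   | inj₂ refl | inj₁ refl | inj₁ r = inj₂ r
  ...   | inj₂ refl | inj₁ refl | inj₂ r = inj₁ r

  -- If g maps y to x then the images of the arc from y to x under the powers
  -- of g form a directed cycle.
  back : ∀ {x y} → Δ y x → Star Δ x y
  back {x} {y} d with transitive y x
  ... | g , g∈G , refl with recurrent g y
  ...   | k , eq = subst (Star Δ (y · g)) eq (around k)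
    where
    step : ∀ i → Δ (iterate g i y) (iterate g (suc i) y)
    step zero    = d
    step (suc i) = Δ-invariant {g} g∈G (step i)
    around : ∀ k → Star Δ (y · g) (iterate g (suc k) y)
    around zero    = []*
    around (suc k) = around k ◅◅ step (suc k) ◅ []*

  strongly-connected : ∀ x y → Star Δ x y
  strongly-connected x y = Star.concat (Star.map arc (proj₂ connected x y))
    where
    arc : ∀ {x y} → Adj Γ x y → Star Δ x y
    arc {x} {y} a with Equivalence.to (adj⇔Δ x y) a
    ... | inj₁ d = d ◅ []*
    ... | inj₂ d = back d

  -- Arcs of all lengths are treated as initial segments of infinite walks, so that shifting an arc
  -- is composition with `suc`. Every arc extends to a walk because every vertex has an
  -- outneighbour.
  Walk : (ℕ → Fin n) → Set
  Walk f = ∀ i → Δ (f i) (f (suc i))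

  walk-image : ∀ {f g} → Mem G g → Walk f → Walk (λ i → f i · g)
  walk-image {f} {g} g∈G w i = Δ-invariant {g} g∈G (w i)

  private
    prepend : ∀ {x y} → Star Δ x y → ∀ f → Walk f → f 0 ≡ y →
              ∃[ f′ ] Walk f′ × f′ 0 ≡ x × ∃[ k ] (∀ i → f′ (k + i) ≡ f i)
    prepend []*      f w f0≡ = f , w , f0≡ , 0 , λ _ → refl
    prepend {x} (d ◅ p) f w f0≡ with prepend p f w f0≡
    ... | f′ , w′ , f′0≡ , k , shift = f″ , w″ , refl , suc k , shift
      where
      f″ : ℕ → Fin n
      f″ zero    = x
      f″ (suc i) = f′ i
      w″ : Walk f″
      w″ zero    = subst (Δ x) (sym f′0≡) d
      w″ (suc i) = w′ i

    -- Strong connectivity joins each further vertex to the start of the walk built so far. The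
    -- infinite tail consists of the iterates of an element of `G` that maps `u` to an outneighbour.
    covering : ∀ vs → ∃[ f ] Walk f × ∃[ L ] (∀ {x} → x ∈ vs → ∃[ i ] i ≤ L × f i ≡ x)
    covering [] with outneighbours u
    ... | y , _ , _ , d , _ with transitive u y
    ...   | g , g∈G , refl = (λ i → iterate g i u) , walk , 0 , λ ()
      where
      walk : Walk (λ i → iterate g i u)
      walk zero    = d
      walk (suc i) = Δ-invariant {g} g∈G (walk i)
    covering (v ∷ vs) with covering vs
    ... | f , w , L , cov with prepend (strongly-connected v (f 0)) f w refl
    ...   | f′ , w′ , f′0≡ , k , shift = f′ , w′ , k + L , λ
      { (here refl) → 0 , z≤n , f′0≡
      ; (there x∈)  → let i , i≤L , eq = cov x∈
                      in k + i , ℕₚ.+-monoʳ-≤ k i≤L , trans (shift i) eq }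

  abstract
    coveringWalk : ∃[ f ] Walk f × ∃[ L ] (∀ x → ∃[ i ] i ≤ L × f i ≡ x)
    coveringWalk = let f , w , L , cov = covering (allFin n) in f , w , L , λ x → cov (∈-allFin x)

  module TransitiveNormal (N : PermGroup n) (N⊴G : N ⊴ G) (N-transitive : Transitive N) where

    N⊆G : ∀ {g} → Mem N g → Mem G g
    N⊆G {g} = proj₁ N⊴G {g}

    private
      conjugate∈N : ∀ a g → Mem N a → Mem N g → Mem N (a ∘ₚ g ∘ₚ flip a)
      conjugate∈N a g a∈N g∈N = ∙∈ N {a} {g ∘ₚ flip a} a∈N (∙∈ N {g} {flip a} g∈N (⁻¹∈ N {a} a∈N))

    -- The first suc t vertices of a walk form a directed t-arc.
    FixesArc : ℕ → (ℕ → Fin n) → Permutation′ n → Set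
    FixesArc t f g = ∀ {i} → i < suc t → Fixes g (f i)

    FixesOut : Fin n → Permutation′ n → Set
    FixesOut x g = ∀ y → Δ x y → Fixes g y

    ArcTransitive : ℕ → Set
    ArcTransitive t = ∀ f f′ → Walk f → Walk f′ →
      ∃[ g ] Mem N g × (∀ {i} → i < suc t → f i · g ≡ f′ i)

    StabilizerFixesOut : ℕ → (ℕ → Fin n) → Set
    StabilizerFixesOut t f = ∀ {g} → Mem N g → FixesArc t f g → FixesOut (f t) g

    -- There are only two outneighbours, so an element that permutes them without fixing both
    -- interchanges them.
    moves : ∀ {g x y z} → Mem G g → Fixes g x → ¬ FixesOut x g → Δ x y → Δ x z → y ≢ z → y · g ≡ z
    moves {g} {x} {y} {z} g∈G gx ¬fix xy xz y≢z =
      [ (λ gy → [ (λ zg≡y → contradiction (·-injective g (trans gy (sym zg≡y))) y≢z)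
                , (λ gz → contradiction (fix gy gz) ¬fix) ]′ (image xz))
      , (λ eq → eq) ]′ (image xy)
      where
      image : ∀ {w} → Δ x w → w · g ≡ y ⊎ w · g ≡ z
      image {w} xw = other-outneighbour xy xz y≢z (subst (λ x → Δ x (w · g)) gx (Δ-invariant {g} g∈G xw))
      fix : Fixes g y → Fixes g z → FixesOut x g
      fix gy gz w xw = [ (λ { refl → gy }) , (λ { refl → gz }) ]′ (other-outneighbour xy xz y≢z xw)

    private
      Mover : ℕ → (ℕ → Fin n) → Pred (Permutation′ n) 0ℓ
      Mover t f g = Mem N g × FixesArc t f g × ¬ FixesOut (f t) g

      mover? : ∀ t f → Dec (∃ (Mover t f))
      mover? t f = ∃ₚ?
        (λ {g} {h} g≈h (g∈N , fix , ¬out) → resp N {g} {h} g≈h g∈N , (λ i< → trans (sym (g≈h _)) (fix i<)) ,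
          λ out → ¬out (λ y d → trans (g≈h y) (out y d)))
        (λ g → mem? N g ×-dec (ℕₚ.allUpTo? (λ i → f i · g ≟ f i) (suc t) ×-dec ¬? (fixesOut? (f t) g)))
        where
        fixesOut? : ∀ x g → Dec (FixesOut x g)
        fixesOut? x g = all? (λ y → Δ? x y →-dec (y · g ≟ y))

    -- If an element of `N` fixes the `t`-arc of `f` but not the outneighbours of its end, it
    -- interchanges these two. Any two walks can be brought to `f` along their first `t` steps, and
    -- this element then corrects the next vertex where necessary.
    extend-arcs : ∀ {t f} → Walk f → ArcTransitive t → StabilizerFixesOut t f ⊎ ArcTransitive (suc t)
    extend-arcs {t} {f} wf trans-t with mover? t f
    ... | no ¬mover = inj₁ λ {g} g∈N fix y d →
      decidable-stable (y · g ≟ y) (λ ≢y → ¬mover (g , g∈N , fix , λ out → ≢y (out y d)))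
    ... | yes (g , g∈N , fix , ¬out) = inj₂ λ h h′ wh wh′ → join h h′ wh wh′ (trans-t h f wh wf) (trans-t h′ f wh′ wf)
      where
      join : ∀ h h′ → Walk h → Walk h′ →
             ∃[ a ] Mem N a × (∀ {i} → i < suc t → h i · a ≡ f i) →
             ∃[ b ] Mem N b × (∀ {i} → i < suc t → h′ i · b ≡ f i) →
             ∃[ c ] Mem N c × (∀ {i} → i < suc (suc t) → h i · c ≡ h′ i)
      join h h′ wh wh′ (a , a∈N , ha) (b , b∈N , h′b) with h (suc t) · a ≟ h′ (suc t) · b
      ... | yes eq = a ∘ₚ flip b , ∙∈ N {a} {flip b} a∈N (⁻¹∈ N {b} b∈N) , λ {i} i<2+t → maps i (ℕₚ.m<1+n⇒m<n∨m≡n i<2+t)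
        where
        maps : ∀ i → i < suc t ⊎ i ≡ suc t → h i · a · flip b ≡ h′ i
        maps i (inj₁ i<)   = ·-flip b (trans (h′b i<) (sym (ha i<)))
        maps i (inj₂ refl) = ·-flip b (sym eq)
      -- Both next vertices have become outneighbours of `f t`; they differ, so `g` takes one to the
      -- other.
      ... | no neq = a ∘ₚ g ∘ₚ flip b , ∙∈ N {a} {g ∘ₚ flip b} a∈N (∙∈ N {g} {flip b} g∈N (⁻¹∈ N {b} b∈N)) ,
                     λ {i} i<2+t → maps i (ℕₚ.m<1+n⇒m<n∨m≡n i<2+t)
        where
        outArc : ∀ {k c} → Mem N c → Walk k → (∀ {i} → i < suc t → k i · c ≡ f i) → Δ (f t) (k (suc t) · c)
        outArc {k} {c} c∈N wk kc = subst (λ x → Δ x (k (suc t) · c)) (kc (ℕₚ.n<1+n t)) (Δ-invariant {c} (N⊆G {c} c∈N) (wk t))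
        maps : ∀ i → i < suc t ⊎ i ≡ suc t → h i · a · g · flip b ≡ h′ i
        maps i (inj₁ i<) = ·-flip b (trans (h′b i<) (sym (trans (cong (_· g) (ha i<)) (fix i<))))
        maps i (inj₂ refl) = ·-flip b (sym (moves {g} (N⊆G {g} g∈N) (fix (ℕₚ.n<1+n t)) ¬out
          (outArc {h} {a} a∈N wh ha) (outArc {h′} {b} b∈N wh′ h′b) neq))

    private
      c : ℕ → Fin n
      c = proj₁ coveringWalk
      c-walk : Walk c
      c-walk = proj₁ (proj₂ coveringWalk)
      bound : ℕ
      bound = proj₁ (proj₂ (proj₂ coveringWalk))
      c-covers : ∀ x → ∃[ i ] i ≤ bound × c i ≡ x
      c-covers = proj₂ (proj₂ (proj₂ coveringWalk))

      -- `k` is the fuel. When it runs out, `bound ≤ t`, so the initial `t`-arc of `c` contains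
      -- every vertex and an element fixing it fixes everything.
      search : ∀ k t → bound ≤ t + k → ArcTransitive t → ∃[ t ] ArcTransitive t × StabilizerFixesOut t c
      search k t bound≤ trans-t with extend-arcs c-walk trans-t
      ... | inj₁ fix = t , trans-t , fix
      search (suc k) t bound≤ trans-t | inj₂ trans-t+1 = search k (suc t) (subst (bound ≤_) (ℕₚ.+-suc t k) bound≤) trans-t+1
      search zero    t bound≤ trans-t | inj₂ _ = t , trans-t , λ {g} g∈N fix y _ →
        let i , i≤ , eq = c-covers y
        in subst (Fixes g) eq (fix (s≤s (ℕₚ.≤-trans i≤ (subst (bound ≤_) (ℕₚ.+-identityʳ t) bound≤))))

      arcTransitive-zero : ArcTransitive 0
      arcTransitive-zero f f′ _ _ with N-transitive (f 0) (f′ 0)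
      ... | g , g∈N , eq = g , g∈N , λ { {zero} _ → eq ; {suc i} (s≤s ()) }

      abstract
        critical : ∃[ t ] ArcTransitive t × StabilizerFixesOut t c
        critical = search bound 0 ℕₚ.≤-refl arcTransitive-zero

      t : ℕ
      t = proj₁ critical

      trans-t : ArcTransitive t
      trans-t = proj₁ (proj₂ critical)

      -- Known for `c` only; conjugation by an element of `N` that maps the `t`-arc of `c` to that
      -- of `f` transports it to `f`.
      stabilizer-fixes-out : ∀ {f} → Walk f → StabilizerFixesOut t f
      stabilizer-fixes-out {f} wf {g} g∈N fix y d with trans-t c f c-walk wf
      ... | a , a∈N , ca = subst (Fixes g) (Perm.inverseʳ a) (·-injective (flip a) fixed)
        where
        y′ : Fin n
        y′ = y · flip a
        d′ : Δ (c t) y′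
        d′ = subst (λ x → Δ x y′) (·-flip a (ca (ℕₚ.n<1+n t))) (Δ-invariant {flip a} (⁻¹∈ G {a} (N⊆G {a} a∈N)) d)
        fixed : y′ · a · g · flip a ≡ y′ · a · flip a
        fixed = trans
          (proj₂ (proj₂ critical) {a ∘ₚ g ∘ₚ flip a} (conjugate∈N a g a∈N g∈N)
            (λ i< → ·-flip a (trans (ca i<) (sym (trans (cong (_· g) (ca i<)) (fix i<))))) y′ d′)
          (sym (·-flip a refl))

      shift-arc : ∀ {f g} → Walk f → FixesArc t f g → FixesOut (f t) g → FixesArc t (f ∘ suc) g
      shift-arc {f} {g} wf fix out {i} i< with ℕₚ.m<1+n⇒m<n∨m≡n i<
      ... | inj₁ i<t  = fix (s≤s i<t)
      ... | inj₂ refl = out (f (suc t)) (wf t)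

      -- An element of `N` fixing a `t`-arc fixes the arc shifted by one step, which allows
      -- induction along the walk.
      arc-stabilizer-fixes-walk : ∀ k {f g} → Walk f → Mem N g → FixesArc t f g → Fixes g (f k)
      arc-stabilizer-fixes-walk zero    wf g∈N fix = fix z<s
      arc-stabilizer-fixes-walk (suc k) {f} {g} wf g∈N fix = arc-stabilizer-fixes-walk k {f ∘ suc} {g} (wf ∘ suc) g∈N
        (shift-arc {f} {g} wf fix (stabilizer-fixes-out wf {g} g∈N fix))

      covered : ∀ {g} → (∀ k → Fixes g (c k)) → ∀ x → Fixes g x
      covered {g} fix x = let k , _ , eq = c-covers x in subst (Fixes g) eq (fix k)

      -- A conjugate of `g` fixes the `t`-arc of `c`, hence all of `c`, and `c` visits every vertex.
      arc-stabilizer-trivial : ∀ {f g} → Walk f → Mem N g → FixesArc t f g → ∀ x → Fixes g x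
      arc-stabilizer-trivial {f} {g} wf g∈N fix x with trans-t c f c-walk wf
      ... | a , a∈N , ca = subst (Fixes g) (Perm.inverseʳ a) (·-injective (flip a)
        (trans (covered {g′} (λ k → arc-stabilizer-fixes-walk k {c} {g′} c-walk g′∈N fix′) (x · flip a)) (sym (·-flip a refl))))
        where
        g′ : Permutation′ n
        g′ = a ∘ₚ g ∘ₚ flip a
        g′∈N : Mem N g′
        g′∈N = conjugate∈N a g a∈N g∈N
        fix′ : FixesArc t c g′
        fix′ i< = ·-flip a (trans (ca i<) (sym (trans (cong (_· g) (ca i<)) (fix i<))))

      -- The commutator of q with an element s of N shifting the arc fixes
      -- the arc, so q commutes with s and fixes the next arc as well.
      rigid : ∀ k {f q} → Walk f → Mem G q → FixesArc t f q → FixesOut (f t) q → Fixes q (f k)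
      rigid zero    wf q∈G fix out = fix z<s
      rigid (suc k) {f} {q} wf q∈G fix out with trans-t f (f ∘ suc) wf (wf ∘ suc)
      ... | s , s∈N , fs = rigid k {f ∘ suc} {q} (wf ∘ suc) q∈G fix′ out′
        where
        fix′ : FixesArc t (f ∘ suc) q
        fix′ = shift-arc {f} {q} wf fix out
        r : Permutation′ n
        r = ((flip q ∘ₚ s) ∘ₚ q) ∘ₚ flip s
        r-trivial : ∀ x → Fixes r x
        r-trivial = arc-stabilizer-trivial {f} {r} wf
          (∙∈ N {(flip q ∘ₚ s) ∘ₚ q} {flip s} (proj₂ N⊴G {q} {s} q∈G s∈N) (⁻¹∈ N {s} s∈N))
          (λ i< → ·-flip s (trans (fs i<) (sym (trans
            (cong (λ x → x · s · q) (·-flip q (fix i<))) (trans (cong (_· q) (fs i<)) (fix′ i<))))))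
        -- The outneighbours of `f (suc t)` are the images under `s` of those of `f t`. The latter
        -- are fixed by `q`, and `q` commutes with `s`.
        out′ : FixesOut (f (suc t)) q
        out′ y d = ·-injective (flip s) (trans
          (trans (cong (λ x → x · q · flip s) (sym (Perm.inverseʳ s)))
                 (cong (λ x → x · s · q · flip s) (sym (·-flip q w-fixed))))
          (r-trivial w))
          where
          w : Fin n
          w = y · flip s
          w-fixed : Fixes q w
          w-fixed = out w (subst (λ x → Δ x w) (·-flip s (fs (ℕₚ.n<1+n t)))
            (Δ-invariant {flip s} (⁻¹∈ G {s} (N⊆G {s} s∈N)) d))

    -- Multiplying by elements `a` and `b` of `N` makes `g` and `h` fix the `t`-arc of `c`. By
    -- `rigid` neither product fixes the outneighbours of its end, since `g` and `h` are not in `N`;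
    -- so both interchange them. The quotient of the two products then fixes everything, whence `g`
    -- times the inverse of `h` is a conjugate of `b` times the inverse of `a`.
    index≤2 : ∀ g h → Mem G g → Mem G h → ¬ Mem N g → ¬ Mem N h → Mem N (g ∘ₚ flip h)
    index≤2 g h g∈G h∈G g∉N h∉N with into-stabilizer g g∈G g∉N | into-stabilizer h h∈G h∉N
      where
      into-stabilizer : ∀ g → Mem G g → ¬ Mem N g → ∃[ a ] Mem N a × FixesArc t c (g ∘ₚ a) × ¬ FixesOut (c t) (g ∘ₚ a)
      into-stabilizer g g∈G g∉N with trans-t (λ i → c i · g) c (walk-image {c} {g} g∈G c-walk) c-walk
      ... | a , a∈N , fix = a , a∈N , fix , λ out → g∉N (resp N {flip a} {g}
        (λ x → sym (·-injective a (trans (covered {g ∘ₚ a} (λ k → rigid k {c} {g ∘ₚ a} c-walk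
            (∙∈ G {g} {a} g∈G (N⊆G {a} a∈N)) fix out) x) (sym (Perm.inverseʳ a)))))
        (⁻¹∈ N {a} a∈N))
    ... | a , a∈N , fix-a , ¬out-a | b , b∈N , fix-b , ¬out-b = resp N {x = (h ∘ₚ (b ∘ₚ flip a)) ∘ₚ flip h} {y = g ∘ₚ flip h}
        (λ x → cong (_· flip h) (·-flip a (sym (sym (ga≈hb x)))))
        (proj₂ N⊴G {flip h} {b ∘ₚ flip a} (⁻¹∈ G {h} h∈G) (∙∈ N {b} {flip a} b∈N (⁻¹∈ N {a} a∈N)))
      where
      p q r : Permutation′ n
      p = g ∘ₚ a
      q = h ∘ₚ b
      r = p ∘ₚ flip q
      p∈G : Mem G p
      p∈G = ∙∈ G {g} {a} g∈G (N⊆G {a} a∈N)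
      q∈G : Mem G q
      q∈G = ∙∈ G {h} {b} h∈G (N⊆G {b} b∈N)
      out-r : FixesOut (c t) r
      out-r y d = swap-back (outneighbours (c t))
        where
        swap-back : ∃[ y ] ∃[ z ] y ≢ z × Δ (c t) y × Δ (c t) z × (∀ {w} → Δ (c t) w → w ≡ y ⊎ w ≡ z) → Fixes r y
        swap-back (y₁ , y₂ , y₁≢y₂ , d₁ , d₂ , only) =
          [ (λ { refl → ·-flip q (trans (moves {q} q∈G (fix-b (ℕₚ.n<1+n t)) ¬out-b d₁ d₂ y₁≢y₂)
                                   (sym (moves {p} p∈G (fix-a (ℕₚ.n<1+n t)) ¬out-a d₁ d₂ y₁≢y₂))) })
          , (λ { refl → ·-flip q (trans (moves {q} q∈G (fix-b (ℕₚ.n<1+n t)) ¬out-b d₂ d₁ (y₁≢y₂ ∘ sym))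
                                   (sym (moves {p} p∈G (fix-a (ℕₚ.n<1+n t)) ¬out-a d₂ d₁ (y₁≢y₂ ∘ sym)))) })
          ]′ (only d)
      ga≈hb : ∀ x → x · g · a ≡ x · h · b
      ga≈hb x = ·-injective (flip q) (trans
        (covered {r} (λ k → rigid k {c} {r} c-walk (∙∈ G {p} {flip q} p∈G (⁻¹∈ G {q} q∈G))
          (λ i< → ·-flip q (trans (fix-b i<) (sym (fix-a i<)))) out-r) x)
        (sym (·-flip q refl)))

-- Isomorphisms, conjugates and intersections of subgroups

isIsomorphism : ∀ (A B : Group 0ℓ 0ℓ) (f : Group.Carrier A → Group.Carrier B) →
  let module A = Group A ; module B = Group B in
  (∀ {x y} → x A.≈ y → f x B.≈ f y) → (∀ x y → f (x A.∙ y) B.≈ f x B.∙ f y) →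
  (∀ {x y} → f x B.≈ f y → x A.≈ y) → (∀ y → ∃[ x ] f x B.≈ y) → IsIsomorphism A B f
isIsomorphism A B f f-cong f-∙ f-inj f-surj = record
  { isGroupMonomorphism = record
    { isGroupHomomorphism = record
      { isMonoidHomomorphism = record
        { isMagmaHomomorphism = record { isRelHomomorphism = record { cong = f-cong } ; homo = f-∙ }
        ; ε-homo = f-ε
        }
      ; ⁻¹-homo = λ x → inverseˡ-unique _ _
          (B.trans (B.sym (f-∙ (x A.⁻¹) x)) (B.trans (f-cong (A.inverseˡ x)) f-ε))
      }
    ; injective = f-inj
    }
  ; surjective = λ y → proj₁ (f-surj y) , λ eq → B.trans (f-cong eq) (proj₂ (f-surj y))
  }
  where
  module A = Group A
  module B = Group B
  open GroupProperties B
  f-ε : f A.ε B.≈ B.ε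
  f-ε = identityˡ-unique (f A.ε) (f A.ε) (B.trans (B.sym (f-∙ A.ε A.ε)) (f-cong (A.identityˡ A.ε)))

module Conjugation (A : Group 0ℓ 0ℓ) where
  open Group A

  infix 9 _^^_
  _^^_ : Carrier → Carrier → Carrier
  x ^^ h = (h ⁻¹ ∙ x) ∙ h

  ^^-cong : ∀ {x y} h → x ≈ y → x ^^ h ≈ y ^^ h
  ^^-cong h eq = ∙-congʳ (∙-congˡ eq)

module _ {A : Group 0ℓ 0ℓ} where
  open Conjugation A
  open Group A renaming (refl to ≈-refl; sym to ≈-sym; trans to ≈-trans)
  open FreeGroup A

  infixl 6 _⊓_
  _⊓_ : Subgroup A → Subgroup A → Subgroup A
  H ⊓ K = record
    { Mem  = λ x → Mem H x × Mem K x
    ; mem? = λ x → mem? H x ×-dec mem? K x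
    ; resp = λ eq (p , q) → resp H eq p , resp K eq q
    ; ε∈   = ε∈ H , ε∈ K
    ; ∙∈   = λ (p , q) (r , s) → ∙∈ H p r , ∙∈ K q s
    ; ⁻¹∈  = λ (p , q) → ⁻¹∈ H p , ⁻¹∈ K q
    }

  ⊓-normal : ∀ {H K L} → H ⊴ L → K ⊴ L → H ⊓ K ⊴ L
  ⊓-normal (H⊆ , H-conj) (_ , K-conj) = H⊆ ∘ proj₁ , λ l∈ (p , q) → H-conj l∈ p , K-conj l∈ q

  -- This is `h ⁻¹ H h`, described through the inverse conjugation so that its membership is decided
  -- by that of `H`.
  conjugate : Subgroup A → Carrier → Subgroup A
  conjugate H h = record
    { Mem  = λ x → Mem H ((h ∙ x) ∙ h ⁻¹)
    ; mem? = λ x → mem? H ((h ∙ x) ∙ h ⁻¹)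
    ; resp = λ eq → resp H (∙-congʳ (∙-congˡ eq))
    ; ε∈   = resp H (freely₂ h h :ε (v₀ :∙ :ε :∙ v₀ :⁻¹) refl) (ε∈ H)
    ; ∙∈   = λ {x} {y} p q → resp H
        (freely₃ h x y ((v₀ :∙ v₁ :∙ v₀ :⁻¹) :∙ (v₀ :∙ v₂ :∙ v₀ :⁻¹)) (v₀ :∙ (v₁ :∙ v₂) :∙ v₀ :⁻¹) refl) (∙∈ H p q)
    ; ⁻¹∈  = λ {x} p → resp H (freely₂ h x ((v₀ :∙ v₁ :∙ v₀ :⁻¹) :⁻¹) (v₀ :∙ v₁ :⁻¹ :∙ v₀ :⁻¹) refl) (⁻¹∈ H p)
    }

  ^^∈conjugate : ∀ H {x} h → Mem H x → Mem (conjugate H h) (x ^^ h)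
  ^^∈conjugate H {x} h = resp H (freely₂ h x v₁ (v₀ :∙ (v₀ :⁻¹ :∙ v₁ :∙ v₀) :∙ v₀ :⁻¹) refl)

  Trivial : Subgroup A → Set
  Trivial H = ∀ {x} → Mem H x → x ≈ ε

  -- The commutator of `x` and `y` lies in both subgroups.
  disjoint-normals-commute : ∀ {H K L} → H ⊴ L → K ⊴ L → Trivial (H ⊓ K) →
                             ∀ {x y} → Mem H x → Mem K y → x ∙ y ≈ y ∙ x
  disjoint-normals-commute {H} {K} (H⊆ , H-conj) (K⊆ , K-conj) trivial {x} {y} x∈ y∈ = ≈-sym (≈-trans
    (≈-trans (≈-sym (identityʳ _)) (∙-congˡ (≈-sym (trivial
      ( resp H (freely₂ x y (v₀ :⁻¹ :∙ (v₁ :⁻¹ :∙ v₀ :∙ v₁)) (v₀ :⁻¹ :∙ v₁ :⁻¹ :∙ v₀ :∙ v₁) refl)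
          (∙∈ H (⁻¹∈ H x∈) (H-conj (K⊆ y∈) x∈))
      , ∙∈ K (K-conj (H⊆ x∈) (⁻¹∈ K y∈)) y∈ )))))
    (freely₂ x y (v₁ :∙ v₀ :∙ (v₀ :⁻¹ :∙ v₁ :⁻¹ :∙ v₀ :∙ v₁)) (v₀ :∙ v₁) refl))

  -- `M` could depend on the proof of membership in `H`; `resp M` excludes this, because equality in
  -- `subgroup→group H` ignores that proof.
  embed : (H : Subgroup A) → Subgroup (subgroup→group H) → Subgroup A
  embed H M = record
    { Mem  = λ x → Σ[ p ∈ Mem H x ] Mem M (x , p)
    ; mem? = λ x → decide x (mem? H x)
    ; resp = λ eq (p , q) → resp H eq p , resp M eq q
    ; ε∈   = ε∈ H , ε∈ M
    ; ∙∈   = λ (p , q) (r , s) → ∙∈ H p r , ∙∈ M q s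
    ; ⁻¹∈  = λ (p , q) → ⁻¹∈ H p , ⁻¹∈ M q
    }
    where
    decide : ∀ x → Dec (Mem H x) → Dec (Σ[ p ∈ Mem H x ] Mem M (x , p))
    decide x (no x∉)  = no (x∉ ∘ proj₁)
    decide x (yes x∈) = map′ (x∈ ,_) (λ (p , q) → resp M ≈-refl q) (mem? M (x , x∈))

  embed-normal : ∀ H M → M ⊴ whole (subgroup→group H) → embed H M ⊴ H
  embed-normal H M (_ , M-conj) = proj₁ , λ h∈ (x∈ , q) →
    ∙∈ H (∙∈ H (⁻¹∈ H h∈) x∈) h∈ , M-conj {_ , h∈} tt q

  module _ (finite : FiniteGroup A) where
    open FiniteSearch (proj₂ finite)

    nontrivial-or-trivial : (H : Subgroup A) → Nontrivial H ⊎ Trivial H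
    nontrivial-or-trivial H with ∃? (λ x≈y (x∈ , x≉) → resp H x≈y x∈ , x≉ ∘ ≈-trans x≈y)
                                    (λ x → mem? H x ×-dec ¬? (x ≈? ε))
    ... | yes nt = inj₁ nt
    ... | no  t  = inj₂ λ {x} x∈ → decidable-stable (x ≈? ε) (λ x≉ → t (x , x∈ , x≉))

    subgroup-simple : (H : Subgroup A) → Nontrivial H →
                      (∀ M → M ⊴ H → Nontrivial M → ∀ {x} → Mem H x → Mem M x) →
                      Simple (subgroup→group H)
    subgroup-simple H (x , x∈ , x≉) least = ((x , x∈) , tt , x≉) , λ M M⊴ → dichotomy M M⊴ (nontrivial-or-trivial (embed H M))
      where
      dichotomy : ∀ M → M ⊴ whole (subgroup→group H) → Nontrivial (embed H M) ⊎ Trivial (embed H M) →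
                  (∀ {x} → Mem M x → proj₁ x ≈ ε) ⊎ (∀ x → Mem M x)
      dichotomy M M⊴ (inj₁ nt) = inj₂ λ (x , x∈) → resp M ≈-refl (proj₂ (least (embed H M) (embed-normal H M M⊴) nt x∈))
      dichotomy M M⊴ (inj₂ t)  = inj₁ λ {x} x∈M → t (proj₂ x , x∈M)

-- A minimal normal subgroup N of index two that is not simple is the
-- product of a minimal normal subgroup T of N and its conjugate.
module ConjugateFactors {A : Group 0ℓ 0ℓ} (finite : FiniteGroup A) {G N T : Subgroup A}
  (N-min : MinimalNormal N G) (T-min : MinimalNormal T N) (N⊈T : ¬ (∀ x → Mem N x → Mem T x))
  (index≤2 : ∀ g h → Mem G g → Mem G h → ¬ Mem N g → ¬ Mem N h → Mem N (Group._∙_ A g (Group._⁻¹ A h)))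
  (h : Group.Carrier A) (h∈G : Mem G h) (h∉N : ¬ Mem N h) where
  open Group A renaming (refl to ≈-refl; sym to ≈-sym; trans to ≈-trans)
  open GroupProperties A
  open Conjugation A
  open FreeGroup A
  open FiniteSearch (proj₂ finite)
  open import Relation.Binary.Reasoning.Setoid (Group.setoid A)

  private
    N⊆G : ∀ {x} → Mem N x → Mem G x
    N⊆G = proj₁ (proj₁ N-min)
    N-conj : ∀ {g x} → Mem G g → Mem N x → Mem N (x ^^ g)
    N-conj = proj₂ (proj₁ N-min)
    T⊆N : ∀ {x} → Mem T x → Mem N x
    T⊆N = proj₁ (proj₁ T-min)
    T-conj : ∀ {g x} → Mem N g → Mem T x → Mem T (x ^^ g)
    T-conj = proj₂ (proj₁ T-min)

    Tʰ : Subgroup A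
    Tʰ = conjugate T h

    h⁻¹∉N : ¬ Mem N (h ⁻¹)
    h⁻¹∉N p = h∉N (resp N (⁻¹-involutive h) (⁻¹∈ N p))

  h²∈N : Mem N (h ∙ h)
  h²∈N = resp N (∙-congˡ (⁻¹-involutive h)) (index≤2 h (h ⁻¹) h∈G (⁻¹∈ G h∈G) h∉N h⁻¹∉N)

  coset : ∀ {g} → Mem G g → Mem N g ⊎ Mem N (g ∙ h ⁻¹)
  coset {g} g∈G with mem? N g
  ... | yes g∈N = inj₁ g∈N
  ... | no  g∉N = inj₂ (index≤2 g h g∈G h∈G g∉N h∉N)

  private
    -- `G` is the union of `N` and the coset of `h`, so invariance under `N` and under `h` is
    -- enough.
    normal-by : (M : Subgroup A) → (∀ {x} → Mem M x → Mem G x) →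
                (∀ {g x} → Mem N g → Mem M x → Mem M (x ^^ g)) → (∀ {x} → Mem M x → Mem M (x ^^ h)) → M ⊴ G
    normal-by M M⊆G by-N by-h = M⊆G , λ {g} {x} g∈G x∈M →
      [ (λ g∈N → by-N g∈N x∈M)
      , (λ m∈N → resp M (freely₃ g h x (v₁ :⁻¹ :∙ ((v₀ :∙ v₁ :⁻¹) :⁻¹ :∙ v₂ :∙ (v₀ :∙ v₁ :⁻¹)) :∙ v₁) (v₀ :⁻¹ :∙ v₂ :∙ v₀) refl)
                        (by-h (by-N m∈N x∈M)))
      ]′ (coset g∈G)

    Tʰ⊆N : ∀ {x} → Mem Tʰ x → Mem N x
    Tʰ⊆N {x} p = resp N (freely₂ h x (v₀ :⁻¹ :∙ (v₀ :∙ v₁ :∙ v₀ :⁻¹) :∙ v₀) v₁ refl) (N-conj h∈G (T⊆N p))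

    Tʰ-conj : ∀ {g x} → Mem N g → Mem Tʰ x → Mem Tʰ (x ^^ g)
    Tʰ-conj {g} {x} g∈N p = resp T
      (freely₃ g h x ((v₁ :∙ v₀ :∙ v₁ :⁻¹) :⁻¹ :∙ (v₁ :∙ v₂ :∙ v₁ :⁻¹) :∙ (v₁ :∙ v₀ :∙ v₁ :⁻¹))
                     (v₁ :∙ (v₀ :⁻¹ :∙ v₂ :∙ v₀) :∙ v₁ :⁻¹) refl)
      (T-conj (resp N (freely₂ g h (v₁ :⁻¹ :⁻¹ :∙ v₀ :∙ v₁ :⁻¹) (v₁ :∙ v₀ :∙ v₁ :⁻¹) refl) (N-conj (⁻¹∈ G h∈G) g∈N)) p)

    Tʰ^h⊆T : ∀ {x} → Mem Tʰ x → Mem T (x ^^ h)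
    Tʰ^h⊆T {x} p = resp T
      (freely₂ h x ((v₀ :∙ v₀) :⁻¹ :∙ (v₀ :∙ v₁ :∙ v₀ :⁻¹) :∙ (v₀ :∙ v₀)) (v₀ :⁻¹ :∙ v₁ :∙ v₀) refl)
      (T-conj h²∈N p)

    -- Conjugation by `h` interchanges `T` and `Tʰ`, as `h ∙ h` lies in `N` and normalizes `T`. The
    -- intersection is therefore normal in `G`, and if it were nontrivial, minimality of `N` would
    -- put `N` inside `T`.
    T⊓Tʰ-trivial : Trivial (T ⊓ Tʰ)
    T⊓Tʰ-trivial = [ (λ nt → contradiction (λ _ x∈N → proj₁ (proj₂ (proj₂ N-min) (T ⊓ Tʰ) normal nt (T⊆N ∘ proj₁) x∈N)) N⊈T)
                   , (λ t → t) ]′ (nontrivial-or-trivial finite (T ⊓ Tʰ))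
      where
      normal : T ⊓ Tʰ ⊴ G
      normal = normal-by (T ⊓ Tʰ) (N⊆G ∘ T⊆N ∘ proj₁) (λ g∈N (p , q) → T-conj g∈N p , Tʰ-conj g∈N q)
                         (λ (p , q) → Tʰ^h⊆T q , ^^∈conjugate T h p)

    T-Tʰ-commute : ∀ {x y} → Mem T x → Mem Tʰ y → x ∙ y ≈ y ∙ x
    T-Tʰ-commute = disjoint-normals-commute {H = T} {K = Tʰ} {L = N} (proj₁ T-min) (Tʰ⊆N , Tʰ-conj) T⊓Tʰ-trivial

  ^h-∙ : ∀ x y → (x ∙ y) ^^ h ≈ x ^^ h ∙ y ^^ h
  ^h-∙ x y = freely₃ h x y (v₀ :⁻¹ :∙ (v₁ :∙ v₂) :∙ v₀) ((v₀ :⁻¹ :∙ v₁ :∙ v₀) :∙ (v₀ :⁻¹ :∙ v₂ :∙ v₀)) refl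

  factors-commute : ∀ {s t} → Mem T s → Mem T t → s ∙ t ^^ h ≈ t ^^ h ∙ s
  factors-commute s∈ t∈ = T-Tʰ-commute s∈ (^^∈conjugate T h t∈)

  private
    interchange : ∀ {x y z w} → y ∙ z ≈ z ∙ y → (x ∙ y) ∙ (z ∙ w) ≈ (x ∙ z) ∙ (y ∙ w)
    interchange {x} {y} {z} {w} eq = ≈-trans (freely₄ x y z w ((v₀ :∙ v₁) :∙ (v₂ :∙ v₃)) (v₀ :∙ (v₁ :∙ v₂) :∙ v₃) refl)
      (≈-trans (∙-congʳ (∙-congˡ eq)) (freely₄ x y z w (v₀ :∙ (v₂ :∙ v₁) :∙ v₃) ((v₀ :∙ v₂) :∙ (v₁ :∙ v₃)) refl))

  pair-∙ : ∀ {s t s′ t′} → Mem T t → Mem T s′ →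
           (s ∙ t ^^ h) ∙ (s′ ∙ t′ ^^ h) ≈ (s ∙ s′) ∙ (t ∙ t′) ^^ h
  pair-∙ {s} {t} {s′} {t′} t∈ s′∈ = ≈-trans (interchange (≈-sym (factors-commute s′∈ t∈))) (∙-congˡ (≈-sym (^h-∙ t t′)))

  private
    -- The product of the two factors, phrased with a single existential variable so that a search
    -- decides it. It is closed under multiplication because the factors commute.
    TTʰ : Subgroup A
    TTʰ = record
      { Mem  = InTTʰ
      ; mem? = λ x → ∃? (λ t≈t′ (p , q) → resp T t≈t′ p , resp Tʰ (∙-congʳ (⁻¹-cong t≈t′)) q)
                        (λ t → mem? T t ×-dec mem? Tʰ (t ⁻¹ ∙ x))
      ; resp = λ x≈y (t , p , q) → t , p , resp Tʰ (∙-congˡ x≈y) q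
      ; ε∈   = ε , ε∈ T , resp Tʰ (freely₂ h h :ε (:ε :⁻¹ :∙ :ε) refl) (ε∈ Tʰ)
      ; ∙∈   = λ {x} {y} (t , p , q) (s , r , m) → t ∙ s , ∙∈ T p r , resp Tʰ
          (≈-trans (∙-congʳ (≈-sym (conj-trivial (T-Tʰ-commute r q))))
            (freely₄ t x s y ((v₂ :⁻¹ :∙ ((v₀ :⁻¹ :∙ v₁) :∙ v₂)) :∙ (v₂ :⁻¹ :∙ v₃)) ((v₀ :∙ v₂) :⁻¹ :∙ (v₁ :∙ v₃)) refl)) (∙∈ Tʰ q m)
      ; ⁻¹∈  = λ {x} (t , p , q) → t ⁻¹ , ⁻¹∈ T p , resp Tʰ
          (≈-trans (≈-sym (conj-trivial (T-Tʰ-commute (⁻¹∈ T p) (⁻¹∈ Tʰ q))))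
            (freely₂ t x ((v₀ :⁻¹) :⁻¹ :∙ ((v₀ :⁻¹ :∙ v₁) :⁻¹ :∙ v₀ :⁻¹)) (v₀ :⁻¹ :⁻¹ :∙ v₁ :⁻¹) refl)) (⁻¹∈ Tʰ q)
      }
      where
      InTTʰ : Pred Carrier 0ℓ
      InTTʰ x = ∃[ t ] Mem T t × Mem Tʰ (t ⁻¹ ∙ x)
      conj-trivial : ∀ {s q} → s ∙ q ≈ q ∙ s → s ⁻¹ ∙ (q ∙ s) ≈ q
      conj-trivial {s} {q} eq = ≈-trans (∙-congˡ (≈-sym eq)) (\\-leftDividesʳ s q)

    T⊆TTʰ : ∀ {t} → Mem T t → Mem TTʰ t
    T⊆TTʰ {t} p = t , p , resp Tʰ (≈-sym (inverseˡ t)) (ε∈ Tʰ)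

    Tʰ⊆TTʰ : ∀ {s} → Mem Tʰ s → Mem TTʰ s
    Tʰ⊆TTʰ {s} p = ε , ε∈ T , resp Tʰ (freely₂ s s v₀ (:ε :⁻¹ :∙ v₀) refl) p

    split : ∀ {x} → Mem TTʰ x → ∃[ t ] ∃[ s ] Mem T t × Mem Tʰ s × t ∙ s ≈ x
    split {x} (t , p , q) = t , t ⁻¹ ∙ x , p , q , \\-leftDividesˡ t x

    -- `h` interchanges the factors, so their product is normal in `G` and minimality of `N`
    -- applies.
    N⊆TTʰ : ∀ {x} → Mem N x → Mem TTʰ x
    N⊆TTʰ = proj₂ (proj₂ N-min) TTʰ normal nontrivial TTʰ⊆N
      where
      TTʰ⊆N : ∀ {x} → Mem TTʰ x → Mem N x
      TTʰ⊆N p = let t , s , t∈ , s∈ , eq = split p in resp N eq (∙∈ N (T⊆N t∈) (Tʰ⊆N s∈))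
      nontrivial : Nontrivial TTʰ
      nontrivial = let x , x∈ , x≉ = proj₁ (proj₂ T-min) in x , T⊆TTʰ x∈ , x≉
      conj : ∀ {g x t s} → t ∙ s ≈ x → Mem TTʰ (t ^^ g) → Mem TTʰ (s ^^ g) → Mem TTʰ (x ^^ g)
      conj {g} {x} {t} {s} eq p q = resp TTʰ (≈-trans
        (freely₃ g t s ((v₀ :⁻¹ :∙ v₁ :∙ v₀) :∙ (v₀ :⁻¹ :∙ v₂ :∙ v₀)) (v₀ :⁻¹ :∙ (v₁ :∙ v₂) :∙ v₀) refl)
        (^^-cong g eq)) (∙∈ TTʰ p q)
      normal : TTʰ ⊴ G
      normal = normal-by TTʰ (N⊆G ∘ TTʰ⊆N)
        (λ g∈N p → let t , s , t∈ , s∈ , eq = split p in conj eq (T⊆TTʰ (T-conj g∈N t∈)) (Tʰ⊆TTʰ (Tʰ-conj g∈N s∈)))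
        (λ p → let t , s , t∈ , s∈ , eq = split p in conj eq (Tʰ⊆TTʰ (^^∈conjugate T h t∈)) (T⊆TTʰ (Tʰ^h⊆T s∈)))

  abstract
    decompose : ∀ {x} → Mem N x → ∃[ s ] ∃[ t ] Mem T s × Mem T t × s ∙ t ^^ h ≈ x
    decompose {x} x∈N = let s , p , q = N⊆TTʰ x∈N in s , (h ∙ (s ⁻¹ ∙ x)) ∙ h ⁻¹ , p , q ,
      freely₃ h s x (v₁ :∙ (v₀ :⁻¹ :∙ ((v₀ :∙ (v₁ :⁻¹ :∙ v₂)) :∙ v₀ :⁻¹) :∙ v₀)) v₂ refl

  pair∈N : ∀ {s t} → Mem T s → Mem T t → Mem N (s ∙ t ^^ h)
  pair∈N s∈ t∈ = ∙∈ N (T⊆N s∈) (N-conj h∈G (T⊆N t∈))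

  decomposition-unique : ∀ {s t s′ t′} → Mem T s → Mem T t → Mem T s′ → Mem T t′ →
                         s ∙ t ^^ h ≈ s′ ∙ t′ ^^ h → s ≈ s′ × t ≈ t′
  decomposition-unique {s} {t} {s′} {t′} s∈ t∈ s′∈ t′∈ eq = s≈s′ , t≈t′
    where
    quotients : s′ ⁻¹ ∙ s ≈ (t′ ∙ t ⁻¹) ^^ h
    quotients = ≈-trans (freely₄ s′ s t h (v₀ :⁻¹ :∙ v₁) (v₀ :⁻¹ :∙ (v₁ :∙ (v₃ :⁻¹ :∙ v₂ :∙ v₃)) :∙ (v₃ :⁻¹ :∙ v₂ :∙ v₃) :⁻¹) refl)
      (≈-trans (∙-congʳ (∙-congˡ eq))
        (freely₄ s′ t′ t h (v₀ :⁻¹ :∙ (v₀ :∙ (v₃ :⁻¹ :∙ v₁ :∙ v₃)) :∙ (v₃ :⁻¹ :∙ v₂ :∙ v₃) :⁻¹) (v₃ :⁻¹ :∙ (v₁ :∙ v₂ :⁻¹) :∙ v₃) refl))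
    trivial : s′ ⁻¹ ∙ s ≈ ε
    trivial = T⊓Tʰ-trivial (∙∈ T (⁻¹∈ T s′∈) s∈ , resp Tʰ (≈-sym quotients) (^^∈conjugate T h (∙∈ T t′∈ (⁻¹∈ T t∈))))
    s≈s′ : s ≈ s′
    s≈s′ = ≈-trans (≈-sym (\\-leftDividesˡ s′ s)) (≈-trans (∙-congˡ trivial) (identityʳ s′))
    t≈t′ : t ≈ t′
    t≈t′ = ≈-sym (x∙y⁻¹≈ε⇒x≈y t′ t (≈-trans (freely₂ h (t′ ∙ t ⁻¹) v₁ (v₀ :∙ (v₀ :⁻¹ :∙ v₁ :∙ v₀) :∙ v₀ :⁻¹) refl)
      (≈-trans (∙-congʳ (∙-congˡ (≈-trans (≈-sym quotients) trivial))) (freely₂ h h (v₀ :∙ :ε :∙ v₀ :⁻¹) :ε refl))))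

  -- A normal subgroup of `T` is centralized by `Tʰ`, hence normal in the product `N`, and
  -- minimality of `T` in `N` applies.
  factor-simple : Simple (subgroup→group T)
  factor-simple = subgroup-simple finite T (proj₁ (proj₂ T-min)) λ M M⊴T nt →
    proj₂ (proj₂ T-min) M
      ( T⊆N ∘ proj₁ M⊴T
      , λ {g} {x} g∈N x∈M → let s , t , s∈ , t∈ , eq = decompose g∈N in
          resp M (≈-trans (≈-sym (conj-s x (proj₁ M⊴T x∈M) s∈ t∈)) (∙-cong (∙-congʳ (⁻¹-cong eq)) eq))
            (proj₂ M⊴T s∈ x∈M) )
      nt (proj₁ M⊴T)
    where
    conj-s : ∀ x {s t} → Mem T x → Mem T s → Mem T t → x ^^ (s ∙ t ^^ h) ≈ x ^^ s
    conj-s x {s} {t} x∈ s∈ t∈ = ≈-trans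
      (freely₃ x s (t ^^ h) ((v₁ :∙ v₂) :⁻¹ :∙ v₀ :∙ (v₁ :∙ v₂)) (v₂ :⁻¹ :∙ ((v₁ :⁻¹ :∙ v₀ :∙ v₁) :∙ v₂)) refl)
      (≈-trans (∙-congˡ (factors-commute (∙∈ T (∙∈ T (⁻¹∈ T s∈) x∈) s∈) t∈)) (\\-leftDividesʳ (t ^^ h) (x ^^ s)))

  factor-nonabelian : ¬ (∀ {x y} → Mem N x → Mem N y → x ∙ y ≈ y ∙ x) → Nonabelian (subgroup→group T)
  factor-nonabelian N-nonabelian T-comm = N-nonabelian λ x∈ y∈ → commute (decompose x∈) (decompose y∈)
    where
    commute : ∀ {x y} → ∃[ s ] ∃[ t ] Mem T s × Mem T t × s ∙ t ^^ h ≈ x →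
              ∃[ s ] ∃[ t ] Mem T s × Mem T t × s ∙ t ^^ h ≈ y → x ∙ y ≈ y ∙ x
    commute {x} {y} (s , t , s∈ , t∈ , eq) (s′ , t′ , s′∈ , t′∈ , eq′) = begin
      x ∙ y                            ≈⟨ ∙-cong eq eq′ ⟨
      (s ∙ t ^^ h) ∙ (s′ ∙ t′ ^^ h)    ≈⟨ pair-∙ {s} {t} {s′} {t′} t∈ s′∈ ⟩
      (s ∙ s′) ∙ (t ∙ t′) ^^ h         ≈⟨ ∙-cong (T-comm (s , s∈) (s′ , s′∈)) (^^-cong h (T-comm (t , t∈) (t′ , t′∈))) ⟩
      (s′ ∙ s) ∙ (t′ ∙ t) ^^ h         ≈⟨ pair-∙ {s′} {t′} {s} {t} t′∈ s∈ ⟨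
      (s′ ∙ t′ ^^ h) ∙ (s ∙ t ^^ h)    ≈⟨ ∙-cong eq′ eq ⟩
      y ∙ x                            ∎

  coordinates : ∃ (Mem N) → ∃ (Mem T) × ∃ (Mem T)
  coordinates (x , x∈N) = let s , t , s∈ , t∈ , _ = decompose x∈N in (s , s∈) , (t , t∈)

  pair : ∃ (Mem T) × ∃ (Mem T) → ∃ (Mem N)
  pair ((s , s∈) , (t , t∈)) = s ∙ t ^^ h , pair∈N s∈ t∈

  pair-coordinates : ∀ x → proj₁ (pair (coordinates x)) ≈ proj₁ x
  pair-coordinates (x , x∈N) = proj₂ (proj₂ (proj₂ (proj₂ (decompose x∈N))))

  infix 4 _≈²_
  _≈²_ : Rel (∃ (Mem T) × ∃ (Mem T)) 0ℓ
  p ≈² q = proj₁ (proj₁ p) ≈ proj₁ (proj₁ q) × proj₁ (proj₂ p) ≈ proj₁ (proj₂ q)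

  pair-injective : ∀ p q → proj₁ (pair p) ≈ proj₁ (pair q) → p ≈² q
  pair-injective ((_ , s∈) , (_ , t∈)) ((_ , s′∈) , (_ , t′∈)) = decomposition-unique s∈ t∈ s′∈ t′∈

  pair-cong : ∀ p q → p ≈² q → proj₁ (pair p) ≈ proj₁ (pair q)
  pair-cong p q (eq , eq′) = ∙-cong eq (^^-cong h eq′)

  infixl 7 _·N_
  _·N_ : ∃ (Mem N) → ∃ (Mem N) → ∃ (Mem N)
  _·N_ = Group._∙_ (subgroup→group N)
  infixl 7 _·²_
  _·²_ : ∃ (Mem T) × ∃ (Mem T) → ∃ (Mem T) × ∃ (Mem T) → ∃ (Mem T) × ∃ (Mem T)
  _·²_ = Group._∙_ (DirectProduct.group (subgroup→group T) (subgroup→group T))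

  pair-homo : ∀ p q → proj₁ (pair p) ∙ proj₁ (pair q) ≈ proj₁ (pair (p ·² q))
  pair-homo ((s , s∈) , (t , t∈)) ((s′ , s′∈) , (t′ , t′∈)) = pair-∙ {s} {t} {s′} {t′} t∈ s′∈

  coordinates-cong : ∀ x y → proj₁ x ≈ proj₁ y → coordinates x ≈² coordinates y
  coordinates-cong x y x≈y = pair-injective (coordinates x) (coordinates y)
    (≈-trans (pair-coordinates x) (≈-trans x≈y (≈-sym (pair-coordinates y))))

  coordinates-pair : ∀ p → coordinates (pair p) ≈² p
  coordinates-pair p = pair-injective (coordinates (pair p)) p (pair-coordinates (pair p))

  coordinates-homo : ∀ x y → coordinates (x ·N y) ≈² coordinates x ·² coordinates y
  coordinates-homo x y = pair-injective (coordinates (x ·N y)) (coordinates x ·² coordinates y) (begin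
    proj₁ (pair (coordinates (x ·N y)))                          ≈⟨ pair-coordinates (x ·N y) ⟩
    proj₁ x ∙ proj₁ y                                            ≈⟨ ∙-cong (pair-coordinates x) (pair-coordinates y) ⟨
    proj₁ (pair (coordinates x)) ∙ proj₁ (pair (coordinates y))  ≈⟨ pair-homo (coordinates x) (coordinates y) ⟩
    proj₁ (pair (coordinates x ·² coordinates y))                ∎)

  isPower : subgroup→group N ≅ power (subgroup→group T) 2
  isPower = f , isIsomorphism (subgroup→group N) (power (subgroup→group T) 2) f
    (λ {x} {y} x≈y → λ { zero → proj₁ (coordinates-cong x y x≈y) ; (suc zero) → proj₂ (coordinates-cong x y x≈y) })
    (λ x y → λ { zero → proj₁ (coordinates-homo x y) ; (suc zero) → proj₂ (coordinates-homo x y) })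
    (λ {x} {y} eq → ≈-trans (≈-sym (pair-coordinates x))
      (≈-trans (pair-cong (coordinates x) (coordinates y) (eq zero , eq (suc zero))) (pair-coordinates y)))
    (λ g → let p = g zero , g (suc zero) in pair p ,
      λ { zero → proj₁ (coordinates-pair p) ; (suc zero) → proj₂ (coordinates-pair p) })
    where
    f : ∃ (Mem N) → Fin 2 → ∃ (Mem T)
    f x zero    = proj₁ (coordinates x)
    f x (suc _) = proj₂ (coordinates x)

  -- Conjugating twice by `h` is the identity and the factors commute, so `h` acts on `N` as the
  -- swap of coordinates.
  pair-^h : h ∙ h ≈ ε → ∀ p → proj₁ (pair p) ^^ h ≈ proj₁ (pair (proj₂ p , proj₁ p))
  pair-^h h² ((s , s∈) , (t , t∈)) = ≈-trans (^h-∙ s (t ^^ h)) (≈-trans (∙-congˡ twice) (≈-sym (factors-commute t∈ s∈)))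
    where
    twice : (t ^^ h) ^^ h ≈ t
    twice = ≈-trans (freely₂ h t (v₀ :⁻¹ :∙ (v₀ :⁻¹ :∙ v₁ :∙ v₀) :∙ v₀) ((v₀ :∙ v₀) :⁻¹ :∙ v₁ :∙ (v₀ :∙ v₀)) refl)
      (≈-trans (∙-cong (∙-congʳ (⁻¹-cong h²)) h²) (freely₂ t t (:ε :⁻¹ :∙ v₀ :∙ :ε) v₀ refl))

-- The socle of a quasiprimitive group and the three cases

module Classification {n : ℕ} (Γ : Graph n) (G : PermGroup n) (bq : BasicQuasiprimitive Γ G) where
  open Oriented4 Γ G (proj₁ bq)
  open OG4 (proj₁ bq) using (transitive)

  private
    y z : Fin n
    y = proj₁ (outneighbours u)
    z = proj₁ (proj₂ (outneighbours u))
    y≢z : y ≢ z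
    y≢z = proj₁ (proj₂ (proj₂ (outneighbours u)))
    uy : Δ u y
    uy = proj₁ (proj₂ (proj₂ (proj₂ (outneighbours u))))
    uz : Δ u z
    uz = proj₁ (proj₂ (proj₂ (proj₂ (proj₂ (outneighbours u)))))
    only-yz : ∀ {w} → Δ u w → w ≡ y ⊎ w ≡ z
    only-yz = proj₂ (proj₂ (proj₂ (proj₂ (proj₂ (outneighbours u)))))

    G-nontrivial : Nontrivial G
    G-nontrivial = let g , g∈G , eq = transitive y z in
      g , g∈G , λ g≈id → y≢z (trans (sym (g≈id y)) eq)

    abstract
      socle : ∃[ N ] MinimalNormal N G
      socle = minimalNormal (symFinite n) G G-nontrivial

    -- The arcs from `u` to `y` and to `z` lie in one orbit of `G`; this element takes the first to
    -- the second and so fixes `u`.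
    h : Permutation′ n
    h = proj₁ (orbital-transitive G uy uz)
    h∈G : Mem G h
    h∈G = proj₁ (proj₂ (orbital-transitive G uy uz))
    u·h : u · h ≡ u
    u·h = proj₁ (proj₂ (proj₂ (orbital-transitive G uy uz)))
    y·h : y · h ≡ z
    y·h = proj₂ (proj₂ (proj₂ (orbital-transitive G uy uz)))

  N : PermGroup n
  N = proj₁ socle

  N-min : MinimalNormal N G
  N-min = proj₂ socle

  private
    N⊴G : N ⊴ G
    N⊴G = proj₁ N-min

    N-transitive : Transitive N
    N-transitive = proj₂ bq N N⊴G (proj₁ (proj₂ N-min))

    N⊆G : ∀ {g} → Mem N g → Mem G g
    N⊆G {g} = proj₁ N⊴G {g}

  open TransitiveNormal N N⊴G N-transitive using (index≤2)

  -- If `M` met `N` trivially, the elements of the transitive group `M` taking `u` to `y` and to `z`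
  -- would lie outside `N`. By `index≤2` their quotient would lie in `N` as well as in `M`, so it
  -- would be trivial and `y` would equal `z`.
  minimalNormal-unique : ∀ M → MinimalNormal M G → Mem M ⊆ Mem N × Mem N ⊆ Mem M
  minimalNormal-unique M M-min with nontrivial-or-trivial (symFinite n) (M ⊓ N)
  ... | inj₁ nt = (λ {x} → proj₂ ∘ proj₂ (proj₂ M-min) (M ⊓ N) normal nt proj₁ {x})
                , (λ {x} → proj₁ ∘ proj₂ (proj₂ N-min) (M ⊓ N) normal nt proj₂ {x})
    where
    normal : M ⊓ N ⊴ G
    normal = ⊓-normal {H = M} {K = N} {L = G} (proj₁ M-min) N⊴G
  ... | inj₂ M⊓N-trivial = contradiction y≡z y≢z
    where
    M-transitive : Transitive M
    M-transitive = proj₂ bq M (proj₁ M-min) (proj₁ (proj₂ M-min))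
    outside : ∀ {w} → Δ u w → ∀ {g} → Mem M g → u · g ≡ w → ¬ Mem N g
    outside uw {g} g∈M eq g∈N = Δ-irrefl uw (trans (sym (M⊓N-trivial {g} (g∈M , g∈N) u)) eq)
    y≡z : y ≡ z
    y≡z with M-transitive u y | M-transitive u z
    ... | a , a∈M , ua | b , b∈M , ub = ·-injective (flip b) (trans
      (trans (cong (_· flip b) (sym ua)) (M⊓N-trivial {a ∘ₚ flip b}
        ( ∙∈ M {a} {flip b} a∈M (⁻¹∈ M {b} b∈M)
        , index≤2 a b (proj₁ (proj₁ M-min) {a} a∈M) (proj₁ (proj₁ M-min) {b} b∈M)
            (outside uy {a} a∈M ua) (outside uz {b} b∈M ub)) u))
      (sym (·-flip b ub)))

  uniqueMinimalNormal : UniqueMinimalNormal N G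
  uniqueMinimalNormal = N-min , minimalNormal-unique

  Semiregular : Set
  Semiregular = ∀ g → Mem N g → ∀ x → Fixes g x → ∀ w → Fixes g w

  private
    semiregular⇒h∉N : Semiregular → ¬ Mem N h
    semiregular⇒h∉N sr h∈N = y≢z (trans (sym (sr h h∈N u u·h y)) y·h)

    square∈N : ∀ {g} → Mem G g → ¬ Mem N g → Mem N (g ∘ₚ g)
    square∈N {g} g∈G g∉N = index≤2 g (flip g) g∈G (⁻¹∈ G {g} g∈G) g∉N λ p → g∉N (⁻¹∈ N {flip g} p)

    semiregular⇒h² : Semiregular → ∀ x → x · h · h ≡ x
    semiregular⇒h² sr = sr (h ∘ₚ h) (square∈N {h} h∈G (semiregular⇒h∉N sr)) u (trans (cong (_· h) u·h) u·h)

  -- If N is abelian then it is regular and h has order two.  An element g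
  -- of N from u to y commutes with gʰ, so that h centralizes g gʰ.  But the
  -- centralizer of h in N is normal in G and h fixes a point, so g gʰ = 1,
  -- and this reverses an arc.
  N-nonabelian : ¬ (∀ {a b} → Mem N a → Mem N b → ∀ x → x · a · b ≡ x · b · a)
  N-nonabelian comm = refute (nontrivial-or-trivial (symFinite n) C)
    where
    sr : Semiregular
    sr g g∈N x gx w with N-transitive x w
    ... | m , m∈N , refl = trans (comm {m} {g} m∈N g∈N x) (cong (_· m) gx)
    h∉N : ¬ Mem N h
    h∉N = semiregular⇒h∉N sr
    h² : ∀ x → x · h · h ≡ x
    h² = semiregular⇒h² sr
    flip-h : ∀ x → x · flip h ≡ x · h
    flip-h x = ·-flip h (h² x)

    C : PermGroup n
    C = record
      { Mem  = λ g → Mem N g × (∀ x → x · g · h ≡ x · h · g)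
      ; mem? = λ g → mem? N g ×-dec all? (λ x → x · g · h ≟ x · h · g)
      ; resp = λ {a} {b} a≈b (a∈N , ah) → resp N {a} {b} a≈b a∈N ,
          λ x → trans (cong (_· h) (sym (a≈b x))) (trans (ah x) (a≈b (x · h)))
      ; ε∈   = ε∈ N , λ _ → refl
      ; ∙∈   = λ {a} {b} (a∈N , ah) (b∈N , bh) → ∙∈ N {a} {b} a∈N b∈N ,
          λ x → trans (bh (x · a)) (cong (_· b) (ah x))
      ; ⁻¹∈  = λ {a} (a∈N , ah) → ⁻¹∈ N {a} a∈N ,
          λ x → sym (·-flip a (trans (sym (ah (x · flip a))) (cong (_· h) (Perm.inverseʳ a))))
      }

    C-central : ∀ {c k} → Mem C c → Mem G k → ∀ x → x · c · k ≡ x · k · c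
    C-central {c} {k} (c∈N , ch) k∈G x with mem? N k
    ... | yes k∈N = comm {c} {k} c∈N k∈N x
    ... | no k∉N  = trans (sym (split (x · c))) (trans
      (cong (_· h) (comm {c} {k ∘ₚ flip h} c∈N (index≤2 k h k∈G h∈G k∉N h∉N) x))
      (trans (ch (x · k · flip h)) (cong (_· c) (split x))))
      where
      split : ∀ x → x · k · flip h · h ≡ x · k
      split x = Perm.inverseʳ h

    C⊴G : C ⊴ G
    C⊴G = (λ {c} (c∈N , _) → N⊆G {c} c∈N) , λ {k} {c} k∈G c∈C →
      resp C {c} {(flip k ∘ₚ c) ∘ₚ k}
        (λ x → sym (trans (C-central {c} {k} c∈C k∈G (x · flip k)) (cong (_· c) (Perm.inverseʳ k)))) c∈C

    C-nontrivial : ¬ Nontrivial C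
    C-nontrivial nt with proj₂ bq C C⊴G nt u y
    -- `c` takes `u` to `y` and commutes with `h`, which fixes `u`. Then `h` fixes `y`, although it
    -- takes `y` to `z`.
    ... | c , (_ , ch) , uc = y≢z (trans (sym (trans (ch u) (trans (cong (_· c) u·h) uc))) (trans (cong (_· h) uc) y·h))

    g : Permutation′ n
    g = proj₁ (N-transitive u y)
    g∈N : Mem N g
    g∈N = proj₁ (proj₂ (N-transitive u y))
    u·g : u · g ≡ y
    u·g = proj₂ (proj₂ (N-transitive u y))
    gʰ : Permutation′ n
    gʰ = (flip h ∘ₚ g) ∘ₚ h
    gʰ∈N : Mem N gʰ
    gʰ∈N = proj₂ N⊴G {h} {g} h∈G g∈N

    refute : ¬ (Nontrivial C ⊎ Trivial C)
    C-trivial : ¬ Trivial C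
    refute (inj₁ nt) = C-nontrivial nt
    refute (inj₂ t)  = C-trivial t
    -- Since `g ∘ₚ gʰ` is trivial, `gʰ` takes `y` to `u`; it also takes `u` to `z`, so an arc goes
    -- to the reverse of an arc.
    C-trivial t = Δ-antisym uz (subst₂ Δ u·gʰ y·gʰ (Δ-invariant {gʰ} (N⊆G {gʰ} gʰ∈N) uy))
      where
      ggʰ∈C : Mem C (g ∘ₚ gʰ)
      ggʰ∈C = ∙∈ N {g} {gʰ} g∈N gʰ∈N , λ x → trans (h² (x · g · flip h · g)) (trans (cong (_· g) (flip-h (x · g)))
        (trans (cong (λ w → w · g · h · g) (sym (Perm.inverseˡ h))) (comm {gʰ} {g} gʰ∈N g∈N (x · h))))
      u·gʰ : u · gʰ ≡ z
      u·gʰ = trans (cong (λ w → w · g · h) (·-flip h u·h)) (trans (cong (_· h) u·g) y·h)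
      y·gʰ : y · gʰ ≡ u
      y·gʰ = trans (cong (_· gʰ) (sym u·g)) (t {g ∘ₚ gʰ} ggʰ∈C u)

  private
    abstract
      component : ∃[ T ] MinimalNormal T N
      component = minimalNormal (symFinite n) N (proj₁ (proj₂ N-min))

    T : PermGroup n
    T = proj₁ component
    T-min : MinimalNormal T N
    T-min = proj₂ component

  Conclusion : Set₁
  Conclusion = Σ[ N ∈ PermGroup n ] Σ[ T ∈ Group 0ℓ 0ℓ ] Σ[ k ∈ ℕ ]
    (SocleIsPower G N T k × k ≤ 2 ×
      (k ≡ 1 ⊎ (k ≡ 2 × N ⊴ G × IndexTwo N G × IsTwistedWreath T Γ G N) ⊎ (k ≡ 2 × ¬ Regular N)))

  -- Minimality of `T` in `N`, which now equals `T`, is simplicity of `N`.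
  simple-case : (∀ {x} → Mem N x → Mem T x) → Conclusion
  simple-case N⊆T = N , subgroup→group N , 1 , socleIsPower , s≤s z≤n , inj₁ refl
    where
    socleIsPower : SocleIsPower G N (subgroup→group N) 1
    socleIsPower = record
      { uniqueMinimalNormal = uniqueMinimalNormal
      ; nonabelianSimple    = subgroupFinite {Sym n} (symFinite n) N
                            , (λ comm → N-nonabelian λ {a} {b} a∈N b∈N → comm (a , a∈N) (b , b∈N))
                            , subgroup-simple (symFinite n) N (proj₁ (proj₂ N-min))
                                (λ M M⊴N nt {x} x∈N → proj₂ (proj₂ T-min) M M⊴N nt
                                  (λ {w} w∈M → N⊆T {w} (proj₁ M⊴N {w} w∈M)) {x} (N⊆T {x} x∈N))
      ; isPower             = (λ x _ → x) , isIsomorphism (subgroup→group N) (power (subgroup→group N) 1) (λ x _ → x)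
                                (λ x≈y _ → x≈y) (λ _ _ _ _ → refl) (λ eq → eq zero)
                                (λ f → f zero , λ { zero _ → refl })
      }

  -- `h` is an arbitrary element outside `N`; the regular case takes the one that fixes `u`.
  module Square (N⊈T : ¬ (∀ x → Mem N x → Mem T x)) (h : Permutation′ n) (h∈G : Mem G h) (h∉N : ¬ Mem N h) where
    open ConjugateFactors (symFinite n) {G} {N} {T} N-min T-min N⊈T index≤2 h h∈G h∉N public

    socleIsPower : SocleIsPower G N (subgroup→group T) 2
    socleIsPower = record
      { uniqueMinimalNormal = uniqueMinimalNormal
      ; nonabelianSimple    = subgroupFinite {Sym n} (symFinite n) T
                            , factor-nonabelian (λ comm → N-nonabelian (λ {a} {b} → comm {a} {b}))
                            , factor-simple
      ; isPower             = isPower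
      }

  -- Coordinates on the vertices in which N acts by right multiplication and h
  -- by swapping.
  module WreathCoordinates (T : Group 0ℓ 0ℓ)
    (T-nontrivial : ∃[ t ] ¬ Group._≈_ T t (Group.ε T)) (φ : Inverse (setoid (Fin n)) (Group.setoid (DirectProduct.group T T)))
    (h∉N : ¬ Mem N h) (h² : ∀ x → x · h · h ≡ x)
    (to-·N : ∀ {g} → Mem N g → ∃[ t ] (∀ x → Group._≈_ (DirectProduct.group T T) (Inverse.to φ (x · g))
                                        (Group._∙_ (DirectProduct.group T T) (Inverse.to φ x) t)))
    (translation : ∀ t → ∃[ g ] Mem N g × (∀ x → Group._≈_ (DirectProduct.group T T) (Inverse.to φ (x · g))
                                        (Group._∙_ (DirectProduct.group T T) (Inverse.to φ x) t)))
    (to-·h : ∀ x → Group._≈_ (DirectProduct.group T T) (Inverse.to φ (x · h)) (swap (Inverse.to φ x)))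
    (to-u : Group._≈_ (DirectProduct.group T T) (Inverse.to φ u) (Group.ε (DirectProduct.group T T))) where

    private
      module T = Group T
      T² : Group 0ℓ 0ℓ
      T² = DirectProduct.group T T
      module T² = Group T²
      open Inverse φ using (to; from; to-cong; from-cong; strictlyInverseˡ; strictlyInverseʳ)
      Pair : Set
      Pair = T².Carrier

      infix 4 _≈²_
      _≈²_ : Rel Pair 0ℓ
      _≈²_ = T²._≈_
      infixl 7 _·²_
      _·²_ : Pair → Pair → Pair
      _·²_ = T²._∙_

      from-to : ∀ x → from (to x) ≡ x
      from-to = strictlyInverseʳ

      to-from : ∀ p → to (from p) ≈² p
      to-from = strictlyInverseˡ

      to-injective : ∀ {x w} → to x ≈² to w → x ≡ w
      to-injective {x} {w} eq = trans (sym (from-to x)) (trans (from-cong {to x} {to w} eq) (from-to w))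

      -- The coordinates of the outneighbour `y` of `u`. The other outneighbour is the image of `y`
      -- under `h` and has the swapped coordinates.
      a b : T.Carrier
      a = proj₁ (to y)
      b = proj₂ (to y)

      IsStep : Pair → Set
      IsStep s = s ≈² (a , b) ⊎ s ≈² (b , a)

      isStep-resp : ∀ {s t} → s ≈² t → IsStep s → IsStep t
      isStep-resp eq (inj₁ p) = inj₁ (T².trans (T².sym eq) p)
      isStep-resp eq (inj₂ p) = inj₂ (T².trans (T².sym eq) p)

      to-z : to z ≈² (b , a)
      to-z = subst (λ w → to w ≈² (b , a)) y·h (to-·h y)

      arc⇒step₀ : ∀ {w} → Δ u w → IsStep (to w)
      arc⇒step₀ uw with only-yz uw
      ... | inj₁ refl = inj₁ (T².refl)
      ... | inj₂ refl = inj₂ to-z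

      step⇒arc₀ : ∀ {w} → IsStep (to w) → Δ u w
      step⇒arc₀ (inj₁ eq) = subst (Δ u) (sym (to-injective eq)) uy
      step⇒arc₀ {w} (inj₂ eq) = subst (Δ u) (sym (to-injective {w} {z}
        (T².trans eq (T².sym to-z)))) uz

      difference : Fin n → Fin n → Pair
      difference x w = to w ·² (to x T².⁻¹)

      mover : Fin n → Permutation′ n
      mover x = proj₁ (translation (to x))
      mover∈N : ∀ x → Mem N (mover x)
      mover∈N x = proj₁ (proj₂ (translation (to x)))
      to-mover : ∀ x w → to (w · mover x) ≈² to w ·² to x
      to-mover x = proj₂ (proj₂ (translation (to x)))

      u·mover : ∀ x → u · mover x ≡ x
      u·mover x = to-injective (T².trans (to-mover x u)
        (T².trans (T².∙-congʳ to-u) (T².identityˡ (to x))))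

      shifted : Fin n → Fin n → Fin n
      shifted x w = w · flip (mover x)

      to-shifted : ∀ x w → to (shifted x w) ≈² difference x w
      to-shifted x w = GroupProperties.x≈z//y T² (to (shifted x w)) (to x) (to w)
        (T².sym
          (subst (λ v → to v ≈² to (shifted x w) ·² to x) (Perm.inverseʳ (mover x)) (to-mover x (shifted x w))))

      -- Right multiplication does not change `difference`, so the arc may be translated by `N`
      -- until it starts at `u`.
      arc⇒step : ∀ {x w} → Δ x w → IsStep (difference x w)
      arc⇒step {x} {w} d = isStep-resp (to-shifted x w) (arc⇒step₀
        (subst (λ v → Δ v (shifted x w)) (·-flip (mover x) (u·mover x))
          (Δ-invariant {flip (mover x)} (⁻¹∈ G {mover x} (N⊆G {mover x} (mover∈N x))) d)))

      step⇒arc : ∀ {x w} → IsStep (difference x w) → Δ x w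
      step⇒arc {x} {w} s = subst₂ Δ (u·mover x) (Perm.inverseʳ (mover x))
        (Δ-invariant {mover x} (N⊆G {mover x} (mover∈N x))
          (step⇒arc₀ (isStep-resp
            (T².sym (to-shifted x w)) s)))

      difference-⁻¹ : ∀ x w → difference x w ≈² (to x ·² (to w T².⁻¹)) T².⁻¹
      difference-⁻¹ x w = T².sym
        (GroupProperties.⁻¹-anti-homo-// T² (to x) (to w))

      -- Induction along directed paths from `u`. Strong connectivity is what makes closure under
      -- steps sufficient, without their inverses.
      invariant-everywhere : {Q : Pair → Set} → (∀ p q → p ≈² q → Q p → Q q) → Q T².ε →
                             (∀ s p → IsStep s → Q p → Q (s ·² p)) → ∀ p → Q p
      invariant-everywhere {Q} Q-resp Q-ε Q-step p = Q-resp (to (from p)) p (to-from p)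
        (follow (strongly-connected u (from p)) (Q-resp T².ε (to u) (T².sym to-u) Q-ε))
        where
        follow : ∀ {x w} → Star Δ x w → Q (to x) → Q (to w)
        follow []* q = q
        follow {x} (_◅_ {j = w} d ds) q = follow ds
          (Q-resp (difference x w ·² to x) (to w) (GroupProperties.//-rightDividesˡ T² (to x) (to w))
            (Q-step (difference x w) (to x) (arc⇒step d) q))

      generates : Generates T a b
      generates H a∈ b∈ t = proj₁ (invariant-everywhere {λ p → Mem H (proj₁ p) × Mem H (proj₂ p)}
        (λ p q (eq , eq′) (m , m′) → resp H eq m , resp H eq′ m′) (ε∈ H , ε∈ H)
        (λ { s p (inj₁ (eq , eq′)) (m , m′) → ∙∈ H (resp H (T.sym eq) a∈) m , ∙∈ H (resp H (T.sym eq′) b∈) m′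
           ; s p (inj₂ (eq , eq′)) (m , m′) → ∙∈ H (resp H (T.sym eq) b∈) m , ∙∈ H (resp H (T.sym eq′) a∈) m′ })
        (t , t))

      -- The graph of an automorphism interchanging a and b would be a proper
      -- subgroup of T² that contains S₀.
      noAut : ¬ Interchangeable T a b
      noAut (α , iso , αa , αb) = proj₂ T-nontrivial (T.trans (graph-of-α (T.ε , proj₁ T-nontrivial)) ε-homo)
        where
        open GroupMorphisms.IsGroupIsomorphism iso using (ε-homo; ∙-homo; ⟦⟧-cong)
        graph-of-α : ∀ p → proj₂ p T.≈ α (proj₁ p)
        graph-of-α = invariant-everywhere {λ p → proj₂ p T.≈ α (proj₁ p)}
          (λ p q (eq , eq′) r → T.trans (T.sym eq′) (T.trans r (⟦⟧-cong eq)))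
          (T.sym ε-homo)
          (λ { s p (inj₁ (eq , eq′)) r → step s p (T.trans eq′ (T.sym αa)) eq r
             ; s p (inj₂ (eq , eq′)) r → step s p (T.trans eq′ (T.sym αb)) eq r })
          where
          step : ∀ s p {c} → proj₂ s T.≈ α c → proj₁ s T.≈ c → proj₂ p T.≈ α (proj₁ p) →
                 (proj₂ s T.∙ proj₂ p) T.≈ α (proj₁ s T.∙ proj₁ p)
          step s p eq eq′ r = T.trans (T.∙-cong (T.trans eq (⟦⟧-cong (T.sym eq′))) r) (T.sym (∙-homo _ _))

      same-action : ∀ σ τ → (∀ p → to (from p · σ) ≈² to (from p · τ)) → ∀ x → x · σ ≡ x · τ
      same-action σ τ eq x = subst (λ w → w · σ ≡ w · τ) (from-to x) (to-injective (eq (to x)))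

      right-mult : ∀ {g} → Mem N g → ∃[ t ] (∀ p → to (from p · g) ≈² p ·² t)
      right-mult {g} g∈N = let t , eq = to-·N {g} g∈N in t , λ p →
        T².trans (eq (from p)) (T².∙-congʳ (to-from p))

      from-right-mult : ∀ σ t → (∀ p → to (from p · σ) ≈² p ·² t) → Mem N σ
      from-right-mult σ t eq = let g , g∈N , to-g = translation t in
        resp N {g} {σ} (same-action g σ λ p →
          T².trans
            (T².trans (to-g (from p)) (T².∙-congʳ (to-from p)))
            (T².sym (eq p)))
          g∈N

      h⁻¹-swaps : ∀ x → to (x · flip h) ≈² swap (to x)
      h⁻¹-swaps x = subst (λ w → to w ≈² swap (to x)) (sym (·-flip h (h² x))) (to-·h x)

    isTwistedWreath : IsTwistedWreath T Γ G N
    isTwistedWreath = record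
      { a = a ; b = b ; generates = generates ; noAut = noAut ; φ = φ
      ; graph = λ x w → mk⇔
          -- `CayleyAdj` looks at the inverse of `difference x w`, so an arc leaving `x` falls into
          -- the inverted half of the connection set.
          (λ adj → [ (λ d → inj₂ (isStep-resp (difference-⁻¹ x w) (arc⇒step d)))
                   , (λ d → inj₁ (arc⇒step d)) ]′ (Equivalence.to (adj⇔Δ x w) adj))
          (λ s → Equivalence.from (adj⇔Δ x w)
            ([ (λ p → inj₂ (step⇒arc p))
             , (λ p → inj₁ (step⇒arc (isStep-resp
                 (T².sym (difference-⁻¹ x w)) p))) ]′ s))
      ; group = λ σ → mk⇔
          (λ σ∈G → [ (λ σ∈N → let t , eq = right-mult {σ} σ∈N in t , inj₁ eq)
                   , (λ hσ∈N → let t , eq = to-·N {flip h ∘ₚ σ} hσ∈N in t , inj₂ (λ p →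
                       T².trans
                         (subst (λ w → to (w · σ) ≈² to (from p · h) ·² t) (Perm.inverseˡ h) (eq (from p · h)))
                         (T².∙-congʳ
                           (T².trans (to-·h (from p)) (swap-cong (to (from p)) p (to-from p)))))) ]′
                   (coset-left σ σ∈G))
          (λ { (t , inj₁ eq) → N⊆G {σ} (from-right-mult σ t eq)
             ; (t , inj₂ eq) → resp G {h ∘ₚ flip h ∘ₚ σ} {σ} (λ x → cong (_· σ) (Perm.inverseˡ h))
                 (∙∈ G {h} {flip h ∘ₚ σ} h∈G (N⊆G {flip h ∘ₚ σ} (from-right-mult (flip h ∘ₚ σ) t λ p →
                   subst (λ w → to (w · σ) ≈² p ·² t) (from-swap p) (eq (swap p))))) })
      ; normal = λ σ → mk⇔ (right-mult {σ})
                           (λ (t , eq) → from-right-mult σ t eq)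
      }
      where
      swap-cong : ∀ p q → p ≈² q → swap p ≈² swap q
      swap-cong _ _ (eq , eq′) = eq′ , eq
      from-swap : ∀ p → from (swap p) ≡ from p · flip h
      from-swap p = to-injective {from (swap p)} {from p · flip h} (T².trans (to-from (swap p))
        (T².sym (T².trans
          (h⁻¹-swaps (from p)) (swap-cong (to (from p)) p (to-from p)))))
      coset-left : ∀ σ → Mem G σ → Mem N σ ⊎ Mem N (flip h ∘ₚ σ)
      coset-left σ σ∈G with mem? N σ
      ... | yes σ∈N = inj₁ σ∈N
      ... | no  σ∉N = inj₂ (resp N {flip h ∘ₚ flip (flip σ)} {flip h ∘ₚ σ} (λ _ → refl)
        (index≤2 (flip h) (flip σ) (⁻¹∈ G {h} h∈G) (⁻¹∈ G {σ} σ∈G)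
          (λ p → h∉N (⁻¹∈ N {flip h} p)) (λ p → σ∉N (⁻¹∈ N {flip σ} p))))

  module RegularSquare (N⊈T : ¬ (∀ x → Mem N x → Mem T x)) (sr : Semiregular) where
    open Square N⊈T h h∈G (semiregular⇒h∉N sr)

    private
      T² : Group 0ℓ 0ℓ
      T² = DirectProduct.group (subgroup→group T) (subgroup→group T)
      module T² = Group T²
      Pair : Set
      Pair = T².Carrier

      -- Regularity identifies a vertex with the element of `N` that takes `u` to it; the
      -- coordinates of that element become those of the vertex.
      elt : Fin n → ∃ (Mem N)
      elt x = let g , g∈N , _ = N-transitive u x in g , g∈N

      u·elt : ∀ x → u · proj₁ (elt x) ≡ x
      u·elt x = proj₂ (proj₂ (N-transitive u x))

      semiregular-unique : ∀ a b → Mem N a → Mem N b → u · a ≡ u · b → ∀ x → x · a ≡ x · b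
      semiregular-unique a b a∈N b∈N eq x = ·-injective (flip b) (trans
        (sr (a ∘ₚ flip b) (∙∈ N {a} {flip b} a∈N (⁻¹∈ N {b} b∈N)) u (·-flip b (sym eq)) x) (sym (·-flip b refl)))

      to : Fin n → Pair
      to x = coordinates (elt x)

      from : Pair → Fin n
      from p = u · proj₁ (pair p)

      from-to : ∀ x → from (to x) ≡ x
      from-to x = trans (pair-coordinates (elt x) u) (u·elt x)

      to-unique : ∀ x (g : ∃ (Mem N)) → u · proj₁ g ≡ x → to x ≈² coordinates g
      to-unique x g eq = coordinates-cong (elt x) g
        (semiregular-unique (proj₁ (elt x)) (proj₁ g) (proj₂ (elt x)) (proj₂ g) (trans (u·elt x) (sym eq)))

      to-from : ∀ p → to (from p) ≈² p
      to-from p = T².trans {to (from p)} {coordinates (pair p)} {p} (to-unique (from p) (pair p) refl) (coordinates-pair p)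

      from-cong : ∀ p q → p ≈² q → from p ≡ from q
      from-cong p q eq = pair-cong p q eq u

      to-·N : ∀ x (g : ∃ (Mem N)) → to (x · proj₁ g) ≈² to x ·² coordinates g
      to-·N x g = T².trans {to (x · proj₁ g)} {coordinates (elt x ·N g)} {to x ·² coordinates g}
        (to-unique (x · proj₁ g) (elt x ·N g) (cong (_· proj₁ g) (u·elt x))) (coordinates-homo (elt x) g)

      -- As `h` fixes `u`, applying `h` to a vertex conjugates the corresponding element of `N`, and
      -- this conjugation swaps coordinates.
      to-·h : ∀ x → to (x · h) ≈² swap (to x)
      to-·h x = T².trans {to (x · h)} {coordinates eʰ} {swap (to x)}
        (to-unique (x · h) eʰ (trans (cong (λ w → w · proj₁ e · h) (·-flip h u·h)) (cong (_· h) (u·elt x))))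
        (pair-injective (coordinates eʰ) (swap (to x)) λ w → trans (pair-coordinates eʰ w)
          (trans (cong (_· h) (sym (pair-coordinates e (w · flip h)))) (pair-^h (semiregular⇒h² sr) (to x) w)))
        where
        e eʰ : ∃ (Mem N)
        e  = elt x
        eʰ = (flip h ∘ₚ proj₁ e) ∘ₚ h , proj₂ N⊴G {h} {proj₁ e} h∈G (proj₂ e)

      to-u : to u ≈² T².ε
      to-u = T².trans {to u} {coordinates (Perm.id , ε∈ N)} {T².ε} (to-unique u (Perm.id , ε∈ N) refl)
        (pair-injective (coordinates (Perm.id , ε∈ N)) T².ε λ w → trans (pair-coordinates (Perm.id , ε∈ N) w) (sym (Perm.inverseʳ h)))

      φ : Inverse (setoid (Fin n)) T².setoid
      φ = record
        { to        = to
        ; from      = from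
        ; to-cong   = λ { {x} refl → T².refl {to x} }
        ; from-cong = λ {p} {q} → from-cong p q
        ; inverse   = (λ { {p} refl → to-from p }) , (λ {x} {p} eq → trans (from-cong p (to x) eq) (from-to x))
        }

      translation : ∀ t → ∃[ g ] Mem N g × (∀ x → to (x · g) ≈² to x ·² t)
      translation t = proj₁ (pair t) , proj₂ (pair t) , λ x →
        T².trans {to (x · proj₁ (pair t))} {to x ·² coordinates (pair t)} {to x ·² t} (to-·N x (pair t))
          (T².∙-congˡ {to x} {coordinates (pair t)} {t} (coordinates-pair t))

      T-nontrivial : ∃[ t ] ¬ Group._≈_ (subgroup→group T) t (Group.ε (subgroup→group T))
      T-nontrivial = let t , t∈T , t≉ = proj₁ (proj₂ T-min) in (t , t∈T) , t≉

      N-translates : ∀ {g} → Mem N g → ∃[ t ] (∀ x → to (x · g) ≈² to x ·² t)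
      N-translates {g} g∈N = coordinates (g , g∈N) , λ x → to-·N x (g , g∈N)

      module Wreath = WreathCoordinates (subgroup→group T) T-nontrivial φ (semiregular⇒h∉N sr) (semiregular⇒h² sr)
        N-translates translation to-·h to-u

    conclusion : Conclusion
    conclusion = N , subgroup→group T , 2 , socleIsPower , ℕₚ.≤-refl ,
      inj₂ (inj₁ (refl , N⊴G , (h , h∈G , semiregular⇒h∉N sr , λ {g} → coset {g}) , Wreath.isTwistedWreath))

  semiregular? : Semiregular ⊎ ¬ Semiregular
  semiregular? with ∃ₚ? {P = λ g → Mem N g × (∃[ x ] Fixes g x) × ¬ (∀ x → Fixes g x)}
    (λ {g} {k} g≈k (g∈N , (x , gx) , nt) → resp N {g} {k} g≈k g∈N , (x , trans (sym (g≈k x)) gx) , λ f → nt (λ w → trans (g≈k w) (f w)))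
    (λ g → mem? N g ×-dec (any? (λ x → x · g ≟ x) ×-dec ¬? (all? (λ x → x · g ≟ x))))
  ... | yes (g , g∈N , (x , gx) , nt) = inj₂ λ sr → nt (sr g g∈N x gx)
  ... | no none = inj₁ λ g g∈N x gx w → decidable-stable (w · g ≟ w) λ ≢ → none (g , g∈N , (x , gx) , λ f → ≢ (f w))

  outside? : (H K : PermGroup n) → (∃[ x ] Mem H x × ¬ Mem K x) ⊎ (∀ x → Mem H x → Mem K x)
  outside? H K with ∃ₚ? {P = λ x → Mem H x × ¬ Mem K x}
    (λ {a} {b} a≈b (p , q) → resp H {a} {b} a≈b p , λ r → q (resp K {b} {a} (λ i → sym (a≈b i)) r))
    (λ g → mem? H g ×-dec ¬? (mem? K g))
  ... | yes found = inj₁ found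
  ... | no none   = inj₂ λ x x∈H → decidable-stable (mem? K x) λ x∉K → none (x , x∈H , x∉K)

  classification : Conclusion
  classification = by-component (outside? N T)
    where
    by-regularity : ¬ (∀ x → Mem N x → Mem T x) → (∃[ g ] Mem G g × ¬ Mem N g) → Semiregular ⊎ ¬ Semiregular → Conclusion
    by-regularity N⊈T _ (inj₁ sr) = RegularSquare.conclusion N⊈T sr
    by-regularity N⊈T (g , g∈G , g∉N) (inj₂ ¬sr) = N , subgroup→group T , 2 , Square.socleIsPower N⊈T g g∈G g∉N ,
      ℕₚ.≤-refl , inj₂ (inj₂ (refl , λ regular → ¬sr λ g g∈N x gx → proj₂ regular {g} g∈N x gx))

    by-index : ¬ (∀ x → Mem N x → Mem T x) → (∃[ g ] Mem G g × ¬ Mem N g) ⊎ (∀ g → Mem G g → Mem N g) → Conclusion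
    by-index N⊈T (inj₁ g) = by-regularity N⊈T g semiregular?
    -- If `G` equals `N`, then `T` is normal in `G`, and minimality of `N` gives `N` inside `T`.
    by-index N⊈T (inj₂ G⊆N) = contradiction
      (λ x x∈N → proj₂ (proj₂ N-min) T
        ( (λ {t} t∈T → N⊆G {t} (proj₁ (proj₁ T-min) {t} t∈T)) , λ {g} {t} g∈G t∈T → proj₂ (proj₁ T-min) {g} {t} (G⊆N g g∈G) t∈T)
        (proj₁ (proj₂ T-min)) (λ {t} → proj₁ (proj₁ T-min) {t}) {x} x∈N)
      N⊈T

    by-component : (∃[ x ] Mem N x × ¬ Mem T x) ⊎ (∀ x → Mem N x → Mem T x) → Conclusion
    by-component (inj₁ (x , x∈N , x∉T)) = by-index (λ N⊆T → x∉T (N⊆T x x∈N)) (outside? G N)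
    by-component (inj₂ N⊆T)             = simple-case (λ {x} → N⊆T x)

-- Counting disjoint unions and two-element sets

count-⊎ : ∀ {n} {P Q R : Pred (Fin n) 0ℓ} (P? : Decidable P) (Q? : Decidable Q) (R? : Decidable R) →
          (∀ i → R i → P i ⊎ Q i) → (∀ i → P i → R i) → (∀ i → Q i → R i) → (∀ i → P i → ¬ Q i) →
          count R? ≡ count P? + count Q?
count-⊎ P? Q? R? R⇒ P⇒ Q⇒ disjoint =
  trans (sum-cong-≗ (λ i → split i (P? i) (Q? i) (R? i))) (∑-distrib-+ (indicator ∘ P?) (indicator ∘ Q?))
  where
  split : ∀ i → (p : Dec _) (q : Dec _) (r : Dec _) → indicator r ≡ indicator p + indicator q
  split i (yes p) (yes q) _       = contradiction q (disjoint i p)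
  split i (yes p) (no _)  (yes _) = refl
  split i (no _)  (yes q) (yes _) = refl
  split i (no _)  (no _)  (no _)  = refl
  split i (yes p) _       (no ¬r) = contradiction (P⇒ i p) ¬r
  split i (no _)  (yes q) (no ¬r) = contradiction (Q⇒ i q) ¬r
  split i (no ¬p) (no ¬q) (yes r) = contradiction (R⇒ i r) [ ¬p , ¬q ]′

count-none : ∀ {n} {P : Pred (Fin n) 0ℓ} (P? : Decidable P) → (∀ i → ¬ P i) → count P? ≡ 0
count-none {zero}  P? none = refl
count-none {suc n} P? none with P? zero
... | yes p = contradiction p (none zero)
... | no _  = count-none (P? ∘ suc) (none ∘ suc)

count-one : ∀ {n} {P : Pred (Fin n) 0ℓ} (P? : Decidable P) i → P i → (∀ j → P j → j ≡ i) → count P? ≡ 1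
count-one P? zero p only with P? zero
... | yes _ = cong suc (count-none (P? ∘ suc) (λ j q → case only (suc j) q of λ ()))
... | no ¬p = contradiction p ¬p
count-one P? (suc i) p only with P? zero
... | yes q = case only zero q of λ ()
... | no _  = count-one (P? ∘ suc) i p (λ j q → suc-injective (only (suc j) q))

count-two : ∀ {n} {P : Pred (Fin n) 0ℓ} (P? : Decidable P) i j → i ≢ j → P i → P j →
            (∀ k → P k → k ≡ i ⊎ k ≡ j) → count P? ≡ 2
count-two P? i j i≢j p q only = trans
  (count-⊎ (_≟ i) (_≟ j) P? only (λ { _ refl → p }) (λ { _ refl → q }) (λ { _ refl i≡j → i≢j i≡j }))
  (cong₂ _+_ (count-one (_≟ i) i refl (λ _ eq → eq)) (count-one (_≟ j) j refl (λ _ eq → eq)))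

-- Orbital graphs

module OrbitalGraph {n : ℕ} (G : PermGroup n) (G-transitive : Transitive G) (v w : Fin n)
  (not-reversed : ∀ g → Mem G g → v · g ≡ w → w · g ≢ v) where

  private
    Δ : Rel (Fin n) 0ℓ
    Δ = Orbital G v w

    Δ? : Decidable₂ Δ
    Δ? = orbital? G v w

    Δ-invariant : ∀ {g x y} → Mem G g → Δ x y → Δ (x · g) (y · g)
    Δ-invariant = orbital-invariant G

    Δ-antisym : ∀ {x y} → Δ x y → ¬ Δ y x
    Δ-antisym xy yx with orbital-transitive G xy yx | xy
    ... | g , g∈G , xg , yg | (k , k∈G , vk , wk) = not-reversed ((k ∘ₚ g) ∘ₚ flip k)
      (∙∈ G {k ∘ₚ g} {flip k} (∙∈ G {k} {g} k∈G g∈G) (⁻¹∈ G {k} k∈G))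
      (·-flip k (trans wk (sym (trans (cong (_· g) vk) xg))))
      (·-flip k (trans vk (sym (trans (cong (_· g) wk) yg))))

  graph : Graph n
  graph = record
    { Adj    = λ x y → Δ x y ⊎ Δ y x
    ; adj?   = λ x y → Δ? x y ⊎-dec Δ? y x
    ; symm   = [ inj₂ , inj₁ ]′
    ; irrefl = λ { refl → [ (λ d → Δ-antisym d d) , (λ d → Δ-antisym d d) ]′ }
    }

  adj-invariant : ∀ {g x y} → Mem G g → Adj graph x y → Adj graph (x · g) (y · g)
  adj-invariant {g} g∈G (inj₁ d) = inj₁ (Δ-invariant {g} g∈G d)
  adj-invariant {g} g∈G (inj₂ d) = inj₂ (Δ-invariant {g} g∈G d)

  private
    adj-invariant⁻ : ∀ {g x y} → Mem G g → Adj graph (x · g) (y · g) → Adj graph x y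
    adj-invariant⁻ {g} g∈G a =
      subst₂ (Adj graph) (Perm.inverseˡ g) (Perm.inverseˡ g) (adj-invariant {flip g} (⁻¹∈ G {g} g∈G) a)

    edgeTransitive : EdgeTransitive graph G
    edgeTransitive (inj₁ d) (inj₁ e) = let g , g∈G , p , q = orbital-transitive G d e in g , g∈G , inj₁ (p , q)
    edgeTransitive (inj₁ d) (inj₂ e) = let g , g∈G , p , q = orbital-transitive G d e in g , g∈G , inj₂ (p , q)
    edgeTransitive (inj₂ d) (inj₁ e) = let g , g∈G , p , q = orbital-transitive G d e in g , g∈G , inj₂ (q , p)
    edgeTransitive (inj₂ d) (inj₂ e) = let g , g∈G , p , q = orbital-transitive G d e in g , g∈G , inj₁ (q , p)

  og4 : Connected graph →
        ∀ y₁ y₂ → y₁ ≢ y₂ → Δ v y₁ → Δ v y₂ → (∀ y → Δ v y → y ≡ y₁ ⊎ y ≡ y₂) →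
        ∀ z₁ z₂ → z₁ ≢ z₂ → Δ z₁ v → Δ z₂ v → (∀ z → Δ z v → z ≡ z₁ ⊎ z ≡ z₂) → OG4 graph G
  og4 connected y₁ y₂ y₁≢y₂ vy₁ vy₂ only-y z₁ z₂ z₁≢z₂ z₁v z₂v only-z = record
    { connected      = connected
    ; valency4       = λ x → let g , g∈G , vg = G-transitive v x in
        trans (length-filter (adj? graph x) (λ y → y))
          (trans (sym (count-permute (adj? graph v) (adj? graph x) g
              (λ y a → subst (λ x → Adj graph x (y · g)) vg (adj-invariant {g} g∈G a))
              (λ y a → adj-invariant⁻ {g} g∈G (subst (λ x → Adj graph x (y · g)) (sym vg) a))))
            valency-v)
    ; automorphisms  = λ {g} g∈G x y → mk⇔ (adj-invariant {g} g∈G) (adj-invariant⁻ {g} g∈G)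
    ; transitive     = G-transitive
    ; edgeTransitive = edgeTransitive
    ; oriented       = v , w , Δ-antisym , λ x y → mk⇔ (λ a → a) (λ a → a)
    }
    where
    valency-v : count (adj? graph v) ≡ 4
    valency-v = trans (count-⊎ (Δ? v) (λ y → Δ? y v) (adj? graph v) (λ _ a → a) (λ _ → inj₁) (λ _ → inj₂) (λ _ → Δ-antisym))
      (cong₂ _+_ (count-two (Δ? v) y₁ y₂ y₁≢y₂ vy₁ vy₂ only-y) (count-two (λ z → Δ? z v) z₁ z₂ z₁≢z₂ z₁v z₂v only-z))

-- Coset graphs

module Cosets {A : Group 0ℓ 0ℓ} (finite : FiniteGroup A) (H : Subgroup A) where
  open Group A hiding (setoid) renaming (refl to ≈-refl; sym to ≈-sym; trans to ≈-trans)
  open FreeGroup A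

  infix 4 _~_
  _~_ : Rel Carrier 0ℓ
  x ~ y = Mem H (x ∙ y ⁻¹)

  ≈⇒~ : ∀ {x y} → x ≈ y → x ~ y
  ≈⇒~ {x} {y} eq = resp H (≈-sym (≈-trans (∙-congʳ eq) (inverseʳ y))) (ε∈ H)

  ~-isEquivalence : IsEquivalence _~_
  ~-isEquivalence = record
    { refl  = ≈⇒~ ≈-refl
    ; sym   = λ {x} {y} p → resp H (freely₂ x y ((v₀ :∙ v₁ :⁻¹) :⁻¹) (v₁ :∙ v₀ :⁻¹) refl) (⁻¹∈ H p)
    ; trans = λ {x} {y} {z} p q → resp H (freely₃ x y z ((v₀ :∙ v₁ :⁻¹) :∙ (v₁ :∙ v₂ :⁻¹)) (v₀ :∙ v₂ :⁻¹) refl) (∙∈ H p q)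
    }

  cosets : Setoid 0ℓ 0ℓ
  cosets = record { isEquivalence = ~-isEquivalence }

  abstract
    cosetsFinite : ∃[ k ] Inverse cosets (setoid (Fin k))
    cosetsFinite = finiteQuotient ~-isEquivalence (λ x y → mem? H (x ∙ y ⁻¹)) (Inverse.from (proj₂ finite))
      (λ x → Inverse.to (proj₂ finite) x , ≈⇒~ (FiniteSearch.from∘to (proj₂ finite) x))

  ~-right : ∀ {x y} a → x ~ y → x ∙ a ~ y ∙ a
  ~-right {x} {y} a = resp H (freely₃ x y a (v₀ :∙ v₁ :⁻¹) ((v₀ :∙ v₂) :∙ (v₁ :∙ v₂) :⁻¹) refl)

-- Conditions on a vertex stabilizer `H` and an element `g` under which the orbital of the cosets
-- `H` and `Hg` gives a basic pair. `out` and `into`, with their companions, say that `HgH` and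
-- `Hg⁻¹H` consist of two right cosets each, and `not-reversed` keeps these apart. `B` becomes the
-- socle: it lies in every nontrivial normal subgroup and is transitive by `B-complement`. The
-- element `b₀` makes the action faithful.
record CosetGraphData (A : Group 0ℓ 0ℓ) : Set₁ where
  open Group A
  field
    finite         : FiniteGroup A
    H B            : Subgroup A
    g h₀           : Carrier
    h₀∈H           : Mem H h₀
    generate       : ∀ (K : Subgroup A) → (∀ {h} → Mem H h → Mem K h) → Mem K g → ∀ a → Mem K a
    out            : ∀ {h} → Mem H h → ∃[ k ] Mem H ((g ∙ k) ∙ g ⁻¹) × (h ≈ k ⊎ h ≈ k ∙ h₀)
    out-distinct   : ¬ Mem H (g ∙ (g ∙ h₀) ⁻¹)
    into           : ∀ {h} → Mem H h → ∃[ k ] Mem H ((g ⁻¹ ∙ k) ∙ g ⁻¹ ⁻¹) × (h ≈ k ⊎ h ≈ k ∙ h₀)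
    into-distinct  : ¬ Mem H (g ⁻¹ ∙ (g ⁻¹ ∙ h₀) ⁻¹)
    not-reversed   : ∀ {h} → Mem H h → ¬ Mem H ((g ∙ h) ∙ g)
    B-normal       : B ⊴ whole A
    B-least        : ∀ (M : Subgroup A) → M ⊴ whole A → Nontrivial M → ∀ {x} → Mem B x → Mem M x
    B-complement   : ∀ a → ∃[ h ] Mem H h × Mem B (h ∙ a)
    b₀             : Carrier
    b₀∈B           : Mem B b₀
    b₀∉H           : ¬ Mem H b₀

module CosetGraph {A : Group 0ℓ 0ℓ} (D : CosetGraphData A) {n : ℕ}
  (X : Inverse (Cosets.cosets (CosetGraphData.finite D) (CosetGraphData.H D)) (setoid (Fin n))) where
  open CosetGraphData D
  open Group A hiding (setoid) renaming (refl to ≈-refl; sym to ≈-sym; trans to ≈-trans)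
  open GroupProperties A
  open FreeGroup A
  open Cosets finite H
  open FiniteSearch (proj₂ finite) using (∃?)
  open Inverse X using (to; from; to-cong; strictlyInverseˡ; strictlyInverseʳ)

  from∘to : ∀ x → from (to x) ~ x
  from∘to = strictlyInverseʳ

  to-injective : ∀ {x y} → to x ≡ to y → x ~ y
  to-injective {x} {y} eq = IsEquivalence.trans ~-isEquivalence {x} {from (to x)} {y}
    (IsEquivalence.sym ~-isEquivalence {from (to x)} {x} (from∘to x)) (subst (λ i → from i ~ y) (sym eq) (from∘to y))

  act : Carrier → Fin n → Fin n
  act a i = to (from i ∙ a)

  act-to : ∀ a x → act a (to x) ≡ to (x ∙ a)
  act-to a x = to-cong {from (to x) ∙ a} {x ∙ a} (~-right a (from∘to x))

  private
    act-inverse : ∀ a b → a ∙ b ≈ ε → ∀ i → act b (act a i) ≡ i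
    act-inverse a b ab i = trans (act-to b (from i ∙ a)) (trans
      (to-cong (≈⇒~ (≈-trans (assoc _ _ _) (≈-trans (∙-congˡ ab) (identityʳ _))))) (strictlyInverseˡ i))

  abstract
    ρ : Carrier → Permutation′ n
    ρ a = permutation (act a) (act (a ⁻¹)) (act-inverse (a ⁻¹) a (inverseˡ a)) (act-inverse a (a ⁻¹) (inverseʳ a))

    ρ-to : ∀ x a → to x · ρ a ≡ to (x ∙ a)
    ρ-to x a = act-to a x

  at : ∀ {σ τ : Permutation′ n} → (∀ x → to x · σ ≡ to x · τ) → ∀ i → i · σ ≡ i · τ
  at {σ} {τ} eq i = subst (λ j → j · σ ≡ j · τ) (strictlyInverseˡ i) (eq (from i))

  ρ-cong : ∀ {a b} → a ≈ b → ∀ i → i · ρ a ≡ i · ρ b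
  ρ-cong {a} {b} eq = at {ρ a} {ρ b} λ x → trans (ρ-to x a) (trans (to-cong (≈⇒~ (∙-congˡ eq))) (sym (ρ-to x b)))

  ρ-∙ : ∀ a b i → i · ρ (a ∙ b) ≡ i · ρ a · ρ b
  ρ-∙ a b = at {ρ (a ∙ b)} {ρ a ∘ₚ ρ b} λ x → trans (ρ-to x (a ∙ b)) (trans (to-cong (≈⇒~ (≈-sym (assoc x a b))))
    (sym (trans (cong (_· ρ b) (ρ-to x a)) (ρ-to (x ∙ a) b))))

  ρ-ε : ∀ i → i · ρ ε ≡ i
  ρ-ε = at {ρ ε} {Perm.id} λ x → trans (ρ-to x ε) (to-cong (≈⇒~ (identityʳ x)))

  ρ-⁻¹ : ∀ a i → i · ρ (a ⁻¹) ≡ i · flip (ρ a)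
  ρ-⁻¹ a i = sym (·-flip (ρ a) (trans (sym (ρ-∙ (a ⁻¹) a i)) (trans (ρ-cong (inverseˡ a) i) (ρ-ε i))))

  image : Subgroup A → PermGroup n
  image K = record
    { Mem  = λ σ → ∃[ a ] Mem K a × (∀ i → i · ρ a ≡ i · σ)
    ; mem? = λ σ → ∃? (λ eq (p , q) → resp K eq p , λ i → trans (ρ-cong (≈-sym eq) i) (q i))
                      (λ a → mem? K a ×-dec (ρ a ≈ₚ? σ))
    ; resp = λ σ≈τ (a , p , q) → a , p , λ i → trans (q i) (σ≈τ i)
    ; ε∈   = ε , ε∈ K , ρ-ε
    ; ∙∈   = λ {σ} {τ} (a , p , q) (b , r , s) → a ∙ b , ∙∈ K p r ,
        λ i → trans (ρ-∙ a b i) (trans (cong (_· ρ b) (q i)) (s (i · σ)))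
    ; ⁻¹∈  = λ {σ} (a , p , q) → a ⁻¹ , ⁻¹∈ K p ,
        λ i → trans (ρ-⁻¹ a i) (·-flip (ρ a) (trans (q (i · flip σ)) (Perm.inverseʳ σ)))
    }

  G N : PermGroup n
  G = image (whole A)
  N = image B

  preimage : PermGroup n → Subgroup A
  preimage M = record
    { Mem  = λ a → Mem M (ρ a)
    ; mem? = λ a → mem? M (ρ a)
    ; resp = λ {a} {b} eq → resp M {ρ a} {ρ b} (ρ-cong eq)
    ; ε∈   = resp M {Perm.id} {ρ ε} (λ i → sym (ρ-ε i)) (ε∈ M)
    ; ∙∈   = λ {a} {b} p q → resp M {ρ a ∘ₚ ρ b} {ρ (a ∙ b)} (λ i → sym (ρ-∙ a b i)) (∙∈ M {ρ a} {ρ b} p q)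
    ; ⁻¹∈  = λ {a} p → resp M {flip (ρ a)} {ρ (a ⁻¹)} (λ i → sym (ρ-⁻¹ a i)) (⁻¹∈ M {ρ a} p)
    }

  private
    ρ-conj : ∀ k a i → i · ρ ((k ⁻¹ ∙ a) ∙ k) ≡ i · flip (ρ k) · ρ a · ρ k
    ρ-conj k a i = trans (ρ-∙ (k ⁻¹ ∙ a) k i) (cong (_· ρ k) (trans (ρ-∙ (k ⁻¹) a i) (cong (_· ρ a) (ρ-⁻¹ k i))))

    ρ∈G : ∀ a → Mem G (ρ a)
    ρ∈G a = a , tt , λ _ → refl

    preimage-normal : ∀ M → (∀ {σ τ} → Mem G σ → Mem M τ → Mem M ((flip σ ∘ₚ τ) ∘ₚ σ)) → preimage M ⊴ whole A
    preimage-normal M M-conj = (λ _ → tt) , λ {k} {a} _ a∈ →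
      resp M {(flip (ρ k) ∘ₚ ρ a) ∘ₚ ρ k} {ρ ((k ⁻¹ ∙ a) ∙ k)} (λ i → sym (ρ-conj k a i))
        (M-conj {ρ k} {ρ a} (ρ∈G k) a∈)

    N⊆normal : ∀ M → M ⊴ G → Nontrivial M → ∀ {σ} → Mem N σ → Mem M σ
    N⊆normal M (M⊆G , M-conj) (τ , τ∈M , τ≉) {σ} (b , b∈ , eq) with M⊆G {τ} τ∈M
    ... | c , _ , ρc≈τ = resp M {ρ b} {σ} eq (B-least (preimage M) (preimage-normal M (λ {σ} {τ} → M-conj {σ} {τ}))
      (c , resp M {τ} {ρ c} (λ i → sym (ρc≈τ i)) τ∈M , λ c≈ε → τ≉ (λ i → trans (sym (ρc≈τ i)) (trans (ρ-cong c≈ε i) (ρ-ε i)))) b∈)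

    v : Fin n
    v = to ε

    v·ρ : ∀ a → v · ρ a ≡ to a
    v·ρ a = trans (ρ-to ε a) (to-cong (≈⇒~ (identityˡ a)))

    stabilizer : ∀ {a} → v · ρ a ≡ v → Mem H a
    stabilizer {a} eq = resp H (freely₂ a a (v₀ :∙ :ε :⁻¹) v₀ refl) (to-injective (trans (sym (v·ρ a)) eq))

    in-stabilizer : ∀ {a} → Mem H a → v · ρ a ≡ v
    in-stabilizer {a} a∈H = trans (v·ρ a) (to-cong (resp H (freely₂ a a v₀ (v₀ :∙ :ε :⁻¹) refl) a∈H))

    N⊴G : N ⊴ G
    N⊴G = (λ (b , _ , eq) → b , tt , eq) , λ {σ} {τ} (k , _ , k≈) (b , b∈ , b≈) →
      (k ⁻¹ ∙ b) ∙ k , proj₂ B-normal tt b∈ , λ i → trans (ρ-conj k b i)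
        (trans (k≈ _) (cong (_· σ) (trans (b≈ _) (cong (_· τ) (·-flip (ρ k) (trans (k≈ _) (Perm.inverseʳ σ)))))))

    kernel : Subgroup A
    kernel = preimage (record
      { Mem = λ σ → ∀ i → i · σ ≡ i ; mem? = λ σ → all? (λ i → i · σ ≟ i)
      ; resp = λ eq p i → trans (sym (eq i)) (p i) ; ε∈ = λ _ → refl
      ; ∙∈ = λ {σ} {τ} p q i → trans (cong (_· τ) (p i)) (q i) ; ⁻¹∈ = λ {σ} p i → ·-flip σ (p i) })

    -- A nontrivial kernel would contain `B`, and `b₀` would fix the vertex `H`.
    kernel-trivial : Trivial kernel
    kernel-trivial = [ (λ nt → contradiction (stabilizer (B-least kernel normal nt b₀∈B v)) b₀∉H) , (λ t → t) ]′
      (nontrivial-or-trivial finite kernel)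
      where
      normal : kernel ⊴ whole A
      normal = (λ _ → tt) , λ {k} {a} _ a∈ i → trans (ρ-conj k a i) (trans (cong (_· ρ k) (a∈ _)) (Perm.inverseʳ (ρ k)))

    ρ-injective : ∀ {a b} → (∀ i → i · ρ a ≡ i · ρ b) → a ≈ b
    ρ-injective {a} {b} eq = x∙y⁻¹≈ε⇒x≈y a b (kernel-trivial λ i →
      trans (ρ-∙ a (b ⁻¹) i) (trans (ρ-⁻¹ b (i · ρ a)) (·-flip (ρ b) (sym (eq i)))))

    N-transitive : Transitive N
    N-transitive i j = ρ b , (b , b∈B , λ _ → refl) , trans (cong (_· ρ b) (sym (strictlyInverseˡ i)))
      (trans (ρ-to x b) (trans (to-cong moved) (strictlyInverseˡ j)))
      where
      x y : Carrier
      x = from i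
      y = from j
      h : Carrier
      h = proj₁ (B-complement (y ∙ x ⁻¹))
      -- Chosen so that `x ∙ b` equals `h ∙ y`, which lies in the coset of `y`.
      b : Carrier
      b = (x ⁻¹ ∙ (h ∙ (y ∙ x ⁻¹))) ∙ x
      b∈B : Mem B b
      b∈B = proj₂ B-normal tt (proj₂ (proj₂ (B-complement (y ∙ x ⁻¹))))
      moved : x ∙ b ~ y
      moved = resp H (freely₃ h x y v₀ ((v₁ :∙ ((v₁ :⁻¹ :∙ (v₀ :∙ (v₂ :∙ v₁ :⁻¹))) :∙ v₁)) :∙ v₂ :⁻¹) refl)
        (proj₁ (proj₂ (B-complement (y ∙ x ⁻¹))))

    N-nontrivial : Nontrivial N
    N-nontrivial = ρ b₀ , (b₀ , b₀∈B , λ _ → refl) , λ eq → b₀∉H (stabilizer (eq v))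

    G-transitive : Transitive G
    G-transitive i j = let σ , (b , _ , eq) , p = N-transitive i j in σ , (b , tt , eq) , p

    w : Fin n
    w = to g

    arcs-not-reversed : ∀ σ → Mem G σ → v · σ ≡ w → w · σ ≢ v
    arcs-not-reversed σ (c , _ , c≈) vσ wσ = not-reversed {c ∙ g ⁻¹}
      (to-injective (trans (sym (v·ρ c)) (trans (c≈ v) vσ)))
      (resp H (freely₂ g c ((v₀ :∙ v₁) :∙ :ε :⁻¹) ((v₀ :∙ (v₁ :∙ v₀ :⁻¹)) :∙ v₀) refl)
        (to-injective (trans (sym (ρ-to g c)) (trans (c≈ w) wσ))))

  open OrbitalGraph G G-transitive v w arcs-not-reversed public using (graph)
  open OrbitalGraph G G-transitive v w arcs-not-reversed using (adj-invariant; og4)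

  private
    -- The elements whose cosets lie in the component of `v` form a subgroup: a path to the coset of
    -- `b` is continued by the translate under `b` of a path to the coset of `a`. It contains `H`
    -- and `g`, so it is everything.
    Reached : Subgroup A
    Reached = record
      { Mem  = λ a → Star (Adj graph) v (to a)
      ; mem? = λ a → Reachability.star? (adj? graph) v (to a)
      ; resp = λ eq → subst (Star (Adj graph) v) (to-cong (≈⇒~ eq))
      ; ε∈   = []*
      ; ∙∈   = λ {a} {b} p q → q ◅◅ subst₂ (Star (Adj graph)) (v·ρ b) (ρ-to a b) (translate b {v} {to a} p)
      ; ⁻¹∈  = λ {a} p → Star.reverse (symm graph)
          (subst₂ (Star (Adj graph)) (v·ρ (a ⁻¹)) (trans (ρ-to a (a ⁻¹)) (to-cong (≈⇒~ (inverseʳ a)))) (translate (a ⁻¹) {v} {to a} p))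
      }
      where
      translate : ∀ a {i j} → Star (Adj graph) i j → Star (Adj graph) (i · ρ a) (j · ρ a)
      translate a = Star.gmap (_· ρ a) (adj-invariant {ρ a} (ρ∈G a))

    reached : ∀ i → Star (Adj graph) v i
    reached i = subst (Star (Adj graph) v) (strictlyInverseˡ i) (generate Reached
      (λ {h} h∈ → subst (Star (Adj graph) v) (trans (sym (in-stabilizer h∈)) (v·ρ h)) []*)
      (inj₁ (ρ ε , ρ∈G ε , ρ-ε v , ρ-ε w) ◅ []*) (from i))

    connected : Connected graph
    connected = v , λ i j → Star.reverse (symm graph) (reached i) ◅◅ reached j

    doubleCoset : ∀ f {h} → ∃[ k ] Mem H ((f ∙ k) ∙ f ⁻¹) × (h ≈ k ⊎ h ≈ k ∙ h₀) → (f ∙ h ~ f) ⊎ (f ∙ h ~ f ∙ h₀)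
    doubleCoset f (k , fkf⁻¹∈H , inj₁ eq) = inj₁ (resp H (∙-congʳ (∙-congˡ (≈-sym eq))) fkf⁻¹∈H)
    doubleCoset f (k , fkf⁻¹∈H , inj₂ eq) = inj₂ (resp H (≈-trans
      (freely₃ f k h₀ ((v₀ :∙ v₁) :∙ v₀ :⁻¹) ((v₀ :∙ (v₁ :∙ v₂)) :∙ (v₀ :∙ v₂) :⁻¹) refl)
      (∙-congʳ (∙-congˡ (≈-sym eq)))) fkf⁻¹∈H)

    -- The neighbours of the coset H are the cosets in H g H and H g⁻¹ H.
    isOG4 : OG4 graph G
    isOG4 = og4 connected
      (to g) (to (g ∙ h₀)) (λ eq → out-distinct (to-injective eq))
      (ρ ε , ρ∈G ε , ρ-ε v , ρ-ε w) (ρ h₀ , ρ∈G h₀ , in-stabilizer h₀∈H , ρ-to g h₀)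
      (λ { y (σ , (c , _ , c≈) , vσ , wσ) → let y≡ = trans (sym wσ) (trans (sym (c≈ w)) (ρ-to g c)) in
           [ (λ p → inj₁ (trans y≡ (to-cong p))) , (λ p → inj₂ (trans y≡ (to-cong p))) ]′ (doubleCoset g (out (stabilizer (trans (c≈ v) vσ)))) })
      (to (g ⁻¹)) (to (g ⁻¹ ∙ h₀)) (λ eq → into-distinct (to-injective eq))
      (ρ (g ⁻¹) , ρ∈G (g ⁻¹) , v·ρ (g ⁻¹) , trans (ρ-to g (g ⁻¹)) (to-cong (≈⇒~ (inverseʳ g))))
      (ρ (g ⁻¹ ∙ h₀) , ρ∈G _ , v·ρ _ , trans (ρ-to g _) (trans (to-cong (≈⇒~ (\\-leftDividesˡ g h₀)))
        (trans (sym (v·ρ h₀)) (in-stabilizer h₀∈H))))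
      (λ { z (σ , (c , _ , c≈) , vσ , wσ) →
           let z≡ = trans (sym vσ) (trans (sym (c≈ v)) (trans (v·ρ c) (to-cong (≈⇒~ (≈-sym (\\-leftDividesʳ g c))))))
               gc∈H = resp H (freely₂ g c ((v₀ :∙ v₁) :∙ :ε :⁻¹) (v₀ :∙ v₁) refl)
                        (to-injective (trans (sym (ρ-to g c)) (trans (c≈ w) wσ)))
           in [ (λ p → inj₁ (trans z≡ (to-cong p))) , (λ p → inj₂ (trans z≡ (to-cong p))) ]′ (doubleCoset (g ⁻¹) (into gc∈H)) })

  basicQuasiprimitive : BasicQuasiprimitive graph G
  basicQuasiprimitive = isOG4 , λ M M⊴G nt i j →
    let σ , σ∈N , eq = N-transitive i j in σ , N⊆normal M M⊴G nt {σ} σ∈N , eq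

  uniqueMinimalNormal : UniqueMinimalNormal N G
  uniqueMinimalNormal = (N⊴G , N-nontrivial , λ M M⊴G nt _ {σ} → N⊆normal M M⊴G nt {σ}) ,
    λ M (M⊴G , nt , least) →
      let N⊆M : ∀ {σ} → Mem N σ → Mem M σ
          N⊆M {σ} = N⊆normal M M⊴G nt {σ}
      in (λ {σ} → least N N⊴G N-nontrivial (λ {σ} → N⊆M {σ}) {σ}) , (λ {σ} → N⊆M {σ})

  N≅ : ∀ {P : Group 0ℓ 0ℓ} → subgroup→group B ≅ P → subgroup→group N ≅ P
  N≅ {P} (f , iso) = f ∘ source , isGroupIsomorphism {G₁ = Group.rawGroup (subgroup→group N)} {G₂ = Group.rawGroup (subgroup→group B)}
      {G₃ = Group.rawGroup P} (Group.trans P)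
      (isIsomorphism (subgroup→group N) (subgroup→group B) source
        (λ {x} {y} eq → ρ-injective λ i → trans (proj₂ (proj₂ (proj₂ x)) i) (trans (eq i) (sym (proj₂ (proj₂ (proj₂ y)) i))))
        (λ _ _ → ≈-refl)
        (λ {x} {y} eq i → trans (sym (proj₂ (proj₂ (proj₂ x)) i)) (trans (ρ-cong eq i) (proj₂ (proj₂ (proj₂ y)) i)))
        (λ (b , b∈) → (ρ b , b , b∈ , λ _ → refl) , ≈-refl))
      iso
    where
    source : ∃ (Mem N) → ∃ (Mem B)
    source (_ , b , b∈ , _) = b , b∈

  N-not-regular : ∀ {b} → Mem B b → Mem H b → ¬ b ≈ ε → ¬ Regular N
  N-not-regular {b} b∈B b∈H b≉ε (_ , free) = b≉ε (ρ-injective λ i →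
    trans (free {ρ b} (b , b∈B , λ _ → refl) v (in-stabilizer b∈H) i) (sym (ρ-ε i)))

  order-bound : ∀ {m} (e : Fin m → Carrier) → (∀ i j → Mem H (e i ∙ e j ⁻¹) → i ≡ j) → m ≤ n
  order-bound e separate = injective⇒≤ {f = to ∘ e} (λ {i} {j} eq → separate i j (to-injective eq))

module CosetGraphExamples {A : Group 0ℓ 0ℓ} (D : CosetGraphData A) {m : ℕ} (e : Fin m → Group.Carrier A)
  (separate : ∀ i j → Mem (CosetGraphData.H D) (Group._∙_ A (e i) (Group._⁻¹ A (e j))) → i ≡ j)
  (T : Group 0ℓ 0ℓ) (nonabelianSimple : FiniteNonabelianSimple T) where
  open CosetGraphData D

  private
    n : ℕ
    n = proj₁ (Cosets.cosetsFinite finite H)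

  open CosetGraph D (proj₂ (Cosets.cosetsFinite finite H))

  private
    socleIsPower : ∀ {k} → subgroup→group B ≅ power T k → SocleIsPower G N T k
    socleIsPower {k} B≅ = record
      { uniqueMinimalNormal = uniqueMinimalNormal ; nonabelianSimple = nonabelianSimple ; isPower = N≅ {power T k} B≅ }

  almostSimpleExample : subgroup→group B ≅ power T 1 →
    Σ[ n ∈ ℕ ] m ≤ n × (Σ[ Γ ∈ Graph n ] Σ[ G ∈ PermGroup n ] AlmostSimpleExample Γ G)
  almostSimpleExample B≅ = n , order-bound e separate , graph , G , basicQuasiprimitive , N , T , socleIsPower B≅

  nonregularSquareExample : subgroup→group B ≅ power T 2 →
    ∀ b → Mem B b → Mem H b → ¬ Group._≈_ A b (Group.ε A) →
    Σ[ n ∈ ℕ ] m ≤ n × (Σ[ Γ ∈ Graph n ] Σ[ G ∈ PermGroup n ] NonregularSquareExample Γ G)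
  nonregularSquareExample B≅ b b∈B b∈H b≉ε =
    n , order-bound e separate , graph , G , basicQuasiprimitive , N , T , socleIsPower B≅ , N-not-regular b∈B b∈H b≉ε

-- Transpositions

module _ {n : ℕ} where

  transpose-left : ∀ (i j : Fin n) → i · transpose i j ≡ j
  transpose-left i j with i ≟ i
  ... | yes _  = refl
  ... | no i≢i = contradiction refl i≢i

  transpose-right : ∀ (i j : Fin n) → j · transpose i j ≡ i
  transpose-right i j with j ≟ i
  ... | yes j≡i = j≡i
  ... | no _ with j ≟ j
  ...   | yes _  = refl
  ...   | no j≢j = contradiction refl j≢j

  transpose-other : ∀ {i j k : Fin n} → k ≢ i → k ≢ j → k · transpose i j ≡ k
  transpose-other {i} {j} {k} k≢i k≢j with k ≟ i
  ... | yes k≡i = contradiction k≡i k≢i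
  ... | no _ with k ≟ j
  ...   | yes k≡j = contradiction k≡j k≢j
  ...   | no _    = refl

  transpose-determined : ∀ {i j k : Fin n} (σ : Permutation′ n) → i · σ ≡ j → j · σ ≡ i →
                         (∀ {k} → k ≢ i → k ≢ j → k · σ ≡ k) → k · transpose i j ≡ k · σ
  transpose-determined {i} {j} {k} σ iσ jσ kσ with k ≟ i
  ... | yes refl = sym iσ
  ... | no k≢i with k ≟ j
  ...   | yes refl = sym jσ
  ...   | no k≢j   = sym (kσ k≢i k≢j)

  transpose-sym : ∀ (i j k : Fin n) → k · transpose i j ≡ k · transpose j i
  transpose-sym i j k = transpose-determined {k = k} (transpose j i) (transpose-right j i) (transpose-left j i)
    (λ k≢i k≢j → transpose-other k≢j k≢i)

  transpose-conj : ∀ (σ : Permutation′ n) i j k → k · flip σ · transpose i j · σ ≡ k · transpose (i · σ) (j · σ)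
  transpose-conj σ i j k = sym (transpose-determined ((flip σ ∘ₚ transpose i j) ∘ₚ σ)
    (cong (_· σ) (trans (cong (_· transpose i j) (Perm.inverseˡ σ)) (transpose-left i j)))
    (cong (_· σ) (trans (cong (_· transpose i j) (Perm.inverseˡ σ)) (transpose-right i j)))
    (λ {k} k≢i k≢j → trans (cong (_· σ) (transpose-other
        (λ eq → k≢i (trans (sym (Perm.inverseʳ σ)) (cong (_· σ) eq)))
        (λ eq → k≢j (trans (sym (Perm.inverseʳ σ)) (cong (_· σ) eq)))))
      (Perm.inverseʳ σ)))

  -- The transpositions may overlap. Such products replace the notion of an even permutation, and
  -- 3-cycles are the case of one common point.
  pair : (i j k l : Fin n) → Permutation′ n
  pair i j k l = transpose i j ∘ₚ transpose k l

  pair-conj : ∀ (σ : Permutation′ n) i j k l x →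
              x · flip σ · transpose i j · transpose k l · σ ≡ x · pair (i · σ) (j · σ) (k · σ) (l · σ)
  pair-conj σ i j k l x = trans (cong (λ y → y · transpose k l · σ) (sym (Perm.inverseˡ σ)))
    (trans (transpose-conj σ k l (x · flip σ · transpose i j · σ)) (cong (_· transpose (k · σ) (l · σ)) (transpose-conj σ i j x)))

  threeCycle : (i j k : Fin n) → Permutation′ n
  threeCycle i j k = pair i j j k

  -- Moving (i j) past (j k) turns it into (i k).
  threeCycle-rotate : ∀ {i j k : Fin n} → i ≢ j → i ≢ k → ∀ x → x · threeCycle i j k ≡ x · threeCycle j k i
  threeCycle-rotate {i} {j} {k} i≢j i≢k x = begin
    x · transpose i j · s                    ≡⟨ cong (λ y → y · transpose i j · s) (Perm.inverseˡ s {x}) ⟨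
    x · s · flip s · transpose i j · s       ≡⟨ transpose-conj s i j (x · s) ⟩
    x · s · transpose (i · s) (j · s)        ≡⟨ cong₂ (λ y z → x · s · transpose y z) (transpose-other i≢j i≢k) (transpose-left j k) ⟩
    x · s · transpose i k                    ≡⟨ transpose-sym i k (x · s) ⟩
    x · s · transpose k i                    ∎
    where
    open ≡-Reasoning
    s = transpose j k

  fresh : (xs : List (Fin n)) → length xs < n → ∃[ y ] All (y ≢_) xs
  fresh xs len with any? (λ y → ¬? (y ∈? xs))
    where open DecMembership _≟_ using (_∈?_)
  ... | yes (y , y∉xs) = y , ¬Any⇒All¬ xs y∉xs
  ... | no none = contradiction (injective⇒≤ {f = λ y → ∈-index (everywhere y)}
      (λ {y} {z} → index-injective (setoid (Fin n)) (everywhere y) (everywhere z))) (ℕₚ.<⇒≱ len)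
    where
    open DecMembership _≟_ using (_∈?_)
    everywhere : ∀ y → y ∈ xs
    everywhere y = decidable-stable (y ∈? xs) (λ y∉ → none (y , y∉))

AllPairs : ∀ {n} → PermGroup n → Set
AllPairs K = ∀ i j k l → i ≢ j → k ≢ l → Mem K (pair i j k l)

AllThreeCycles : ∀ {n} → PermGroup n → Set
AllThreeCycles K = ∀ i j k → i ≢ j → i ≢ k → j ≢ k → Mem K (threeCycle i j k)

-- Simplicity of alternating groups

module NormalInAlternating {n : ℕ} (8<n : 8 < n) (K : PermGroup n) (pairs : AllPairs K)
                           (M : PermGroup n) (M⊴K : M ⊴ K) where

  private
    fresh′ : ∀ (xs : List (Fin n)) → length xs ≤ 8 → ∃[ y ] All (y ≢_) xs
    fresh′ xs len = fresh xs (ℕₚ.≤-<-trans len 8<n)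

    conj∈ : ∀ σ τ → Mem K σ → Mem M τ → Mem M ((flip σ ∘ₚ τ) ∘ₚ σ)
    conj∈ σ τ = proj₂ M⊴K {σ} {τ}

    commutator∈ : ∀ σ τ → Mem M σ → Mem K τ → Mem M (flip σ ∘ₚ ((flip τ ∘ₚ σ) ∘ₚ τ))
    commutator∈ σ τ σ∈M τ∈K = ∙∈ M {flip σ} {(flip τ ∘ₚ σ) ∘ₚ τ} (⁻¹∈ M {σ} σ∈M) (conj∈ τ σ τ∈K σ∈M)

  -- If c is a 3-cycle through i and i · σ then σ⁻¹c⁻¹σc moves few points.
  small-support : ∀ σ → Mem M σ → ∀ i → i · σ ≢ i →
    ∃[ ρ ] Mem M ρ × ∃[ p ] p · ρ ≢ p × ∃[ x ] ∃[ y ] x ≢ y × x · ρ ≡ x × y · ρ ≡ y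
  small-support σ σ∈M i iσ≢i
    -- `k` avoids the preimage of `i` so that the commutator moves `k · σ`, which it takes to `i`;
    -- `x` and `y` avoid the five points that it can move.
    with fresh′ (i ∷ i · σ ∷ i · σ · σ ∷ i · flip σ ∷ []) (ℕₚ.m≤m+n 4 4)
  ... | k , k≢i ∷ k≢i′ ∷ _ ∷ k≢iσ⁻¹ ∷ []
    with fresh′ (k · σ ∷ i · σ · σ ∷ i · σ ∷ i ∷ k ∷ []) (ℕₚ.m≤m+n 5 3)
  ... | x , x≢
    with fresh′ (x ∷ k · σ ∷ i · σ · σ ∷ i · σ ∷ i ∷ k ∷ []) (ℕₚ.m≤m+n 6 2)
  ... | y , y≢x ∷ y≢ =
      ρ , commutator∈ σ τ σ∈M (pairs i i′ i′ k (iσ≢i ∘ sym) (k≢i′ ∘ sym)) ,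
      k′ , (λ eq → k≢iσ⁻¹ (sym (·-flip σ (trans (sym eq) k′ρ)))) ,
      x , y , y≢x ∘ sym , fixed x x≢ , fixed y y≢
    where
    i′ i″ k′ : Fin n
    i′ = i · σ
    i″ = i′ · σ
    k′ = k · σ
    τ ρ : Permutation′ n
    τ = threeCycle i i′ k
    ρ = flip σ ∘ₚ ((flip τ ∘ₚ σ) ∘ₚ τ)
    ρ≡ : ∀ z → z · ρ ≡ z · transpose k′ i″ · transpose i″ i′ · transpose i i′ · transpose i′ k
    ρ≡ z = cong (λ w → w · transpose i i′ · transpose i′ k) (pair-conj σ k i′ i′ i z)
    fixed : ∀ z → All (z ≢_) (k′ ∷ i″ ∷ i′ ∷ i ∷ k ∷ []) → z · ρ ≡ z
    fixed z (z≢k′ ∷ z≢i″ ∷ z≢i′ ∷ z≢i ∷ z≢k ∷ []) = trans (ρ≡ z)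
      (trans (cong (λ w → w · transpose i″ i′ · transpose i i′ · transpose i′ k) (transpose-other z≢k′ z≢i″))
      (trans (cong (λ w → w · transpose i i′ · transpose i′ k) (transpose-other z≢i″ z≢i′))
      (trans (cong (λ w → w · transpose i′ k) (transpose-other z≢i z≢i′)) (transpose-other z≢i′ z≢k))))
    k′ρ : k′ · ρ ≡ i
    k′ρ = trans (ρ≡ k′)
      (trans (cong (λ w → w · transpose i″ i′ · transpose i i′ · transpose i′ k) (transpose-left k′ i″))
      (trans (cong (λ w → w · transpose i i′ · transpose i′ k) (transpose-left i″ i′))
      (trans (cong (λ w → w · transpose i′ k) (transpose-right i i′))
             (transpose-other (iσ≢i ∘ sym) (k≢i ∘ sym)))))

  -- Let `c` be a 3-cycle on `p`, `x`, `y`. The conjugate by `ρ` of its inverse is a 3-cycle on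
  -- `p · ρ`, `x`, `y`, and multiplying it by `c` leaves a 3-cycle on `p · ρ`, `y`, `p`.
  some-threeCycle : ∀ ρ → Mem M ρ → ∀ p → p · ρ ≢ p → ∀ x y → x ≢ y → x · ρ ≡ x → y · ρ ≡ y →
    ∃[ i ] ∃[ j ] ∃[ k ] i ≢ j × i ≢ k × j ≢ k × Mem M (threeCycle i j k)
  some-threeCycle ρ ρ∈M p pρ≢p x y x≢y xρ yρ = q , y , p , q≢ y yρ , pρ≢p , (λ eq → p≢ y yρ (sym eq)) ,
    resp M {flip ρ ∘ₚ ((flip c ∘ₚ ρ) ∘ₚ c)} {threeCycle q y p} equal
      (commutator∈ ρ c ρ∈M (pairs p x x y (p≢ x xρ) x≢y))
    where
    q : Fin n
    q = p · ρ
    p≢ : ∀ z → z · ρ ≡ z → p ≢ z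
    p≢ z zρ refl = pρ≢p zρ
    q≢ : ∀ z → z · ρ ≡ z → q ≢ z
    q≢ z zρ eq = p≢ z zρ (·-injective ρ (trans eq (sym zρ)))
    c : Permutation′ n
    c = threeCycle p x y
    s : Permutation′ n
    s = transpose x y
    open ≡-Reasoning
    equal : ∀ w → w · flip ρ · flip c · ρ · c ≡ w · threeCycle q y p
    equal w = begin
      w · flip ρ · transpose y x · transpose x p · ρ · transpose p x · s
        ≡⟨ cong (λ v → v · transpose p x · s) (pair-conj ρ y x x p w) ⟩
      w · transpose (y · ρ) (x · ρ) · transpose (x · ρ) q · transpose p x · s
        ≡⟨ cong₂ (λ y′ x′ → w · transpose y′ x′ · transpose x′ q · transpose p x · s) yρ xρ ⟩
      w · flip s · transpose x q · transpose p x · s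
        ≡⟨ pair-conj s x q p x w ⟩
      w · transpose (x · s) (q · s) · transpose (p · s) (x · s)
        ≡⟨ cong₂ (λ q′ p′ → w · transpose (x · s) q′ · transpose p′ (x · s))
             (transpose-other (q≢ x xρ) (q≢ y yρ)) (transpose-other (p≢ x xρ) (p≢ y yρ)) ⟩
      w · transpose (x · s) q · transpose p (x · s)
        ≡⟨ cong (λ y′ → w · transpose y′ q · transpose p y′) (transpose-left x y) ⟩
      w · transpose y q · transpose p y
        ≡⟨ cong (_· transpose p y) (transpose-sym y q w) ⟩
      w · transpose q y · transpose p y
        ≡⟨ transpose-sym p y (w · transpose q y) ⟩
      w · transpose q y · transpose y p ∎

  private
    -- Conjugation by (z z′)(v w), where the disjoint transposition (v w) only serves to make the
    -- conjugating element even.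
    replace : ∀ {x y z} z′ → x ≢ z → y ≢ z → x ≢ z′ → y ≢ z′ → z ≢ z′ →
              Mem M (threeCycle x y z) → Mem M (threeCycle x y z′)
    replace {x} {y} {z} z′ x≢z y≢z x≢z′ y≢z′ z≢z′ c∈M
      with fresh′ (x ∷ y ∷ z ∷ z′ ∷ []) (ℕₚ.m≤m+n 4 4)
    ... | v , v≢x ∷ v≢y ∷ v≢z ∷ v≢z′ ∷ []
      with fresh′ (v ∷ x ∷ y ∷ z ∷ z′ ∷ []) (ℕₚ.m≤m+n 5 3)
    ... | w , w≢v ∷ w≢x ∷ w≢y ∷ w≢z ∷ w≢z′ ∷ [] = resp M {(flip d ∘ₚ threeCycle x y z) ∘ₚ d} {threeCycle x y z′}
      (λ k → trans (pair-conj d x y y z k) (trans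
        (cong₂ (λ x′ z″ → k · transpose x′ (y · d) · transpose (y · d) z″)
          (fixed x≢z x≢z′ (v≢x ∘ sym) (w≢x ∘ sym))
          (trans (cong (_· transpose v w) (transpose-left z z′)) (transpose-other (v≢z′ ∘ sym) (w≢z′ ∘ sym))))
        (cong (λ y′ → k · transpose x y′ · transpose y′ z′) (fixed y≢z y≢z′ (v≢y ∘ sym) (w≢y ∘ sym)))))
      (conj∈ d (threeCycle x y z) (pairs z z′ v w z≢z′ (w≢v ∘ sym)) c∈M)
      where
      d : Permutation′ n
      d = pair z z′ v w
      fixed : ∀ {k} → k ≢ z → k ≢ z′ → k ≢ v → k ≢ w → k · d ≡ k
      fixed k≢z k≢z′ k≢v k≢w = trans (cong (_· transpose v w) (transpose-other k≢z k≢z′)) (transpose-other k≢v k≢w)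

    rotate : ∀ {x y z} → x ≢ y → x ≢ z → Mem M (threeCycle x y z) → Mem M (threeCycle y z x)
    rotate {x} {y} {z} x≢y x≢z = resp M {threeCycle x y z} {threeCycle y z x} (threeCycle-rotate x≢y x≢z)

  -- Replacing the entries one at a time, by way of three fresh points.
  all-threeCycles : ∀ {x y z} → x ≢ y → x ≢ z → y ≢ z → Mem M (threeCycle x y z) → AllThreeCycles M
  all-threeCycles {x} {y} {z} x≢y x≢z y≢z c∈M p q r p≢q p≢r q≢r
    with fresh′ (p ∷ q ∷ x ∷ y ∷ z ∷ []) (ℕₚ.m≤m+n 5 3)
  ... | f , f≢p ∷ f≢q ∷ f≢x ∷ f≢y ∷ f≢z ∷ []
    with fresh′ (f ∷ p ∷ q ∷ r ∷ x ∷ y ∷ []) (ℕₚ.m≤m+n 6 2)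
  ... | g , g≢f ∷ g≢p ∷ g≢q ∷ g≢r ∷ g≢x ∷ g≢y ∷ []
    with fresh′ (g ∷ f ∷ p ∷ y ∷ []) (ℕₚ.m≤m+n 4 4)
  ... | h , h≢g ∷ h≢f ∷ h≢p ∷ h≢y ∷ [] =
    replace r (g≢p ∘ sym) (g≢q ∘ sym) p≢r q≢r g≢r
      (rotate g≢p g≢q
        (replace q g≢f (f≢p ∘ sym) g≢q p≢q f≢q
          (rotate (g≢f ∘ sym) f≢p
            (replace p (h≢f ∘ sym) (h≢g ∘ sym) f≢p g≢p h≢p
              (replace h f≢y g≢y (h≢f ∘ sym) (h≢g ∘ sym) (h≢y ∘ sym)
                (rotate (f≢y ∘ sym) (g≢y ∘ sym)
                  (replace g (x≢y ∘ sym) f≢x (g≢y ∘ sym) (g≢f ∘ sym) (g≢x ∘ sym)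
                    (rotate x≢y (f≢x ∘ sym)
                      (replace f x≢z y≢z (f≢x ∘ sym) (f≢y ∘ sym) (f≢z ∘ sym) c∈M)))))))))

  nontrivial⇒all-threeCycles : Nontrivial M → AllThreeCycles M
  nontrivial⇒all-threeCycles (σ , σ∈M , σ≉id) with any? (λ i → ¬? (i · σ ≟ i))
  ... | no none = contradiction (λ i → decidable-stable (i · σ ≟ i) (λ ≢ → none (i , ≢))) σ≉id
  ... | yes (i , iσ≢i) = from-small (small-support σ σ∈M i iσ≢i)
    where
    from-three : ∃[ i ] ∃[ j ] ∃[ k ] i ≢ j × i ≢ k × j ≢ k × Mem M (threeCycle i j k) → AllThreeCycles M
    from-three (_ , _ , _ , i≢j , i≢k , j≢k , c∈M) = all-threeCycles i≢j i≢k j≢k c∈M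
    from-small : ∃[ ρ ] Mem M ρ × ∃[ p ] p · ρ ≢ p × ∃[ x ] ∃[ y ] x ≢ y × x · ρ ≡ x × y · ρ ≡ y → AllThreeCycles M
    from-small (ρ , ρ∈M , p , pρ≢p , x , y , x≢y , xρ , yρ) = from-three (some-threeCycle ρ ρ∈M p pρ≢p x y x≢y xρ yρ)

-- The long cycle i + 1 ↦ i

double : ℕ → ℕ
double zero    = zero
double (suc k) = suc (suc (double k))

abstract
  cycle : ∀ n → Permutation′ (suc n)
  cycle zero    = Perm.id
  cycle (suc n) = transpose zero (suc zero) ∘ₚ lift₀ (cycle n)

  cycle-suc : ∀ n (i : Fin n) → suc i · cycle n ≡ inject₁ i
  cycle-suc (suc n) zero    = refl
  cycle-suc (suc n) (suc i) = cong suc (cycle-suc n i)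

  -- Splitting off the 3-cycle on 0, 1, 2 leaves the cycle on the points from 2 on, which is shorter
  -- by two; `K′` is the preimage of `K` for those points.
  cycle-even : ∀ k (K : PermGroup (suc (double k))) → AllThreeCycles K → Mem K (cycle (double k))
  cycle-even zero    K _    = ε∈ K
  cycle-even (suc k) K three = resp K {threeCycle 0F 1F 2F ∘ₚ lift² (cycle (double k))} {cycle (double (suc k))}
      (λ x → sym (trans (sym (lift₀-comp (transpose 0F 1F) (lift₀ (cycle (double k))) (x · transpose 0F 1F)))
        (cong (_· lift² (cycle (double k))) (sym (lift₀-transpose 0F 1F (x · transpose 0F 1F))))))
      (∙∈ K {threeCycle 0F 1F 2F} {lift² (cycle (double k))}
        (three 0F 1F 2F (λ ()) (λ ()) (λ ())) (cycle-even k K′ three′))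
    where
    lift² : ∀ {n} → Permutation′ n → Permutation′ (suc (suc n))
    lift² σ = lift₀ (lift₀ σ)
    lift²-cong : ∀ {n} (σ τ : Permutation′ n) → (∀ i → i · σ ≡ i · τ) → ∀ i → i · lift² σ ≡ i · lift² τ
    lift²-cong σ τ eq = lift₀-cong (lift₀ σ) (lift₀ τ) (lift₀-cong σ τ eq)
    lift²-comp : ∀ {n} (σ τ : Permutation′ n) i → i · lift² σ · lift² τ ≡ i · lift² (σ ∘ₚ τ)
    lift²-comp σ τ i = trans (lift₀-comp (lift₀ σ) (lift₀ τ) i) (lift₀-cong (lift₀ σ ∘ₚ lift₀ τ) (lift₀ (σ ∘ₚ τ)) (lift₀-comp σ τ) i)
    lift²-transpose : ∀ {n} (i j : Fin n) x → x · transpose (suc (suc i)) (suc (suc j)) ≡ x · lift² (transpose i j)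
    lift²-transpose i j x = trans (lift₀-transpose (suc i) (suc j) x)
      (lift₀-cong (transpose (suc i) (suc j)) (lift₀ (transpose i j)) (lift₀-transpose i j) x)
    K′ : PermGroup (suc (double k))
    K′ = record
      { Mem  = λ σ → Mem K (lift² σ)
      ; mem? = λ σ → mem? K (lift² σ)
      ; resp = λ {σ} {τ} eq → resp K {lift² σ} {lift² τ} (lift²-cong σ τ eq)
      ; ε∈   = resp K {Perm.id} {lift² Perm.id} (λ { zero → refl ; (suc zero) → refl ; (suc (suc _)) → refl }) (ε∈ K)
      ; ∙∈   = λ {σ} {τ} p q → resp K {lift² σ ∘ₚ lift² τ} {lift² (σ ∘ₚ τ)} (lift²-comp σ τ) (∙∈ K {lift² σ} {lift² τ} p q)
      ; ⁻¹∈  = λ {σ} p → resp K {flip (lift² σ)} {lift² (flip σ)} (λ { zero → refl ; (suc zero) → refl ; (suc (suc _)) → refl }) (⁻¹∈ K {lift² σ} p)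
      }
    three′ : AllThreeCycles K′
    three′ i j l i≢j i≢l j≢l = resp K {threeCycle (suc (suc i)) (suc (suc j)) (suc (suc l))} {lift² (threeCycle i j l)}
      (λ x → trans (lift²-transpose j l (x · transpose (suc (suc i)) (suc (suc j))))
        (trans (cong (_· lift² (transpose j l)) (lift²-transpose i j x)) (lift²-comp (transpose i j) (transpose j l) x)))
      (three (suc (suc i)) (suc (suc j)) (suc (suc l)) (i≢j ∘ up) (i≢l ∘ up) (j≢l ∘ up))
      where
      up : ∀ {n} {i j : Fin n} → _≡_ {A = Fin (suc (suc n))} (suc (suc i)) (suc (suc j)) → i ≡ j
      up = suc-injective ∘ suc-injective

-- The vertex stabilizers of the examples will be ⟨u⟩ in T and the group
-- generated by (u , u) and the swap in T wr 2; the elements a and (a , u a)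
-- map a vertex to an outneighbour.
record Seed (m : ℕ) : Set₁ where
  field
    T : Group 0ℓ 0ℓ
  open Group T
  field
    nonabelianSimple : FiniteNonabelianSimple T
    u a              : Carrier
    u²≈ε             : u ∙ u ≈ ε
    generates        : Generates T u a
    ua≉au            : ¬ u ∙ a ≈ a ∙ u
    not-reversed     : ∀ {h} → h ≈ ε ⊎ h ≈ u → ¬ ((a ∙ h) ∙ a ≈ ε ⊎ (a ∙ h) ∙ a ≈ u)
    noAut            : ∀ {α} → IsIsomorphism T T α → α u ≈ u → ¬ α a ≈ u ∙ a
    -- Representatives of distinct cosets of ⟨u⟩, which force at least `m` vertices.
    c                : Fin m → Carrier
    c-separate       : ∀ i j → c i ∙ c j ⁻¹ ≈ ε ⊎ c i ∙ c j ⁻¹ ≈ u → i ≡ j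

module SeedProperties {m : ℕ} (seed : Seed m) where
  open Seed seed public
  open Group T public hiding (setoid) renaming (refl to ≈-refl; sym to ≈-sym; trans to ≈-trans)
  open GroupProperties T public
  open FreeGroup T public
  open FiniteSearch (proj₂ (proj₁ nonabelianSimple)) public using (_≈?_; ∃?)

  T-finite : FiniteGroup T
  T-finite = proj₁ nonabelianSimple

  T-simple : ∀ (M : Subgroup T) → M ⊴ whole T → (∀ {x} → Mem M x → x ≈ ε) ⊎ (∀ x → Mem M x)
  T-simple = proj₂ (proj₂ (proj₂ nonabelianSimple))

  u⁻¹≈u : u ⁻¹ ≈ u
  u⁻¹≈u = ≈-sym (inverseˡ-unique u u u²≈ε)

  u≉ε : ¬ u ≈ ε
  u≉ε u≈ε = ua≉au (≈-trans (∙-congʳ u≈ε) (≈-trans (identityˡ a) (≈-sym (≈-trans (∙-congˡ u≈ε) (identityʳ a)))))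

  u*-∙ : ∀ {x y} → x ≈ ε ⊎ x ≈ u → y ≈ ε ⊎ y ≈ u → x ∙ y ≈ ε ⊎ x ∙ y ≈ u
  u*-∙ (inj₁ p) (inj₁ q) = inj₁ (≈-trans (∙-cong p q) (identityˡ ε))
  u*-∙ (inj₁ p) (inj₂ q) = inj₂ (≈-trans (∙-cong p q) (identityˡ u))
  u*-∙ (inj₂ p) (inj₁ q) = inj₂ (≈-trans (∙-cong p q) (identityʳ u))
  u*-∙ (inj₂ p) (inj₂ q) = inj₁ (≈-trans (∙-cong p q) u²≈ε)

  ⟨u⟩ : Subgroup T
  ⟨u⟩ = record
    { Mem  = λ x → x ≈ ε ⊎ x ≈ u
    ; mem? = λ x → (x ≈? ε) ⊎-dec (x ≈? u)
    ; resp = λ eq → [ (λ p → inj₁ (≈-trans (≈-sym eq) p)) , (λ p → inj₂ (≈-trans (≈-sym eq) p)) ]′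
    ; ε∈   = inj₁ ≈-refl
    ; ∙∈   = u*-∙
    ; ⁻¹∈  = [ (λ p → inj₁ (≈-trans (⁻¹-cong p) ε⁻¹≈ε)) , (λ p → inj₂ (≈-trans (⁻¹-cong p) u⁻¹≈u)) ]′
    }

  out-distinct : ¬ Mem ⟨u⟩ (a ∙ (a ∙ u) ⁻¹)
  out-distinct (inj₁ p) = u≉ε (≈-trans (≈-sym (⁻¹-involutive u)) (≈-trans (⁻¹-cong u⁻¹≈ε) ε⁻¹≈ε))
    where
    u⁻¹≈ε : u ⁻¹ ≈ ε
    u⁻¹≈ε = ≈-trans (freely₂ a u (v₁ :⁻¹) (v₀ :⁻¹ :∙ (v₀ :∙ (v₀ :∙ v₁) :⁻¹) :∙ v₀) refl)
      (≈-trans (∙-congʳ (∙-congˡ p)) (freely₂ a u (v₀ :⁻¹ :∙ :ε :∙ v₀) :ε refl))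
  out-distinct (inj₂ p) = ua≉au (≈-trans (∙-congʳ (≈-sym p))
    (≈-trans (freely₂ a u (v₀ :∙ (v₀ :∙ v₁) :⁻¹ :∙ v₀) (v₀ :∙ v₁ :⁻¹) refl) (∙-congˡ u⁻¹≈u)))

  into-distinct : ¬ Mem ⟨u⟩ (a ⁻¹ ∙ (a ⁻¹ ∙ u) ⁻¹)
  into-distinct (inj₁ p) = u≉ε (≈-trans (≈-sym (⁻¹-involutive u)) (≈-trans (⁻¹-cong u⁻¹≈ε) ε⁻¹≈ε))
    where
    u⁻¹≈ε : u ⁻¹ ≈ ε
    u⁻¹≈ε = ≈-trans (freely₂ a u (v₁ :⁻¹) (v₀ :∙ (v₀ :⁻¹ :∙ (v₀ :⁻¹ :∙ v₁) :⁻¹) :∙ v₀ :⁻¹) refl)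
      (≈-trans (∙-congʳ (∙-congˡ p)) (freely₂ a u (v₀ :∙ :ε :∙ v₀ :⁻¹) :ε refl))
  into-distinct (inj₂ p) = ua≉au (≈-trans (∙-congʳ (≈-sym u⁻¹≈u))
    (≈-trans (freely₂ a u (v₁ :⁻¹ :∙ v₀) (v₀ :∙ (v₀ :⁻¹ :∙ (v₀ :⁻¹ :∙ v₁) :⁻¹)) refl) (∙-congˡ p)))

-- Examples with simple socle

module AlmostSimple {m : ℕ} (seed : Seed m) where
  open SeedProperties seed

  cosetGraphData : CosetGraphData T
  cosetGraphData = record
    { finite        = T-finite
    ; H             = ⟨u⟩
    ; B             = whole T
    ; g             = a
    ; h₀            = u
    ; h₀∈H          = inj₂ ≈-refl
    ; generate      = λ K ⟨u⟩⊆K a∈K → generates K (⟨u⟩⊆K (inj₂ ≈-refl)) a∈K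
    ; out           = fixed-coset a
    ; out-distinct  = out-distinct
    ; into          = fixed-coset (a ⁻¹)
    ; into-distinct = into-distinct
    ; not-reversed  = not-reversed
    ; B-normal      = (λ _ → tt) , λ _ _ → tt
    ; B-least       = λ M M⊴T (x , x∈M , x≉ε) {y} _ →
        [ (λ trivial → contradiction (trivial x∈M) x≉ε) , (λ all → all y) ]′ (T-simple M M⊴T)
    ; B-complement  = λ _ → ε , inj₁ ≈-refl , tt
    ; b₀            = a
    ; b₀∈B          = tt
    ; b₀∉H          = λ
        { (inj₁ p) → ua≉au (≈-trans (∙-congˡ p) (≈-trans (identityʳ u) (≈-sym (≈-trans (∙-congʳ p) (identityˡ u)))))
        ; (inj₂ p) → ua≉au (≈-trans (∙-congˡ p) (∙-congʳ (≈-sym p))) }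
    }
    where
    fixed-coset : ∀ g {h} → Mem ⟨u⟩ h → ∃[ k ] Mem ⟨u⟩ ((g ∙ k) ∙ g ⁻¹) × (h ≈ k ⊎ h ≈ k ∙ u)
    fixed-coset g h∈ = ε , inj₁ (freely₂ g g (v₀ :∙ :ε :∙ v₀ :⁻¹) :ε refl) ,
      [ inj₁ , (λ h≈u → inj₂ (≈-trans h≈u (≈-sym (identityˡ u)))) ]′ h∈

  example : Σ[ n ∈ ℕ ] m ≤ n × (Σ[ Γ ∈ Graph n ] Σ[ G ∈ PermGroup n ] AlmostSimpleExample Γ G)
  example = CosetGraphExamples.almostSimpleExample cosetGraphData c c-separate T nonabelianSimple
    ( (λ x _ → proj₁ x)
    , isIsomorphism (subgroup→group (whole T)) (power T 1) (λ x _ → proj₁ x)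
        (λ eq _ → eq) (λ _ _ _ → ≈-refl) (λ eq → eq zero) (λ f → (f zero , tt) , λ { zero → ≈-refl }) )

-- The wreath product of T with the group of order two; (i , x , y) is τⁱ (x , y).
module WreathProduct (T : Group 0ℓ 0ℓ) where
  open Group T hiding (setoid) renaming (refl to ≈-refl; sym to ≈-sym; trans to ≈-trans)
  open GroupProperties T using (ε⁻¹≈ε)

  Elt : Set
  Elt = Bool × Carrier × Carrier

  infix 4 _≈ʷ_
  _≈ʷ_ : Rel Elt 0ℓ
  (i , x , y) ≈ʷ (j , x′ , y′) = i ≡ j × x ≈ x′ × y ≈ y′

  infixl 7 _∙ʷ_
  _∙ʷ_ : Elt → Elt → Elt
  (i , x , y) ∙ʷ (false , x′ , y′) = i , x ∙ x′ , y ∙ y′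
  (i , x , y) ∙ʷ (true  , x′ , y′) = not i , y ∙ x′ , x ∙ y′

  _⁻¹ʷ : Elt → Elt
  (false , x , y) ⁻¹ʷ = false , x ⁻¹ , y ⁻¹
  (true  , x , y) ⁻¹ʷ = true  , y ⁻¹ , x ⁻¹

  private
    not-not : ∀ i → not (not i) ≡ i
    not-not true  = refl
    not-not false = refl

    ≈ʷ-isEquivalence : IsEquivalence _≈ʷ_
    ≈ʷ-isEquivalence = record
      { refl  = refl , ≈-refl , ≈-refl
      ; sym   = λ (p , q , r) → sym p , ≈-sym q , ≈-sym r
      ; trans = λ (p , q , r) (p′ , q′ , r′) → trans p p′ , ≈-trans q q′ , ≈-trans r r′
      }

    ∙ʷ-cong : ∀ {x y z w} → x ≈ʷ y → z ≈ʷ w → x ∙ʷ z ≈ʷ y ∙ʷ w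
    ∙ʷ-cong {z = false , _} (refl , q , r) (refl , q′ , r′) = refl , ∙-cong q q′ , ∙-cong r r′
    ∙ʷ-cong {z = true  , _} (refl , q , r) (refl , q′ , r′) = refl , ∙-cong r q′ , ∙-cong q r′

    ∙ʷ-assoc : ∀ x y z → (x ∙ʷ y) ∙ʷ z ≈ʷ x ∙ʷ (y ∙ʷ z)
    ∙ʷ-assoc (i , _) (false , _) (false , _) = refl , assoc _ _ _ , assoc _ _ _
    ∙ʷ-assoc (i , _) (true  , _) (false , _) = refl , assoc _ _ _ , assoc _ _ _
    ∙ʷ-assoc (i , _) (false , _) (true  , _) = refl , assoc _ _ _ , assoc _ _ _
    ∙ʷ-assoc (i , _) (true  , _) (true  , _) = not-not i , assoc _ _ _ , assoc _ _ _

    ⁻¹ʷ-cong : ∀ {x y} → x ≈ʷ y → x ⁻¹ʷ ≈ʷ y ⁻¹ʷ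
    ⁻¹ʷ-cong {false , _} (refl , q , r) = refl , ⁻¹-cong q , ⁻¹-cong r
    ⁻¹ʷ-cong {true  , _} (refl , q , r) = refl , ⁻¹-cong r , ⁻¹-cong q

    εʷ : Elt
    εʷ = false , ε , ε

    inverseʷˡ : ∀ x → (x ⁻¹ʷ) ∙ʷ x ≈ʷ εʷ
    inverseʷˡ (false , x , y) = refl , inverseˡ x , inverseˡ y
    inverseʷˡ (true  , x , y) = refl , inverseˡ x , inverseˡ y

    inverseʷʳ : ∀ x → x ∙ʷ (x ⁻¹ʷ) ≈ʷ εʷ
    inverseʷʳ (false , x , y) = refl , inverseʳ x , inverseʳ y
    inverseʷʳ (true  , x , y) = refl , inverseʳ y , inverseʳ x

    identityʷˡ : ∀ x → εʷ ∙ʷ x ≈ʷ x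
    identityʷˡ (false , x , y) = refl , identityˡ x , identityˡ y
    identityʷˡ (true  , x , y) = refl , identityˡ x , identityˡ y

  wreath : Group 0ℓ 0ℓ
  wreath = record
    { Carrier = Elt ; _≈_ = _≈ʷ_ ; _∙_ = _∙ʷ_ ; ε = εʷ ; _⁻¹ = _⁻¹ʷ
    ; isGroup = record
      { isMonoid = record
        { isSemigroup = record
          { isMagma = record { isEquivalence = ≈ʷ-isEquivalence ; ∙-cong = λ {x} {y} {z} {w} → ∙ʷ-cong {x} {y} {z} {w} }
          ; assoc = ∙ʷ-assoc }
        ; identity = identityʷˡ , λ (_ , x , y) → refl , identityʳ x , identityʳ y }
      ; inverse = inverseʷˡ , inverseʷʳ
      ; ⁻¹-cong = λ {x} {y} → ⁻¹ʷ-cong {x} {y} }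
    }

  wreathFinite : FiniteGroup T → FiniteGroup wreath
  wreathFinite (m , F) = finiteQuotient ≈ʷ-isEquivalence
      (λ (i , x , y) (j , x′ , y′) → (i Bool.≟ j) ×-dec ((x ≈? x′) ×-dec (y ≈? y′)))
      (decode ∘ remQuot (m * m))
      λ (i , x , y) → combine (index i) (combine (to x) (to y)) , covers i x y
    where
    open Inverse F
    open FiniteSearch F
    bit : Fin 2 → Bool
    bit zero    = false
    bit (suc _) = true
    index : Bool → Fin 2
    index false = zero
    index true  = suc zero
    bit-index : ∀ i → bit (index i) ≡ i
    bit-index false = refl
    bit-index true  = refl
    decodePair : Fin m × Fin m → Carrier × Carrier
    decodePair (p , q) = from p , from q
    decode : Fin 2 × Fin (m * m) → Elt
    decode (i , r) = bit i , decodePair (remQuot m r)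
    covers : ∀ i x y → decode (remQuot (m * m) (combine (index i) (combine (to x) (to y)))) ≈ʷ (i , x , y)
    covers i x y = subst (λ ir → decode ir ≈ʷ (i , x , y)) (sym (remQuot-combine (index i) (combine (to x) (to y))))
      ( bit-index i
      , subst (λ pq → let x′ , y′ = decodePair pq in x′ ≈ x × y′ ≈ y) (sym (remQuot-combine (to x) (to y)))
          (from∘to x , from∘to y) )

-- Examples with nonregular socle `T × T`

module WreathExample {m : ℕ} (seed : Seed m) where
  open SeedProperties seed
  open WreathProduct T

  private
    W : Group 0ℓ 0ℓ
    W = wreath

    H : Subgroup W
    H = record
      { Mem  = λ (_ , x , y) → x ≈ y × Mem ⟨u⟩ x
      ; mem? = λ (_ , x , y) → (x ≈? y) ×-dec mem? ⟨u⟩ x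
      ; resp = λ (_ , p , q) (r , s) → ≈-trans (≈-sym p) (≈-trans r q) , resp ⟨u⟩ p s
      ; ε∈   = ≈-refl , ε∈ ⟨u⟩
      ; ∙∈   = λ { {_} {false , _} (p , q) (r , s) → ∙-cong p r , ∙∈ ⟨u⟩ q s
                 ; {_} {true  , _} (p , q) (r , s) → ∙-cong (≈-sym p) r , ∙∈ ⟨u⟩ (resp ⟨u⟩ p q) s }
      ; ⁻¹∈  = λ { {false , _} (p , q) → ⁻¹-cong p , ⁻¹∈ ⟨u⟩ q
                 ; {true  , _} (p , q) → ⁻¹-cong (≈-sym p) , ⁻¹∈ ⟨u⟩ (resp ⟨u⟩ p q) }
      }

    B : Subgroup W
    B = record
      { Mem  = λ (i , _) → i ≡ false
      ; mem? = λ (i , _) → i Bool.≟ false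
      ; resp = λ (p , _) q → trans (sym p) q
      ; ε∈   = refl
      ; ∙∈   = λ { refl refl → refl }
      ; ⁻¹∈  = λ { refl → refl }
      }

    z τ g : Elt
    z = false , u , u
    τ = true , ε , ε
    g = false , a , u ∙ a

    fixed-false : ∀ x y → Mem H (((false , x , y) ∙ʷ (false , ε , ε)) ∙ʷ (false , x ⁻¹ , y ⁻¹))
    fixed-false x y = ≈-trans xx⁻¹ (≈-sym (freely₂ x y ((v₁ :∙ :ε) :∙ v₁ :⁻¹) :ε refl)) , inj₁ xx⁻¹
      where
      xx⁻¹ : (x ∙ ε) ∙ x ⁻¹ ≈ ε
      xx⁻¹ = freely₂ x y ((v₀ :∙ :ε) :∙ v₀ :⁻¹) :ε refl

    -- Conjugating `τ` by the inverse of `g` gives `τ ∙ʷ z`, because `u` is an involution. So `τ`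
    -- fixes the coset `Hg`, and only `z` moves it.
    out : ∀ {h} → Mem H h → ∃[ k ] Mem H ((g ∙ʷ k) ∙ʷ (g ⁻¹ʷ)) × (h ≈ʷ k ⊎ h ≈ʷ k ∙ʷ z)
    out {i , x , y} (x≈y , x∈) = (i , ε , ε) , fixed i , position x∈
      where
      gτg⁻¹ : ((u ∙ a) ∙ ε) ∙ a ⁻¹ ≈ u
      gτg⁻¹ = freely₂ u a (((v₀ :∙ v₁) :∙ :ε) :∙ v₁ :⁻¹) v₀ refl
      fixed : ∀ i → Mem H ((g ∙ʷ (i , ε , ε)) ∙ʷ (g ⁻¹ʷ))
      fixed false = fixed-false a (u ∙ a)
      fixed true  = ≈-trans gτg⁻¹ (≈-sym (≈-trans (freely₂ u a ((v₁ :∙ :ε) :∙ (v₀ :∙ v₁) :⁻¹) (v₀ :⁻¹) refl) u⁻¹≈u)) , inj₂ gτg⁻¹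
      position : x ≈ ε ⊎ x ≈ u → (i , x , y) ≈ʷ (i , ε , ε) ⊎ (i , x , y) ≈ʷ (i , ε ∙ u , ε ∙ u)
      position (inj₁ x≈ε) = inj₁ (refl , x≈ε , ≈-trans (≈-sym x≈y) x≈ε)
      position (inj₂ x≈u) = inj₂ (refl , x≈εu , ≈-trans (≈-sym x≈y) x≈εu)
        where x≈εu = ≈-trans x≈u (≈-sym (identityˡ u))

    -- The same relation read backwards: here `τ ∙ʷ z` fixes the coset, so it replaces `τ` as
    -- representative.
    into : ∀ {h} → Mem H h → ∃[ k ] Mem H (((g ⁻¹ʷ) ∙ʷ k) ∙ʷ (g ⁻¹ʷ ⁻¹ʷ)) × (h ≈ʷ k ⊎ h ≈ʷ k ∙ʷ z)
    into {false , x , y} (x≈y , x∈) = (false , ε , ε) , fixed-false (a ⁻¹) ((u ∙ a) ⁻¹) , position x∈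
      where
      position : x ≈ ε ⊎ x ≈ u → (false , x , y) ≈ʷ (false , ε , ε) ⊎ (false , x , y) ≈ʷ (false , ε ∙ u , ε ∙ u)
      position (inj₁ x≈ε) = inj₁ (refl , x≈ε , ≈-trans (≈-sym x≈y) x≈ε)
      position (inj₂ x≈u) = inj₂ (refl , x≈εu , ≈-trans (≈-sym x≈y) x≈εu)
        where x≈εu = ≈-trans x≈u (≈-sym (identityˡ u))
    into {true , x , y} (x≈y , x∈) = (true , u , u) , (≈-trans e₁ (≈-sym e₂) , inj₁ e₁) , position x∈
      where
      e₁ : ((u ∙ a) ⁻¹ ∙ u) ∙ a ⁻¹ ⁻¹ ≈ ε
      e₁ = freely₂ u a (((v₀ :∙ v₁) :⁻¹ :∙ v₀) :∙ v₁ :⁻¹ :⁻¹) :ε refl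
      e₂ : (a ⁻¹ ∙ u) ∙ (u ∙ a) ⁻¹ ⁻¹ ≈ ε
      e₂ = ≈-trans (freely₂ u a ((v₁ :⁻¹ :∙ v₀) :∙ (v₀ :∙ v₁) :⁻¹ :⁻¹) ((v₁ :⁻¹ :∙ (v₀ :∙ v₀)) :∙ v₁) refl)
        (≈-trans (∙-congʳ (∙-congˡ u²≈ε)) (freely₂ a a (v₀ :⁻¹ :∙ :ε :∙ v₀) :ε refl))
      position : x ≈ ε ⊎ x ≈ u → (true , x , y) ≈ʷ (true , u , u) ⊎ (true , x , y) ≈ʷ (true , u ∙ u , u ∙ u)
      position (inj₁ x≈ε) = inj₂ (refl , x≈uu , ≈-trans (≈-sym x≈y) x≈uu)
        where x≈uu = ≈-trans x≈ε (≈-sym u²≈ε)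
      position (inj₂ x≈u) = inj₁ (refl , x≈u , ≈-trans (≈-sym x≈y) x≈u)

    -- The first coordinate of the product is `a x a`, or `u a x a` if `h` swaps; either case falls
    -- back on the condition in `T`.
    not-reversedʷ : ∀ {h} → Mem H h → ¬ Mem H ((g ∙ʷ h) ∙ʷ g)
    not-reversedʷ {false , x , y} (_ , x∈) (_ , r) = not-reversed x∈ r
    not-reversedʷ {true  , x , y} (_ , x∈) (_ , r) = not-reversed x∈
      (resp ⟨u⟩ (freely₃ u a x (v₀ :⁻¹ :∙ ((v₀ :∙ v₁) :∙ v₂ :∙ v₁)) ((v₁ :∙ v₂) :∙ v₁) refl) (∙∈ ⟨u⟩ (inj₂ u⁻¹≈u) r))

    firstFactor : Subgroup W → Subgroup T
    firstFactor K = record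
      { Mem  = λ s → Mem K (false , s , ε)
      ; mem? = λ s → mem? K (false , s , ε)
      ; resp = λ eq → resp K (refl , eq , ≈-refl)
      ; ε∈   = ε∈ K
      ; ∙∈   = λ p q → resp K (refl , ≈-refl , identityˡ ε) (∙∈ K p q)
      ; ⁻¹∈  = λ p → resp K (refl , ≈-refl , ε⁻¹≈ε) (⁻¹∈ K p)
      }

    firstProjection : Subgroup W → Subgroup T
    firstProjection K = record
      { Mem  = λ s → ∃[ t ] Mem K (false , s , t)
      ; mem? = λ s → ∃? (λ eq → resp K (refl , ≈-refl , eq)) (λ t → mem? K (false , s , t))
      ; resp = λ eq (t , p) → t , resp K (refl , eq , ≈-refl) p
      ; ε∈   = ε , ε∈ K
      ; ∙∈   = λ (t , p) (s , q) → t ∙ s , ∙∈ K p q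
      ; ⁻¹∈  = λ (t , p) → t ⁻¹ , ⁻¹∈ K p
      }

    swapped : ∀ (K : Subgroup W) {s t} → Mem K ((τ ∙ʷ (false , s , t)) ∙ʷ τ) → Mem K (false , t , s)
    swapped K {s} {t} = resp K (refl , freely₂ s t ((:ε :∙ v₁) :∙ :ε) v₁ refl , freely₂ s t ((:ε :∙ v₀) :∙ :ε) v₀ refl)

    B⊆ : ∀ (K : Subgroup W) → (∀ s → Mem K (false , s , ε)) → (∀ s → Mem K (false , ε , s)) → ∀ {x} → Mem B x → Mem K x
    B⊆ K first second {_ , s , t} refl =
      resp K (refl , identityʳ s , identityˡ t) (∙∈ K (first s) (second t))

    -- Goursat: a subgroup containing H and g projects onto T, so that it
    -- meets the first factor in 1 or in T; in the first case it is the graph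
    -- of an automorphism.
    generate : ∀ (K : Subgroup W) → (∀ {h} → Mem H h → Mem K h) → Mem K g → ∀ w → Mem K w
    generate K H⊆K g∈K = everything (T-simple (firstFactor K) firstFactor-normal)
      where
      τ∈K : Mem K τ
      τ∈K = H⊆K (≈-refl , inj₁ ≈-refl)

      z∈K : Mem K z
      z∈K = H⊆K (≈-refl , inj₂ ≈-refl)

      swap∈ : ∀ {s t} → Mem K (false , s , t) → Mem K (false , t , s)
      swap∈ p = swapped K (∙∈ K {τ ∙ʷ (false , _ , _)} {τ} (∙∈ K {τ} {false , _ , _} τ∈K p) τ∈K)

      onto : ∀ s → ∃[ t ] Mem K (false , s , t)
      onto = generates (firstProjection K) (u , z∈K) (u ∙ a , g∈K)

      firstFactor-normal : firstFactor K ⊴ whole T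
      firstFactor-normal = (λ _ → tt) , λ {r} {s} _ p → let t , q = onto r in
        resp K (refl , ≈-refl , freely₂ t t (v₀ :⁻¹ :∙ :ε :∙ v₀) :ε refl) (∙∈ K (∙∈ K (⁻¹∈ K q) p) q)

      everything : (∀ {s} → Mem K (false , s , ε) → s ≈ ε) ⊎ (∀ s → Mem K (false , s , ε)) → ∀ w → Mem K w
      everything (inj₂ all) (false , s , t) = B⊆ K all (swap∈ ∘ all) {false , s , t} refl
      everything (inj₂ all) (true  , s , t) = resp K (refl , identityˡ s , identityˡ t)
        (∙∈ K τ∈K (B⊆ K all (swap∈ ∘ all) {false , s , t} refl))
      -- `α` fixes `u` because `z` lies in `K`, and takes `a` to `u ∙ a` because `g` does.
      everything (inj₁ trivial) = contradiction
        (functional u∈α z∈K ≈-refl)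
        (λ αu≈u → noAut {α} α-iso αu≈u (functional (proj₂ (onto a)) g∈K ≈-refl))
        where
        α : Carrier → Carrier
        α s = proj₁ (onto s)
        u∈α : Mem K (false , u , α u)
        u∈α = proj₂ (onto u)
        injective : ∀ {s t s′ t′} → Mem K (false , s , t) → Mem K (false , s′ , t′) → t ≈ t′ → s ≈ s′
        injective {s} {t} {s′} {t′} p q eq = x∙y⁻¹≈ε⇒x≈y s s′ (trivial
          (resp K (refl , ≈-refl , x≈y⇒x∙y⁻¹≈ε eq) (∙∈ K p (⁻¹∈ K q))))
        functional : ∀ {s t s′ t′} → Mem K (false , s , t) → Mem K (false , s′ , t′) → s ≈ s′ → t ≈ t′
        functional p q = injective (swap∈ p) (swap∈ q)
        α-iso : IsIsomorphism T T α
        α-iso = isIsomorphism T T α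
          (λ {x} {y} eq → functional (proj₂ (onto x)) (proj₂ (onto y)) eq)
          (λ x y → functional (proj₂ (onto (x ∙ y))) (∙∈ K (proj₂ (onto x)) (proj₂ (onto y))) ≈-refl)
          (λ {x} {y} eq → injective (proj₂ (onto x)) (proj₂ (onto y)) eq)
          (λ y → let t , p = onto y in t , functional (proj₂ (onto t)) (swap∈ p) ≈-refl)

    center : Subgroup T
    center = record
      { Mem  = λ x → ∀ y → x ∙ y ≈ y ∙ x
      ; mem? = λ x → map′
          (λ none y → decidable-stable (x ∙ y ≈? y ∙ x) (λ ≉ → none (y , ≉)))
          (λ all (y , ≉) → ≉ (all y))
          (¬? (∃? (λ {y} {y′} eq ≉ p → ≉ (≈-trans (∙-congˡ eq) (≈-trans p (∙-congʳ (≈-sym eq))))) (λ y → ¬? (x ∙ y ≈? y ∙ x))))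
      ; resp = λ eq p y → ≈-trans (∙-congʳ (≈-sym eq)) (≈-trans (p y) (∙-congˡ eq))
      ; ε∈   = λ y → ≈-trans (identityˡ y) (≈-sym (identityʳ y))
      ; ∙∈   = λ {x} {x′} p q y → ≈-trans (assoc x x′ y) (≈-trans (∙-congˡ (q y))
          (≈-trans (≈-sym (assoc x y x′)) (≈-trans (∙-congʳ (p y)) (assoc y x x′))))
      ; ⁻¹∈  = λ {x} p y → ≈-trans (freely₂ x y (v₀ :⁻¹ :∙ v₁) (v₀ :⁻¹ :∙ (v₁ :∙ v₀) :∙ v₀ :⁻¹) refl)
          (≈-trans (∙-congʳ (∙-congˡ (≈-sym (p y)))) (freely₂ x y (v₀ :⁻¹ :∙ (v₀ :∙ v₁) :∙ v₀ :⁻¹) (v₁ :∙ v₀ :⁻¹) refl))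
      }

    center-trivial : ∀ {x} → (∀ y → x ∙ y ≈ y ∙ x) → x ≈ ε
    center-trivial {x} central = [ (λ trivial → trivial central) , (λ all → contradiction (λ x y → all x y) (proj₁ (proj₂ nonabelianSimple))) ]′
      (T-simple center ((λ _ → tt) , λ {h} {x} _ p → resp center
        (≈-sym (≈-trans (∙-congʳ (≈-sym (p (h ⁻¹)))) (freely₂ h x (v₁ :∙ v₀ :⁻¹ :∙ v₀) v₁ refl))) p))

    B-normal : B ⊴ whole W
    B-normal = (λ _ → tt) , λ { {false , _} _ refl → refl ; {true , _} _ refl → refl }

    -- Suppose that `M` meets the first factor trivially. Commutators with elements of that factor
    -- show that the elements of `M` in `B` have central, hence trivial, coordinates. An element of
    -- `M` outside `B` has a commutator with `(u , ε)` that lies in `B` and has first coordinate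
    -- `u`, which is impossible.
    B-least : ∀ (M : Subgroup W) → M ⊴ whole W → Nontrivial M → ∀ {x} → Mem B x → Mem M x
    B-least M (_ , M-conj) nt = by-firstFactor (T-simple (firstFactor M) firstFactor-normal)
      where
      swap∈ : ∀ {s t} → Mem M (false , s , t) → Mem M (false , t , s)
      swap∈ {s} {t} p = resp M (refl , freely₂ s t ((ε⁻¹ :∙ v₁) :∙ :ε) v₁ refl , freely₂ s t ((ε⁻¹ :∙ v₀) :∙ :ε) v₀ refl)
        (M-conj {τ} tt p)
        where
        ε⁻¹ : Term 2
        ε⁻¹ = :ε :⁻¹

      firstFactor-normal : firstFactor M ⊴ whole T
      firstFactor-normal = (λ _ → tt) , λ {r} {s} _ p →
        resp M (refl , ≈-refl , freely₂ r r (:ε :⁻¹ :∙ :ε :∙ :ε) :ε refl) (M-conj {false , r , ε} tt p)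

      by-firstFactor : (∀ {s} → Mem M (false , s , ε) → s ≈ ε) ⊎ (∀ s → Mem M (false , s , ε)) → ∀ {x} → Mem B x → Mem M x
      by-firstFactor (inj₂ all)     {x} = B⊆ M all (swap∈ ∘ all) {x}
      by-firstFactor (inj₁ trivial) {x} = contradiction nt M-trivial
        where
        -- Taking the commutator with (r , 1).
        central : ∀ {s t} → Mem M (false , s , t) → ∀ r → s ∙ r ≈ r ∙ s
        central {s} {t} p r = ≈-trans (freely₂ s r (v₀ :∙ v₁) (v₁ :∙ v₀ :∙ (v₀ :⁻¹ :∙ ((v₁ :⁻¹ :∙ v₀) :∙ v₁))) refl)
          (≈-trans (∙-congˡ (trivial (resp M (refl , ≈-refl , freely₂ t t (v₀ :⁻¹ :∙ ((:ε :⁻¹ :∙ v₀) :∙ :ε)) :ε refl)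
            (∙∈ M (⁻¹∈ M p) (M-conj {false , r , ε} tt p))))) (identityʳ _))
        B-part : ∀ {s t} → Mem M (false , s , t) → s ≈ ε × t ≈ ε
        B-part p = center-trivial (central p) , center-trivial (central (swap∈ p))
        M-trivial : ¬ Nontrivial M
        M-trivial ((false , s , t) , p , ≉) = let s≈ε , t≈ε = B-part p in ≉ (refl , s≈ε , t≈ε)
        M-trivial ((true  , s , t) , p , ≉) = u≉ε (≈-trans
          (freely₂ s u v₁ (v₀ :⁻¹ :∙ ((:ε :⁻¹ :∙ v₀) :∙ v₁)) refl)
          (proj₁ (B-part (∙∈ M (⁻¹∈ M p) (M-conj {false , u , ε} tt p)))))

  cosetGraphData : CosetGraphData W
  cosetGraphData = record
    { finite        = wreathFinite T-finite
    ; H             = H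
    ; B             = B
    ; g             = g
    ; h₀            = z
    ; h₀∈H          = ≈-refl , inj₂ ≈-refl
    ; generate      = generate
    ; out           = λ {h} → out {h}
    ; out-distinct  = λ (_ , p) → out-distinct p
    ; into          = λ {h} → into {h}
    ; into-distinct = λ (_ , p) → into-distinct p
    ; not-reversed  = λ {h} → not-reversedʷ {h}
    ; B-normal      = B-normal
    ; B-least       = B-least
    ; B-complement  = λ { (false , _) → (false , ε , ε) , (≈-refl , inj₁ ≈-refl) , refl
                        ; (true  , _) → (true  , ε , ε) , (≈-refl , inj₁ ≈-refl) , refl }
    ; b₀            = g
    ; b₀∈B          = refl
    ; b₀∉H          = λ (a≈ua , _) → u≉ε (identityˡ-unique u a (≈-sym a≈ua))
    }

  B-isPower : subgroup→group B ≅ power T 2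
  B-isPower = f , isIsomorphism (subgroup→group B) (power T 2) f
      (λ (_ , p , q) → λ { zero → p ; (suc _) → q })
      (λ { (_ , refl) (_ , refl) zero → ≈-refl ; (_ , refl) (_ , refl) (suc _) → ≈-refl })
      (λ { {_ , refl} {_ , refl} eq → refl , eq zero , eq (suc zero) })
      (λ y → ((false , y zero , y (suc zero)) , refl) , λ { zero → ≈-refl ; (suc zero) → ≈-refl })
    where
    f : ∃ (Mem B) → Fin 2 → Carrier
    f ((_ , x , y) , _) zero    = x
    f ((_ , x , y) , _) (suc _) = y

  example : Σ[ n ∈ ℕ ] m ≤ n × (Σ[ Γ ∈ Graph n ] Σ[ G ∈ PermGroup n ] NonregularSquareExample Γ G)
  example = CosetGraphExamples.nonregularSquareExample cosetGraphData (λ i → false , c i , ε)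
    (λ i j (_ , p) → c-separate i j p) T nonabelianSimple B-isPower z refl (≈-refl , inj₂ ≈-refl) (λ (_ , u≈ε , _) → u≉ε u≈ε)

-- Identities between transpositions

transpose-involutive : ∀ {n} (i j k : Fin n) → k · transpose i j · transpose i j ≡ k
transpose-involutive i j k = trans (cong (_· transpose i j) (transpose-sym i j k)) (Perm.inverseʳ (transpose i j))

allPairs⇒transitive : ∀ {n} → 3 < n → (K : PermGroup n) → AllPairs K → Transitive K
allPairs⇒transitive 3<n K pairs i j with i ≟ j
... | yes i≡j = Perm.id , ε∈ K , i≡j
... | no i≢j
  with fresh (i ∷ j ∷ []) (ℕₚ.<-trans (ℕₚ.n<1+n 2) 3<n)
... | k , _ ∷ k≢j ∷ []
  with fresh (k ∷ i ∷ j ∷ []) 3<n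
... | l , l≢k ∷ _ ∷ l≢j ∷ [] = pair i j k l , pairs i j k l i≢j (l≢k ∘ sym) ,
  trans (cong (_· transpose k l) (transpose-left i j)) (transpose-other (k≢j ∘ sym) (l≢j ∘ sym))

transpose-sandwich : ∀ {n} {i j k l : Fin n} x → k · transpose i j ≡ k → l · transpose i j ≡ l →
                     x · transpose i j · transpose k l · transpose i j ≡ x · transpose k l
transpose-sandwich {i = i} {j} {k} {l} x kσ lσ = trans (cong (λ y → y · transpose k l · transpose i j) (transpose-sym i j x))
  (trans (transpose-conj (transpose i j) k l x) (cong₂ (λ k l → x · transpose k l) kσ lσ))

pair-commutes : ∀ {n} (σ : Permutation′ n) {i j k l} → i · σ ≡ i → j · σ ≡ j → k · σ ≡ k → l · σ ≡ l →
                ∀ x → x · σ · pair i j k l ≡ x · pair i j k l · σ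
pair-commutes σ {i} {j} {k} {l} iσ jσ kσ lσ x = sym (trans (cong (λ y → y · pair i j k l · σ) (sym (Perm.inverseˡ σ)))
  (trans (pair-conj σ i j k l (x · σ))
    (trans (cong₂ (λ i j → x · σ · pair i j (k · σ) (l · σ)) iσ jσ) (cong₂ (λ k l → x · σ · pair i j k l) kσ lσ))))

-- A generating pair of the alternating group of degree 11 + e

module GeneratingPair (e : ℕ) where

  Points : Set
  Points = Fin (11 + e)

  u a : Permutation′ (11 + e)
  u = pair 0F 1F 2F 3F
  a = cycle (10 + e)

  module _ (K : PermGroup (11 + e)) (u∈K : Mem K u) (a∈K : Mem K a) where

    private
      conj-pair : ∀ σ {i j k l i′ j′ k′ l′} → Mem K σ → i · σ ≡ i′ → j · σ ≡ j′ → k · σ ≡ k′ → l · σ ≡ l′ →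
                  Mem K (pair i j k l) → Mem K (pair i′ j′ k′ l′)
      conj-pair σ {i} {j} {k} {l} σ∈K refl refl refl refl p =
        resp K {(flip σ ∘ₚ pair i j k l) ∘ₚ σ} {pair (i · σ) (j · σ) (k · σ) (l · σ)} (pair-conj σ i j k l)
          (∙∈ K {flip σ ∘ₚ pair i j k l} {σ} (∙∈ K {flip σ} {pair i j k l} (⁻¹∈ K {σ} σ∈K) p) σ∈K)

      raise : ∀ i j k l → Mem K (pair (inject₁ i) (inject₁ j) (inject₁ k) (inject₁ l)) →
              Mem K (pair (suc i) (suc j) (suc k) (suc l))
      raise i j k l = conj-pair (flip a) (⁻¹∈ K {a} a∈K) (·-flip a (cycle-suc _ i)) (·-flip a (cycle-suc _ j))
                                (·-flip a (cycle-suc _ k)) (·-flip a (cycle-suc _ l))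

      lower : ∀ i j k l → Mem K (pair (suc i) (suc j) (suc k) (suc l)) →
              Mem K (pair (inject₁ i) (inject₁ j) (inject₁ k) (inject₁ l))
      lower i j k l = conj-pair a a∈K (cycle-suc _ i) (cycle-suc _ j) (cycle-suc _ k) (cycle-suc _ l)

      u₃∈K : Mem K (pair 3F 4F 5F 6F)
      u₃∈K = raise 2F 3F 4F 5F (raise 1F 2F 3F 4F (raise 0F 1F 2F 3F u∈K))

      -- The supports of u and of its conjugate by a⁻³ have just one point in
      -- common, which makes u times its conjugate by (3 4)(5 6) a 3-cycle.
      324∈K : Mem K (pair 2F 3F 2F 4F)
      324∈K = resp K {u ∘ₚ pair 0F 1F 2F 4F} {pair 2F 3F 2F 4F}
        (λ x → cong (_· transpose 2F 4F) (transpose-sandwich {i = 0F} {j = 1F} {k = 2F} {l = 3F} x refl refl))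
        (∙∈ K {u} {pair 0F 1F 2F 4F} u∈K (conj-pair (pair 3F 4F 5F 6F) {0F} {1F} {2F} {3F} u₃∈K refl refl refl refl u∈K))

      234∈K : Mem K (threeCycle 2F 3F 4F)
      234∈K = resp K {threeCycle 4F 2F 3F} {threeCycle 2F 3F 4F} (threeCycle-rotate (λ ()) (λ ()))
        (resp K {flip (pair 2F 3F 2F 4F)} {threeCycle 4F 2F 3F}
          (λ x → transpose-sym 3F 2F (x · transpose 4F 2F)) (⁻¹∈ K {pair 2F 3F 2F 4F} 324∈K))

      consecutive : ∀ (i : Fin (9 + e)) → Mem K (threeCycle (inject₁ (inject₁ i)) (inject₁ (suc i)) (suc (suc i)))
      consecutive = <-weakInduction (λ i → Mem K (threeCycle (inject₁ (inject₁ i)) (inject₁ (suc i)) (suc (suc i))))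
        -- The 3-cycle on 2, 3, 4 is moved down to 0, 1, 2, where the induction starts.
        (lower 0F 1F 1F 2F (lower 1F 2F 2F 3F 234∈K))
        (λ i → raise (inject₁ (inject₁ i)) (inject₁ (suc i)) (inject₁ (suc i)) (suc (suc i)))

      s : Fin (10 + e) → Permutation′ (11 + e)
      s i = transpose (inject₁ i) (suc i)

      -- Consecutive 3-cycles are products of adjacent transpositions, so the products telescope.
      s₀s∈K : ∀ i → Mem K (s 0F ∘ₚ s i)
      s₀s∈K = <-weakInduction (λ i → Mem K (s 0F ∘ₚ s i))
        (resp K {Perm.id} {s 0F ∘ₚ s 0F} (λ x → sym (transpose-involutive 0F 1F x)) (ε∈ K))
        (λ i p → resp K {(s 0F ∘ₚ s (inject₁ i)) ∘ₚ (s (inject₁ i) ∘ₚ s (suc i))} {s 0F ∘ₚ s (suc i)}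
          (λ x → cong (_· s (suc i)) (transpose-involutive (inject₁ (inject₁ i)) (suc (inject₁ i)) (x · s 0F)))
          (∙∈ K {s 0F ∘ₚ s (inject₁ i)} {s (inject₁ i) ∘ₚ s (suc i)} p (consecutive i)))

      reversed : ∀ i j k l → Mem K (pair i j k l) → Mem K (pair k l i j)
      reversed i j k l p = resp K {flip (pair i j k l)} {pair k l i j}
        (λ x → trans (cong (_· transpose j i) (transpose-sym l k x)) (transpose-sym j i (x · transpose k l))) (⁻¹∈ K {pair i j k l} p)

      -- The transposition (i j) lies in the coset of (0 1) modulo `K`; this takes the place of a
      -- sign.
      Odd : Points → Points → Set
      Odd i j = Mem K (pair i j 0F 1F)

      -- The two inner copies of (0 1) cancel, leaving a conjugate of (k l) times (0 1). Conjugation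
      -- by adjacent transpositions then reaches every (0 j), and conjugation by these every (i j).
      odd-conj : ∀ i j k l → Odd i j → Odd k l → Odd (k · transpose i j) (l · transpose i j)
      odd-conj i j k l p q = resp K
        {pair i j 0F 1F ∘ₚ pair 0F 1F k l ∘ₚ pair i j 0F 1F} {pair (k · transpose i j) (l · transpose i j) 0F 1F}
        (λ x → cong (_· transpose 0F 1F) (trans (cong (λ y → y · transpose k l · transpose i j)
            (trans (transpose-involutive 0F 1F (x · transpose i j)) (transpose-sym i j x)))
          (transpose-conj (transpose i j) k l x)))
        (∙∈ K {pair i j 0F 1F} {pair 0F 1F k l ∘ₚ pair i j 0F 1F} p
          (∙∈ K {pair 0F 1F k l} {pair i j 0F 1F} (reversed k l 0F 1F q) p))

      odd-zero : ∀ j → Odd 0F (suc j)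
      odd-zero = <-weakInduction (λ j → Odd 0F (suc j)) (s₀s∈K 0F)
        (λ i p → subst₂ Odd (transpose-other {i = inject₁ (suc i)} {j = suc (suc i)} (λ ()) (λ ()))
          (transpose-left (inject₁ (suc i)) (suc (suc i)))
          (odd-conj (inject₁ (suc i)) (suc (suc i)) 0F (suc (inject₁ i)) (reversed 0F 1F _ _ (s₀s∈K (suc i))) p))

      odd : ∀ i j → i ≢ j → Odd i j
      odd zero    zero    0≢0 = contradiction refl 0≢0
      odd zero    (suc j) _   = odd-zero j
      odd (suc i) zero    _   = resp K {pair 0F (suc i) 0F 1F} {pair (suc i) 0F 0F 1F}
        (λ x → cong (_· transpose 0F 1F) (transpose-sym 0F (suc i) x)) (odd-zero i)
      odd (suc i) (suc j) i≢j = subst₂ Odd (transpose-left 0F (suc i))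
        (transpose-other {i = 0F} {j = suc i} {k = suc j} (λ ()) (i≢j ∘ sym))
        (odd-conj 0F (suc i) 0F (suc j) (odd-zero i) (odd-zero j))

    generates-allPairs : AllPairs K
    generates-allPairs i j k l i≢j k≢l = resp K {pair i j 0F 1F ∘ₚ pair 0F 1F k l} {pair i j k l}
      (λ x → cong (_· transpose k l) (transpose-involutive 0F 1F (x · transpose i j)))
      (∙∈ K {pair i j 0F 1F} {pair 0F 1F k l} (odd i j i≢j) (reversed k l 0F 1F (odd k l k≢l)))

-- The relation that tells a from u a is that u commutes with farConjugate u a.
module _ (T : Group 0ℓ 0ℓ) where
  open Group T hiding (setoid) renaming (refl to ≈-refl; sym to ≈-sym; trans to ≈-trans)

  -- The support of `u` will be four consecutive points and `a` a shift by one, so four is the least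
  -- power that carries this support off itself.
  fourth : Carrier → Carrier
  fourth x = x ∙ (x ∙ (x ∙ x))

  farConjugate : Carrier → Carrier → Carrier
  farConjugate u x = (fourth x ∙ u) ∙ fourth x ⁻¹

  commute-transfer : ∀ {α u a b} → IsIsomorphism T T α → α u ≈ u → α a ≈ b →
                     u ∙ farConjugate u a ≈ farConjugate u a ∙ u → u ∙ farConjugate u b ≈ farConjugate u b ∙ u
  commute-transfer {α} {u} {a} {b} iso αu αa comm = ≈-trans (≈-sym (≈-trans (∙-homo u (farConjugate u a)) (∙-cong αu α-far)))
    (≈-trans (⟦⟧-cong comm) (≈-trans (∙-homo (farConjugate u a) u) (∙-cong α-far αu)))
    where
    open GroupMorphisms.IsGroupIsomorphism iso
    α-fourth : α (fourth a) ≈ fourth b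
    α-fourth = ≈-trans (∙-homo _ _) (∙-cong αa (≈-trans (∙-homo _ _) (∙-cong αa (≈-trans (∙-homo _ _) (∙-cong αa αa)))))
    α-far : α (farConjugate u a) ≈ farConjugate u b
    α-far = ≈-trans (∙-homo _ _) (∙-cong (≈-trans (∙-homo _ _) (∙-cong α-fourth αu)) (≈-trans (⁻¹-homo _) (⁻¹-cong α-fourth)))

module _ {n : ℕ} (u g : Permutation′ n) where

  fourth-orbit : ∀ {x₀ x₁ x₂ x₃ x₄} → x₀ · g ≡ x₁ → x₁ · g ≡ x₂ → x₂ · g ≡ x₃ → x₃ · g ≡ x₄ → x₀ · fourth (Sym n) g ≡ x₄
  fourth-orbit refl refl refl refl = refl

  farConjugate-pair : ∀ {i j k l i′ j′ k′ l′} → (∀ x → x · u ≡ x · pair i j k l) →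
    i′ · fourth (Sym n) g ≡ i → j′ · fourth (Sym n) g ≡ j → k′ · fourth (Sym n) g ≡ k → l′ · fourth (Sym n) g ≡ l →
    ∀ x → x · farConjugate (Sym n) u g ≡ x · pair i′ j′ k′ l′
  farConjugate-pair {i} {j} {k} {l} {i′} {j′} u≡ refl refl refl refl x = trans (cong (_· flip g⁴) (u≡ (x · g⁴)))
    (trans (pair-conj (flip g⁴) i j k l x)
      (trans (cong₂ (λ i j → x · pair i j (k · flip g⁴) (l · flip g⁴)) (·-flip g⁴ refl) (·-flip g⁴ refl))
             (cong₂ (λ k l → x · pair i′ j′ k l) (·-flip g⁴ refl) (·-flip g⁴ refl))))
    where
    g⁴ : Permutation′ n
    g⁴ = fourth (Sym n) g

  -- The conjugate takes `z₀`, a fixed point of `u`, to `o`. If it commuted with `u`, then `o` would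
  -- be fixed by `u` as well.
  farConjugate-noncommuting : ∀ z₀ z₁ z₂ z₃ z₄ o → z₀ · u ≡ z₀ →
    z₀ · g ≡ z₁ → z₁ · g ≡ z₂ → z₂ · g ≡ z₃ → z₃ · g ≡ z₄ → z₄ · u ≡ o → o · g ≡ o → o · u ≢ o →
    ¬ (∀ x → x · u · farConjugate (Sym n) u g ≡ x · farConjugate (Sym n) u g · u)
  farConjugate-noncommuting z₀ z₁ z₂ z₃ z₄ o z₀u z₀g z₁g z₂g z₃g z₄u og ou≢o comm =
    ou≢o (trans (sym (cong (_· u) z-far)) (trans (sym (comm z₀))
      (trans (cong (_· farConjugate (Sym n) u g) z₀u) z-far)))
    where
    z-far : z₀ · farConjugate (Sym n) u g ≡ o
    z-far = ·-flip (fourth (Sym n) g) (trans (fourth-orbit og og og og)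
      (sym (trans (cong (_· u) (fourth-orbit z₀g z₁g z₂g z₃g)) z₄u)))

-- The computations in K only involve the eight points p i.
module SeedFromPermutations {n m : ℕ} (K : PermGroup n) (u a : Permutation′ n) (u∈K : Mem K u) (a∈K : Mem K a)
  (p : Fin 8 → Fin n) (p-injective : ∀ {i j} → p i ≡ p j → i ≡ j) (p↓ : ∀ i → p (suc i) · a ≡ p (inject₁ i))
  (u≡ : ∀ x → x · u ≡ x · pair (p 0F) (p 1F) (p 2F) (p 3F)) where

  private
    T : Group 0ℓ 0ℓ
    T = subgroup→group K
    uT aT : Group.Carrier T
    uT = u , u∈K
    aT = a , a∈K

    distinct : ∀ {i j} → i ≢ j → p i ≢ p j
    distinct i≢j eq = i≢j (p-injective eq)

    u-fixes : ∀ i → i ≢ 0F → i ≢ 1F → i ≢ 2F → i ≢ 3F → p i · u ≡ p i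
    u-fixes i i≢0 i≢1 i≢2 i≢3 = trans (u≡ (p i)) (trans
      (cong (_· transpose (p 2F) (p 3F)) (transpose-other (distinct i≢0) (distinct i≢1)))
      (transpose-other (distinct i≢2) (distinct i≢3)))

    0·u : p 0F · u ≡ p 1F
    0·u = trans (u≡ (p 0F)) (trans (cong (_· transpose (p 2F) (p 3F)) (transpose-left (p 0F) (p 1F)))
      (transpose-other (distinct λ ()) (distinct λ ())))

    1·u : p 1F · u ≡ p 0F
    1·u = trans (u≡ (p 1F)) (trans (cong (_· transpose (p 2F) (p 3F)) (transpose-right (p 0F) (p 1F)))
      (transpose-other (distinct λ ()) (distinct λ ())))

    3·u : p 3F · u ≡ p 2F
    3·u = trans (u≡ (p 3F)) (trans (cong (_· transpose (p 2F) (p 3F)) (transpose-other (distinct λ ()) (distinct λ ())))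
      (transpose-right (p 2F) (p 3F)))

    4·u : p 4F · u ≡ p 4F
    4·u = u-fixes 4F (λ ()) (λ ()) (λ ()) (λ ())
    5·u : p 5F · u ≡ p 5F
    5·u = u-fixes 5F (λ ()) (λ ()) (λ ()) (λ ())
    6·u : p 6F · u ≡ p 6F
    6·u = u-fixes 6F (λ ()) (λ ()) (λ ()) (λ ())
    7·u : p 7F · u ≡ p 7F
    7·u = u-fixes 7F (λ ()) (λ ()) (λ ()) (λ ())

    u² : ∀ x → x · u · u ≡ x
    u² x = trans (cong (_· u) (u≡ x)) (trans (u≡ (x · pair (p 0F) (p 1F) (p 2F) (p 3F)))
      (trans (cong (_· transpose (p 2F) (p 3F)) (transpose-sandwich x
          (transpose-other (distinct λ ()) (distinct λ ())) (transpose-other (distinct λ ()) (distinct λ ()))))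
        (transpose-involutive (p 2F) (p 3F) x)))

    ua≢au : p 4F · u · a ≢ p 4F · a · u
    ua≢au eq = distinct {3F} {2F} (λ ()) (trans (sym (trans (cong (_· a) 4·u) (p↓ 3F)))
      (trans eq (trans (cong (_· u) (p↓ 3F)) 3·u)))

    far-commutes : ∀ x → x · u · farConjugate (Sym n) u a ≡ x · farConjugate (Sym n) u a · u
    far-commutes x = trans (far (x · u)) (trans (pair-commutes u 4·u 5·u 6·u 7·u x) (cong (_· u) (sym (far x))))
      where
      far : ∀ x → x · farConjugate (Sym n) u a ≡ x · pair (p 4F) (p 5F) (p 6F) (p 7F)
      far = farConjugate-pair u a u≡
        (fourth-orbit u a (p↓ 3F) (p↓ 2F) (p↓ 1F) (p↓ 0F)) (fourth-orbit u a (p↓ 4F) (p↓ 3F) (p↓ 2F) (p↓ 1F))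
        (fourth-orbit u a (p↓ 5F) (p↓ 4F) (p↓ 3F) (p↓ 2F)) (fourth-orbit u a (p↓ 6F) (p↓ 5F) (p↓ 4F) (p↓ 3F))

    far-noncommuting : ¬ (∀ x → x · u · farConjugate (Sym n) u (u ∘ₚ a) ≡ x · farConjugate (Sym n) u (u ∘ₚ a) · u)
    -- Under `u ∘ₚ a` the points move as 6, 5, 4, 3, 1, while 0 is fixed because `u` takes it to 1
    -- and `a` takes it back.
    far-noncommuting = farConjugate-noncommuting u (u ∘ₚ a) (p 6F) (p 5F) (p 4F) (p 3F) (p 1F) (p 0F) 6·u
      (step 6·u (p↓ 5F)) (step 5·u (p↓ 4F)) (step 4·u (p↓ 3F)) (step 3·u (p↓ 1F)) 1·u (step 0·u (p↓ 0F))
      (λ eq → distinct {1F} {0F} (λ ()) (trans (sym 0·u) eq))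
      where
      step : ∀ {x y z} → x · u ≡ y → y · a ≡ z → x · (u ∘ₚ a) ≡ z
      step refl refl = refl

    fixes-6 : ∀ {h : Group.Carrier T} → (∀ x → x · proj₁ h ≡ x) ⊎ (∀ x → x · proj₁ h ≡ x · u) → p 6F · proj₁ h ≡ p 6F
    fixes-6 (inj₁ eq) = eq (p 6F)
    fixes-6 (inj₂ eq) = trans (eq (p 6F)) 6·u

    -- Each such `h` fixes the point 6, so the product takes 7 to 5, whereas both elements of ⟨u⟩
    -- fix 7.
    not-reversed : ∀ {h : Group.Carrier T} → (∀ x → x · proj₁ h ≡ x) ⊎ (∀ x → x · proj₁ h ≡ x · u) →
      ¬ ((∀ x → x · a · proj₁ h · a ≡ x) ⊎ (∀ x → x · a · proj₁ h · a ≡ x · u))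
    not-reversed {h} h∈ = [ (λ eq → 5≢7 (eq (p 7F))) , (λ eq → 5≢7 (trans (eq (p 7F)) 7·u)) ]′
      where
      5≢7 : p 7F · a · proj₁ h · a ≢ p 7F
      5≢7 eq = distinct {5F} {7F} (λ ()) (trans (sym (trans (cong (λ y → y · proj₁ h · a) (p↓ 6F))
        (trans (cong (_· a) (fixes-6 {h} h∈)) (p↓ 5F)))) eq)

  seedFromPermutations :
    Simple T → (∀ M → Mem M u → Mem M a → ∀ {σ} → Mem K σ → Mem M σ) → Transitive K →
    (c : Fin m → Fin n) → (∀ i j → c i ≡ c j → i ≡ j) → Seed m
  seedFromPermutations simple least K-transitive c c-injective = record
    { T                = T
    ; nonabelianSimple = subgroupFinite {Sym n} (symFinite n) K , (λ comm → ua≢au (comm uT aT (p 4F))) , simple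
    ; u                = uT
    ; a                = aT
    ; u²≈ε             = u²
    ; generates        = generates
    ; ua≉au            = λ eq → ua≢au (eq (p 4F))
    ; not-reversed     = λ {h} → not-reversed {h}
    ; noAut            = λ {α} iso αu αa →
        far-noncommuting (commute-transfer T {α} {uT} {aT} {Group._∙_ T uT aT} iso αu αa far-commutes)
    ; c                = cT
    ; c-separate       = λ i j → [ (λ eq → separate i j (eq (p 4F))) , (λ eq → separate i j (trans (eq (p 4F)) 4·u)) ]′
    }
    where
    generates : Generates T uT aT
    generates H u∈H a∈H (σ , σ∈K) = resp H {σ , proj₁ embedded} {σ , σ∈K} (λ _ → refl) (proj₂ embedded)
      where
      embedded : Mem (embed K H) σ
      embedded = least (embed K H) (u∈K , u∈H) (a∈K , a∈H) {σ} σ∈K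

    -- As `u` fixes `p 4F`, the image of this point distinguishes cosets of ⟨u⟩.
    cT : Fin m → Group.Carrier T
    cT i = let σ , σ∈K , _ = K-transitive (p 4F) (c i) in σ , σ∈K

    4·c : ∀ i → p 4F · proj₁ (cT i) ≡ c i
    4·c i = proj₂ (proj₂ (K-transitive (p 4F) (c i)))

    separate : ∀ i j → p 4F · proj₁ (cT i) · flip (proj₁ (cT j)) ≡ p 4F → i ≡ j
    separate i j eq = c-injective i j (trans (sym (4·c i)) (trans
      (trans (sym (Perm.inverseʳ (proj₁ (cT j)))) (cong (_· proj₁ (cT j)) eq)) (4·c j)))

-- Alternating groups of odd degree as seeds

module TwoGenerated {G : Group 0ℓ 0ℓ} (finite : FiniteGroup G) (u a : Group.Carrier G) where
  open Group G hiding (setoid) renaming (refl to ≈-refl; sym to ≈-sym; trans to ≈-trans)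
  open FiniteSearch (proj₂ finite) using (_≈?_)

  private
    Generator : Pred Carrier 0ℓ
    Generator x = x ≈ u ⊎ x ≈ a

    generator? : Decidable Generator
    generator? x = (x ≈? u) ⊎-dec (x ≈? a)

    generator-resp : ∀ {x y} → x ≈ y → Generator x → Generator y
    generator-resp x≈y (inj₁ p) = inj₁ (≈-trans (≈-sym x≈y) p)
    generator-resp x≈y (inj₂ p) = inj₂ (≈-trans (≈-sym x≈y) p)

    module Span = Generated G finite generator? generator-resp

  abstract
    ⟨u,a⟩ : Subgroup G
    ⟨u,a⟩ = Span.span

    u∈⟨u,a⟩ : Mem ⟨u,a⟩ u
    u∈⟨u,a⟩ = Span.generator∈span (inj₁ ≈-refl)

    a∈⟨u,a⟩ : Mem ⟨u,a⟩ a
    a∈⟨u,a⟩ = Span.generator∈span (inj₂ ≈-refl)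

    ⟨u,a⟩-least : ∀ (K : Subgroup G) → Mem K u → Mem K a → ∀ {x} → Mem ⟨u,a⟩ x → Mem K x
    ⟨u,a⟩-least K u∈K a∈K = Span.span-least K
      [ (λ x≈u → resp K (≈-sym x≈u) u∈K) , (λ x≈a → resp K (≈-sym x≈a) a∈K) ]′

generated-by-threeCycles⇒simple : ∀ {n} → 8 < n → (K : PermGroup n) → AllPairs K → Nontrivial K →
  (∀ M → AllThreeCycles M → ∀ {σ} → Mem K σ → Mem M σ) → Simple (subgroup→group K)
generated-by-threeCycles⇒simple {n} 8<n K pairs nt generated = subgroup-simple (symFinite n) K nt
  (λ M M⊴K M-nt {σ} → generated M (NormalInAlternating.nontrivial⇒all-threeCycles 8<n K pairs M M⊴K M-nt) {σ})

module AlternatingSeed (m : ℕ) where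

  private
    e : ℕ
    e = double m

  open GeneratingPair e

  private
    -- `Alt-pairs` and `threeCycles⇒Alt` bound this group from below and from above, which
    -- identifies it as the alternating group.
    Alt : PermGroup (11 + e)
    Alt = TwoGenerated.⟨u,a⟩ (symFinite (11 + e)) u a

    u∈Alt : Mem Alt u
    u∈Alt = TwoGenerated.u∈⟨u,a⟩ (symFinite (11 + e)) u a

    a∈Alt : Mem Alt a
    a∈Alt = TwoGenerated.a∈⟨u,a⟩ (symFinite (11 + e)) u a

    Alt-least : ∀ K → Mem K u → Mem K a → ∀ {σ} → Mem Alt σ → Mem K σ
    Alt-least K u∈K a∈K {σ} = TwoGenerated.⟨u,a⟩-least (symFinite (11 + e)) u a K u∈K a∈K {σ}

    Alt-pairs : AllPairs Alt
    Alt-pairs = generates-allPairs Alt u∈Alt a∈Alt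

    threeCycles⇒Alt : ∀ M → AllThreeCycles M → ∀ {σ} → Mem Alt σ → Mem M σ
    threeCycles⇒Alt M three {σ} = Alt-least M
      -- The two inner transpositions (1 2) cancel, leaving (0 1)(2 3).
      (resp M {threeCycle 0F 1F 2F ∘ₚ threeCycle 1F 2F 3F} {u}
        (λ x → cong (_· transpose 2F 3F) (transpose-involutive 1F 2F (x · transpose 0F 1F)))
        (∙∈ M {threeCycle 0F 1F 2F} {threeCycle 1F 2F 3F} (three 0F 1F 2F (λ ()) (λ ()) (λ ())) (three 1F 2F 3F (λ ()) (λ ()) (λ ()))))
      -- `double (5 + m)` computes to `10 + e`, so the degree `11 + e` is odd.
      (cycle-even (5 + m) M three) {σ}

    Alt-simple : Simple (subgroup→group Alt)
    Alt-simple = generated-by-threeCycles⇒simple (ℕₚ.m≤m+n 9 (2 + e)) Alt Alt-pairs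
      (u , u∈Alt , λ eq → case eq 0F of λ ()) threeCycles⇒Alt

    p : Fin 8 → Points
    p i = inject≤ i (ℕₚ.m≤m+n 8 (3 + e))

    p↓ : ∀ i → p (suc i) · a ≡ p (inject₁ i)
    p↓ 0F = cycle-suc (10 + e) 0F
    p↓ 1F = cycle-suc (10 + e) 1F
    p↓ 2F = cycle-suc (10 + e) 2F
    p↓ 3F = cycle-suc (10 + e) 3F
    p↓ 4F = cycle-suc (10 + e) 4F
    p↓ 5F = cycle-suc (10 + e) 5F
    p↓ 6F = cycle-suc (10 + e) 6F

    m≤11+e : m ≤ 11 + e
    m≤11+e = ℕₚ.≤-trans (m≤double m) (ℕₚ.m≤n+m e 11)
      where
      m≤double : ∀ m → m ≤ double m
      m≤double zero    = z≤n
      m≤double (suc m) = s≤s (ℕₚ.m≤n⇒m≤1+n (m≤double m))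

  seed : Seed m
  seed = SeedFromPermutations.seedFromPermutations Alt u a u∈Alt a∈Alt p (inject≤-injective _ _ _ _) p↓ (λ _ → refl)
    Alt-simple Alt-least (allPairs⇒transitive (ℕₚ.m≤m+n 4 (7 + e)) Alt Alt-pairs)
    (λ i → inject≤ i m≤11+e) (inject≤-injective m≤11+e m≤11+e)

theorem1p3 : (∀ {n : ℕ} (Γ : Graph n) (G : PermGroup n) → BasicQuasiprimitive Γ G →
    Σ[ N ∈ PermGroup n ] Σ[ T ∈ Group 0ℓ 0ℓ ] Σ[ k ∈ ℕ ]
    ( SocleIsPower G N T k
    × k ≤ 2
    × ( k ≡ 1
    ⊎ (k ≡ 2 × N ⊴ G × IndexTwo N G × IsTwistedWreath T Γ G N)
    ⊎ (k ≡ 2 × ¬ Regular N))))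
    × Many AlmostSimpleExample
    × Many NonregularSquareExample
theorem1p3 = Classification.classification
           , (λ m → AlmostSimple.example (AlternatingSeed.seed m))
           , (λ m → WreathExample.example (AlternatingSeed.seed m))
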